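{- Let $G$ be a connected graph of order $n$ with independence number $\alpha(G)$. Then $$m_{D^{L}(G)}[n,n+\alpha(G))\leq n-\alpha(G).$$ For $\alpha(G)=1$ or $\alpha(G)=n-1$, equality holds if and only if $G\cong K_n$ or $G\cong S_n$. Moreover, for all integers $n$ and $\alpha$ with $2\leq \alpha\leq n-2$, the bound is sharp: the graph $SK_{n,\alpha}$ (which has order $n$ and independence number $\alpha$) attains equality.
   Context: All graphs are finite, simple and connected. $K_n$ is the complete graph and $S_n$ the star graph on $n$ vertices. $SK_{n,\alpha}$ is the complete split graph, i.e. the complement of the disjoint union of a clique $K_\alpha$ and $n-\alpha$ isolated vertices. For a connected graph $G$ with vertex set $\{v_1,\dots,v_n\}$, $d_{uv}$ is the length of a shortest path between $u$ and $v$, $D(G)=(d_{uv})$ is the distance matrix, $Tr(v)=\sum_{u\in V(G)}d_{uv}$ is the transmission of $v$, and the distance Laplacian matrix is $D^L(G)=\mathrm{diag}(Tr(v_1),\dots,Tr(v_n))-D(G)$. Its eigenvalues (all real) are the distance Laplacian eigenvalues of $G$. For an interval $I\subseteq\mathbb{R}$, $m_{D^L(G)}I$ denotes the number of distance Laplacian eigenvalues of $G$, counted with multiplicity, lying in $I$. -}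

module Defs where

open import Level using (_⊔_; suc; 0ℓ)
open import Algebra.Bundles using (CommutativeRing; Semiring)
open import Algebra.Structures using (IsCommutativeRing)
import Algebra.Definitions.RawSemiring as RawSemiringDefs
open import Data.Fin.Base using (Fin; toℕ; punchIn) renaming (zero to fzero; suc to fsuc)
import Data.Fin.Properties as Fin
open import Data.Fin.Permutation using (Permutation; _⟨$⟩ʳ_)
open import Data.Fin.Subset using (Subset; _∈_; ∣_∣)
import Data.Nat.Base as ℕ
open ℕ using (ℕ; z≤n; s≤s)
import Data.Nat.Properties as ℕ
open import Data.Product.Base using (Σ; ∃; _×_; _,_; proj₁)
open import Data.Sum.Base using (_⊎_; swap)
open import Data.Vec.Base using (Vec; lookup; count)
open import Data.Vec.Functional using (Vector)
open import Function.Base using (_∘_)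
open import Function.Bundles using (_⇔_)
open import Relation.Binary.Core using (Rel)
open import Relation.Binary.Definitions using (Symmetric; Irreflexive)
  renaming (Decidable to Decidable₂)
open import Relation.Binary.PropositionalEquality as ≡ using (_≡_; _≢_; refl)
import Relation.Binary.Construct.NonStrictToStrict as ToStrict
open import Relation.Binary.Structures using (IsDecTotalOrder)
open import Relation.Nullary using (¬_; Dec; yes; no; contradiction)
open import Relation.Nullary.Decidable using (map′; ¬?; _×-dec_; _⊎-dec_)
open import Relation.Unary using (Pred; Decidable)

-- The real numbers, characterised (up to isomorphism) as the complete ordered
-- field.  Classically ℝ is such a structure.

record RealNumbers c ℓ₁ ℓ₂ : Set (suc (c ⊔ ℓ₁ ⊔ ℓ₂)) where
  infix  8 -_
  infixl 7 _*_
  infixl 6 _+_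
  infix  4 _≈_ _≤_
  field
    Carrier           : Set c
    _≈_               : Rel Carrier ℓ₁
    _≤_               : Rel Carrier ℓ₂
    _+_ _*_           : Carrier → Carrier → Carrier
    -_                : Carrier → Carrier
    0# 1#             : Carrier
    isCommutativeRing : IsCommutativeRing _≈_ _+_ _*_ -_ 0# 1#
    0≉1               : ¬ 0# ≈ 1#
    inverse           : ∀ x → ¬ x ≈ 0# → ∃ λ y → x * y ≈ 1#
    isDecTotalOrder   : IsDecTotalOrder _≈_ _≤_
    +-monoˡ-≤         : ∀ z {x y} → x ≤ y → x + z ≤ y + z
    *-nonNegative     : ∀ {x y} → 0# ≤ x → 0# ≤ y → 0# ≤ x * y

  UpperBound : ∀ {p} → Pred Carrier p → Pred Carrier (c ⊔ ℓ₂ ⊔ p)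
  UpperBound P b = ∀ x → P x → x ≤ b

  field
    supremum : (P : Pred Carrier (c ⊔ ℓ₁ ⊔ ℓ₂)) → ∃ P → ∃ (UpperBound P) →
               ∃ λ s → UpperBound P s × (∀ b → UpperBound P b → s ≤ b)

  commutativeRing : CommutativeRing c ℓ₁
  commutativeRing = record { isCommutativeRing = isCommutativeRing }

  open CommutativeRing commutativeRing public using (_-_; semiring)
  open Semiring semiring using (rawSemiring)
  open RawSemiringDefs rawSemiring public using (sum; product)
  open IsDecTotalOrder isDecTotalOrder public using (_≤?_; _≟_)
  open ToStrict _≈_ _≤_ public using (_<_; <-decidable)

  fromℕ : ℕ → Carrier
  fromℕ k = RawSemiringDefs._×_ rawSemiring k 1#

------------------------------------------------------------------------

record Graph (n : ℕ) : Set₁ where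
  field
    Adj    : Rel (Fin n) 0ℓ
    adj?   : Decidable₂ Adj
    sym    : Symmetric Adj
    irrefl : Irreflexive _≡_ Adj

open Graph public using (Adj; adj?)

infix 4 _≅_

_≅_ : ∀ {m n} → Graph m → Graph n → Set
_≅_ {m} {n} G H =
  Σ (Permutation m n) λ π → ∀ u v → Adj G u v ⇔ Adj H (π ⟨$⟩ʳ u) (π ⟨$⟩ʳ v)

data Walk {n} (G : Graph n) : ℕ → Fin n → Fin n → Set where
  []  : ∀ {u} → Walk G 0 u u
  _∷_ : ∀ {k u v w} → Adj G u v → Walk G k v w → Walk G (ℕ.suc k) u w

Connected : ∀ {n} → Graph n → Set
Connected G = ∀ u v → ∃ λ k → Walk G k u v

walk? : ∀ {n} (G : Graph n) (u v : Fin n) → Decidable (λ k → Walk G k u v)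
walk? G u v ℕ.zero    = map′ (λ { refl → [] }) (λ { [] → refl }) (u Fin.≟ v)
walk? G u v (ℕ.suc k) =
  map′ (λ { (_ , a , p) → a ∷ p }) (λ { (a ∷ p) → _ , a , p })
       (Fin.any? λ w → adj? G u w ×-dec walk? G w v k)

Least : ∀ {p} → Pred ℕ p → Pred ℕ p
Least P m = P m × (∀ j → P j → m ℕ.≤ j)

least : ∀ {p} {P : Pred ℕ p} → Decidable P → ∀ m → P m → ∃ (Least P)
least P? ℕ.zero p = 0 , p , λ _ _ → z≤n
least {P = P} P? (ℕ.suc m) p with P? 0
... | yes p₀ = 0 , p₀ , λ _ _ → z≤n
... | no ¬p₀ with least {P = P ∘ ℕ.suc} (P? ∘ ℕ.suc) m p
...   | k , pk , k≤ = ℕ.suc k , pk , λ where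
        ℕ.zero    p₀ → contradiction p₀ ¬p₀
        (ℕ.suc j) pj → s≤s (k≤ j pj)

-- Since a shortest walk repeats no vertex, this is the length of a shortest
-- path.
dist : ∀ {n} (G : Graph n) → Connected G → Fin n → Fin n → ℕ
dist G conn u v =
  let m , p = conn u v in proj₁ (least (walk? G u v) m p)

Independent : ∀ {n} → Graph n → Subset n → Set
Independent G S = ∀ {u v} → u ∈ S → v ∈ S → ¬ Adj G u v

IndependenceNumber : ∀ {n} → Graph n → ℕ → Set
IndependenceNumber G α =
  (∃ λ S → Independent G S × ∣ S ∣ ≡ α) ×
  (∀ S → Independent G S → ∣ S ∣ ℕ.≤ α)

complement : ∀ {n} → Graph n → Graph n
complement G = record
  { Adj    = λ u v → u ≢ v × ¬ Adj G u v
  ; adj?   = λ u v → ¬? (u Fin.≟ v) ×-dec ¬? (adj? G u v)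
  ; sym    = λ (u≢v , ¬a) → u≢v ∘ ≡.sym , ¬a ∘ Graph.sym G
  ; irrefl = λ u≡v (u≢v , _) → u≢v u≡v
  }

K : ∀ n → Graph n
K n = record
  { Adj    = _≢_
  ; adj?   = λ u v → ¬? (u Fin.≟ v)
  ; sym    = λ u≢v → u≢v ∘ ≡.sym
  ; irrefl = λ u≡v u≢v → u≢v u≡v
  }

-- The centre is the vertex numbered 0.
S : ∀ n → Graph n
S n = record
  { Adj    = λ u v → u ≢ v × (toℕ u ≡ 0 ⊎ toℕ v ≡ 0)
  ; adj?   = λ u v → ¬? (u Fin.≟ v) ×-dec (toℕ u ℕ.≟ 0 ⊎-dec toℕ v ℕ.≟ 0)
  ; sym    = λ (u≢v , c) → u≢v ∘ ≡.sym , swap c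
  ; irrefl = λ u≡v (u≢v , _) → u≢v u≡v
  }

-- For α ≤ n, the disjoint union of a clique on the vertices numbered below α
-- and n - α isolated vertices.
cliqueWithIsolated : ∀ n → ℕ → Graph n
cliqueWithIsolated n α = record
  { Adj    = λ u v → u ≢ v × toℕ u ℕ.< α × toℕ v ℕ.< α
  ; adj?   = λ u v → ¬? (u Fin.≟ v) ×-dec (toℕ u ℕ.<? α ×-dec toℕ v ℕ.<? α)
  ; sym    = λ (u≢v , u< , v<) → u≢v ∘ ≡.sym , v< , u<
  ; irrefl = λ u≡v (u≢v , _) → u≢v u≡v
  }

SK : ∀ n → ℕ → Graph n
SK n α = complement (cliqueWithIsolated n α)

------------------------------------------------------------------------

module _ {c ℓ₁ ℓ₂} (ℝ : RealNumbers c ℓ₁ ℓ₂) where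
  open RealNumbers ℝ

  Matrix : ℕ → Set c
  Matrix n = Fin n → Fin n → Carrier

  diag : ∀ {n} → Vector Carrier n → Matrix n
  diag t i j with i Fin.≟ j
  ... | yes _ = t i
  ... | no  _ = 0#

  sign : ∀ {n} → Fin n → Carrier
  sign fzero    = 1#
  sign (fsuc j) = - sign j

  -- Laplace expansion along the first row.
  det : ∀ {n} → Matrix n → Carrier
  det {ℕ.zero}  M = 1#
  det {ℕ.suc n} M =
    sum λ j → sign j * M fzero j * det (λ r s → M (fsuc r) (punchIn j s))

  charPoly : ∀ {n} → Matrix n → Carrier → Carrier
  charPoly M x = det λ i j → diag (λ _ → x) i j - M i j

  -- The entries of λs are the eigenvalues of M, each listed as often as its
  -- multiplicity as a root of the characteristic polynomial.  As the field is
  -- infinite, polynomials may be compared through their values.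
  Eigenvalues : ∀ {n} → Matrix n → Vec Carrier n → Set (c ⊔ ℓ₁)
  Eigenvalues M λs = ∀ x → charPoly M x ≈ product λ i → x - lookup λs i

  infix 4 _∈[_,_⟩

  _∈[_,_⟩ : Carrier → Carrier → Carrier → Set (ℓ₁ ⊔ ℓ₂)
  x ∈[ a , b ⟩ = a ≤ x × x < b

  _∈?[_,_⟩ : ∀ x a b → Dec (x ∈[ a , b ⟩)
  x ∈?[ a , b ⟩ = (a ≤? x) ×-dec <-decidable _≟_ _≤?_ x b

  -- Exactly k eigenvalues of M, counted with multiplicity, lie in [a , b).
  EigenvalueCount : ∀ {n} → Matrix n → Carrier → Carrier → ℕ → Set (c ⊔ ℓ₁)
  EigenvalueCount M a b k =
    ∃ λ λs → Eigenvalues M λs × count (_∈?[ a , b ⟩) λs ≡ k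

  module _ {n} (G : Graph n) (conn : Connected G) where

    distanceMatrix : Matrix n
    distanceMatrix u v = fromℕ (dist G conn u v)

    transmission : Vector Carrier n
    transmission v = sum λ u → distanceMatrix u v

    distanceLaplacian : Matrix n
    distanceLaplacian u v = diag transmission u v - distanceMatrix u v

    -- The number of distance Laplacian eigenvalues of G in [a , b) is k.
    DLEigenvalueCount : Carrier → Carrier → ℕ → Set (c ⊔ ℓ₁)
    DLEigenvalueCount = EigenvalueCount distanceLaplacian

-- If T is independent, then d(u,v) ≥ 1 + [u ∈ T][v ∈ T] for u ≠ v, so the quadratic
-- form Σ d(u,v) (y_u - y_v)² / 2 of the distance Laplacian L is at least (n + ∣T∣) ∣y∣²
-- on the vectors y with support in T and sum 0.  These are cut out by n - ∣T∣ + 1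
-- linear functionals, hence at most that many eigenvalues lie below n + ∣T∣, and one
-- of them is 0 < n.  The passage from the form to the multiplicities in det (x - L)
-- splits off one eigenvector after the other, replacing (1 , L) by the Gram matrices
-- of both forms on the orthogonal complement.  A connected graph with α = 1 or
-- α = n - 1 is a complete split graph, for which the inequality for d is an equality,
-- and L has an explicit eigenbasis.
module Submission where

open import Defs
open import Level using (_⊔_)
import Algebra.Solver.Ring
import Algebra.Solver.Ring.AlmostCommutativeRing as ACR
import Algebra.Properties.Semiring.Mult
import Algebra.Properties.Monoid.Mult.TCOptimised
import Algebra.Properties.Semiring.Sum
import Algebra.Properties.Ring
import Algebra.Properties.AbelianGroup
open import Algebra.Bundles using (CommutativeRing)
open import Data.Bool.Base using (if_then_else_)
open import Data.Fin.Base using (Fin; zero; suc; toℕ; inject₁; punchIn; punchOut; fromℕ<)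
import Data.Fin.Properties as Fin
open import Data.Fin.Permutation as Perm using (_⟨$⟩ʳ_)
open import Data.Fin.Subset using (Subset; _∈_; _∉_; ∣_∣; ⁅_⁆; _∪_; ∁; inside; outside)
import Data.Fin.Subset as Sub
import Data.Fin.Subset.Properties as Sub
open import Data.Fin.Subset.Properties using (_∈?_)
open import Data.Integer.Base as ℤ using (ℤ; +_; -[1+_])
import Data.Integer.Properties as ℤ
open import Data.Maybe.Base using (Maybe; just; nothing)
open import Data.Nat.Base as ℕ using (ℕ; zero; suc; z≤n; s≤s)
import Data.Nat.Properties as ℕ
open import Data.Product.Base using (Σ; ∃; _×_; _,_; proj₁; proj₂)
open import Data.Sum.Base as Sum using (_⊎_; inj₁; inj₂; [_,_]′)
open import Data.Vec.Base using (Vec; []; _∷_; lookup; count; tabulate; here; there)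
open import Data.Vec.Properties using (count≤n; []=⇒lookup)
open import Data.Vec.Functional using (Vector; insertAt)
open import Data.Vec.Functional.Properties using (insertAt-lookup; insertAt-punchIn)
open import Function.Base using (_∘_; case_of_)
open import Function.Bundles using (_⇔_; mk⇔; Equivalence)
open import Relation.Binary.PropositionalEquality as ≡ using (_≡_; _≢_)
open import Relation.Binary.Definitions using (tri<; tri≈; tri>)
open import Relation.Binary.Structures using (IsDecTotalOrder)
import Relation.Binary.Reasoning.Setoid
open import Relation.Nullary using (¬_; Dec; yes; no; contradiction)
open import Relation.Nullary.Decidable using (¬?; _×-dec_; decidable-stable)
open import Relation.Unary using (Decidable)

-- The eigenvalues are given as a list of roots of the characteristic polynomial, and that
-- polynomial is known only through its values. Hence no diagonalisation of L is presupposed: a root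
-- makes a matrix singular, elimination turns singularity into an eigenvector, and the rest of the
-- list has to be recognised as the root list of a smaller problem. Keeping the shape det (x B - M)
-- with a positive definite B allows any basis of the orthogonal complement, so no vector is
-- normalised and no square root is taken; a change of basis costs only a nonzero constant factor.
-- Splitting off the factor x - a as an identity between functions leaves the point x = a open,
-- which is why polynomial functions and their infinitely many zeros appear. The determinant is
-- defined by expansion along the first row, whereas a change of basis needs its multiplicativity;
-- that comes from the uniqueness of alternating multilinear functions of the columns.

-- Distances, in general and in complete split graphs

module _ {n} (G : Graph n) (conn : Connected G) where

  dist-least : ∀ u v → Least (λ k → Walk G k u v) (dist G conn u v)
  dist-least u v = proj₂ (least (walk? G u v) _ (proj₂ (conn u v)))

  private
    snoc : ∀ {k u v w} → Walk G k u v → Adj G v w → Walk G (suc k) u w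
    snoc []       b = b ∷ []
    snoc (a ∷ p) b = a ∷ snoc p b

    reverse : ∀ {k u v} → Walk G k u v → Walk G k v u
    reverse []      = []
    reverse (a ∷ p) = snoc (reverse p) (Graph.sym G a)

  dist-sym : ∀ u v → dist G conn u v ≡ dist G conn v u
  dist-sym u v = ℕ.≤-antisym (le u v) (le v u)
    where
    le : ∀ u v → dist G conn u v ℕ.≤ dist G conn v u
    le u v = proj₂ (dist-least u v) _ (reverse (proj₁ (dist-least v u)))

  dist≥1 : ∀ {u v} → u ≢ v → 1 ℕ.≤ dist G conn u v
  dist≥1 {u} {v} u≢v = go (proj₁ (dist-least u v))
    where
    go : ∀ {k} → Walk G k u v → 1 ℕ.≤ k
    go []      = contradiction ≡.refl u≢v
    go (_ ∷ _) = s≤s z≤n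

  dist≥2 : ∀ {u v} → u ≢ v → ¬ Adj G u v → 2 ℕ.≤ dist G conn u v
  dist≥2 {u} {v} u≢v ¬adj = go (proj₁ (dist-least u v))
    where
    go : ∀ {k} → Walk G k u v → 2 ℕ.≤ k
    go []            = contradiction ≡.refl u≢v
    go (a ∷ [])      = contradiction a ¬adj
    go (_ ∷ (_ ∷ _)) = s≤s (s≤s z≤n)

  -- In the uses below `u` lies in an independent set, and the neighbour found here is a vertex
  -- outside it.
  firstStep : ∀ {u v} → u ≢ v → ∃ λ w → Adj G u w
  firstStep {u} {v} u≢v = go (proj₂ (conn u v))
    where
    go : ∀ {k} → Walk G k u v → ∃ λ w → Adj G u w
    go []      = contradiction ≡.refl u≢v
    go (a ∷ _) = _ , a

-- Complete graphs, stars and complete split graphs are all of this form.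
record IsSplit {n} (G : Graph n) (T : Subset n) : Set where
  field
    independent : Independent G T
    joined      : ∀ {u v} → u ≢ v → ¬ (u ∈ T × v ∈ T) → Adj G u v

module _ {n} {G : Graph n} {T} (split : IsSplit G T) (conn : Connected G) where
  open IsSplit split

  split-dist-joined : ∀ {u v} → u ≢ v → ¬ (u ∈ T × v ∈ T) → dist G conn u v ≡ 1
  split-dist-joined {u} {v} u≢v ¬both = ℕ.≤-antisym
    (proj₂ (dist-least G conn u v) 1 (joined u≢v ¬both ∷ [])) (dist≥1 G conn u≢v)

  -- Connectedness gives `u` a neighbour `w`; independence puts `w` outside `T`, so `w` is joined to
  -- `v` as well and the walk over `w` has length 2.
  split-dist-independent : ∀ {u v} → u ≢ v → u ∈ T → v ∈ T → dist G conn u v ≡ 2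
  split-dist-independent {u} {v} u≢v u∈T v∈T with firstStep G conn u≢v
  ... | w , u~w = ℕ.≤-antisym
    (proj₂ (dist-least G conn u v) 2 (u~w ∷ (joined w≢v (w∉T ∘ proj₁) ∷ [])))
    (dist≥2 G conn u≢v (independent u∈T v∈T))
    where
    w∉T : w ∉ T
    w∉T w∈T = independent u∈T w∈T u~w
    w≢v : w ≢ v
    w≢v w≡v = w∉T (≡.subst (_∈ T) (≡.sym w≡v) v∈T)

-- Cardinalities and enumerations of finite subsets

two-elements⇒1<∣T∣ : ∀ {n} {T : Subset n} {x y} → x ∈ T → y ∈ T → x ≢ y → 1 ℕ.< ∣ T ∣
two-elements⇒1<∣T∣ {T = T} {x} {y} x∈T y∈T x≢y =
  ≡.subst (ℕ._< ∣ T ∣) (Sub.∣⁅x⁆∣≡1 x) (Sub.p⊂q⇒∣p∣<∣q∣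
    ((λ z∈⁅x⁆ → ≡.subst (_∈ T) (≡.sym (Sub.x∈⁅y⁆⇒x≡y x z∈⁅x⁆)) x∈T) ,
     y , y∈T , Sub.x≢y⇒x∉⁅y⁆ (x≢y ∘ ≡.sym)))

∣T∣<n⇒∃∉ : ∀ {n} (T : Subset n) → ∣ T ∣ ℕ.< n → ∃ λ x → x ∉ T
∣T∣<n⇒∃∉ {n} T ∣T∣<n with Fin.any? (λ x → ¬? (x ∈? T))
... | yes found = found
... | no  ∄x∉T = contradiction
  (≡.subst (ℕ._≤ ∣ T ∣) (Sub.∣⊤∣≡n n)
    (Sub.p⊆q⇒∣p∣≤∣q∣ {p = Sub.⊤} λ {x} _ → decidable-stable (x ∈? T) (λ x∉T → ∄x∉T (x , x∉T))))
  (ℕ.<⇒≱ ∣T∣<n)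

0<∣T∣⇒∃∈ : ∀ {n} (T : Subset n) → 0 ℕ.< ∣ T ∣ → ∃ λ x → x ∈ T
0<∣T∣⇒∃∈ {n} T 0<∣T∣ = let x , x∉∁T = ∣T∣<n⇒∃∉ (∁ T) ∣∁T∣<n in x , Sub.x∉∁p⇒x∈p x∉∁T
  where
  ∣∁T∣<n : ∣ ∁ T ∣ ℕ.< n
  ∣∁T∣<n = ℕ.≤-<-trans (ℕ.≤-reflexive (Sub.∣∁p∣≡n∸∣p∣ T)) (ℕ.∸-monoʳ-< 0<∣T∣ (Sub.∣p∣≤n T))

-- Turns a condition on all elements of `T` into a family indexed by `Fin ∣ T ∣`. Applied to a
-- complement, it lists the functionals that force a vector to vanish off an independent set.
enumerate : ∀ {n} (T : Subset n) → ∃ λ (e : Fin ∣ T ∣ → Fin n) → ∀ {x} → x ∈ T → ∃ λ j → e j ≡ x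
enumerate []            = (λ ()) , λ ()
enumerate (outside ∷ T) with enumerate T
... | e , onto = suc ∘ e , λ where
  (there x∈T) → let j , eⱼ≡x = onto x∈T in j , ≡.cong suc eⱼ≡x
enumerate {suc n} (inside ∷ T) with enumerate T
... | e , onto = e′ , onto′
  where
  e′ : Fin (suc ∣ T ∣) → Fin (suc n)
  e′ zero    = zero
  e′ (suc j) = suc (e j)
  onto′ : ∀ {x} → x ∈ inside ∷ T → ∃ λ j → e′ j ≡ x
  onto′ here        = zero , ≡.refl
  onto′ (there x∈T) = let j , eⱼ≡x = onto x∈T in suc j , ≡.cong suc eⱼ≡x

-- Graphs with extreme independence number

independenceNumber>0 : ∀ {n α} {G : Graph n} → IndependenceNumber G α → Fin n → 0 ℕ.< α
independenceNumber>0 {G = G} (_ , ≤α) x = ≡.subst (ℕ._≤ _) (Sub.∣⁅x⁆∣≡1 x)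
  (≤α ⁅ x ⁆ λ u∈ v∈ → Graph.irrefl G
    (≡.trans (Sub.x∈⁅y⁆⇒x≡y x u∈) (≡.sym (Sub.x∈⁅y⁆⇒x≡y x v∈))))

-- Two nonadjacent vertices would form an independent set of size 2.
independenceNumber-1⇒complete : ∀ {n} {G : Graph n} → IndependenceNumber G 1 →
  ∀ {u v} → u ≢ v → Adj G u v
independenceNumber-1⇒complete {G = G} (_ , ≤1) {u} {v} u≢v =
  decidable-stable (adj? G u v) λ ¬adj →
    ℕ.<⇒≱ (two-elements⇒1<∣T∣ (Sub.x∈p∪q⁺ (inj₁ (Sub.x∈⁅x⁆ u))) (Sub.x∈p∪q⁺ (inj₂ (Sub.x∈⁅x⁆ v))) u≢v)
      (≤1 (⁅ u ⁆ ∪ ⁅ v ⁆) (λ x∈ y∈ → pair ¬adj (element x∈) (element y∈)))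
  where
  element : ∀ {x} → x ∈ ⁅ u ⁆ ∪ ⁅ v ⁆ → x ≡ u ⊎ x ≡ v
  element {x} x∈ with Sub.x∈p∪q⁻ ⁅ u ⁆ ⁅ v ⁆ x∈
  ... | inj₁ x∈⁅u⁆ = inj₁ (Sub.x∈⁅y⁆⇒x≡y u x∈⁅u⁆)
  ... | inj₂ x∈⁅v⁆ = inj₂ (Sub.x∈⁅y⁆⇒x≡y v x∈⁅v⁆)

  pair : ¬ Adj G u v → ∀ {x y} → x ≡ u ⊎ x ≡ v → y ≡ u ⊎ y ≡ v → ¬ Adj G x y
  pair ¬adj (inj₁ ≡.refl) (inj₁ ≡.refl) = Graph.irrefl G ≡.refl
  pair ¬adj (inj₁ ≡.refl) (inj₂ ≡.refl) = ¬adj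
  pair ¬adj (inj₂ ≡.refl) (inj₁ ≡.refl) = ¬adj ∘ Graph.sym G
  pair ¬adj (inj₂ ≡.refl) (inj₂ ≡.refl) = Graph.irrefl G ≡.refl

complete⇒≅K : ∀ {n} {G : Graph n} → (∀ {u v} → u ≢ v → Adj G u v) → G ≅ K n
complete⇒≅K {G = G} complete = Perm.id , λ u v →
  mk⇔ (λ u~v u≡v → Graph.irrefl G u≡v u~v) complete

module _ {n} {G : Graph n} {T : Subset n} (independent : Independent G T) (1+∣T∣≡n : suc ∣ T ∣ ≡ n) where

  private
    outside-unique : ∀ {u v} → u ∉ T → v ∉ T → u ≡ v
    outside-unique {u} {v} u∉T v∉T = decidable-stable (u Fin.≟ v) λ u≢v →
      ℕ.<⇒≱ (two-elements⇒1<∣T∣ (Sub.x∉p⇒x∈∁p u∉T) (Sub.x∉p⇒x∈∁p v∉T) u≢v)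
        (ℕ.≤-reflexive (≡.trans (Sub.∣∁p∣≡n∸∣p∣ T)
          (≡.trans (≡.cong (ℕ._∸ ∣ T ∣) (≡.sym 1+∣T∣≡n)) (ℕ.m+n∸n≡m 1 ∣ T ∣))))

    -- A vertex of `T` has some neighbour, which independence forces outside `T`; only one vertex
    -- lies there, so this neighbour is `u`.
    adjacent-to-outside : Connected G → ∀ {u v} → u ≢ v → u ∉ T → Adj G v u
    adjacent-to-outside conn {u} {v} u≢v u∉T with v ∈? T
    ... | no  v∉T = contradiction (outside-unique u∉T v∉T) u≢v
    ... | yes v∈T with firstStep G conn (u≢v ∘ ≡.sym)
    ...   | w , v~w = ≡.subst (Adj G v) (outside-unique (λ w∈T → independent v∈T w∈T v~w) u∉T) v~w

  connected⇒split : Connected G → IsSplit G T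
  connected⇒split conn = record
    { independent = independent
    ; joined      = λ {u} {v} u≢v ¬both → case u ∈? T of λ where
        (no  u∉T) → Graph.sym G (adjacent-to-outside conn u≢v u∉T)
        (yes u∈T) → adjacent-to-outside conn (u≢v ∘ ≡.sym) (λ v∈T → ¬both (u∈T , v∈T))
    }

  split⇒≅S : IsSplit G T → G ≅ S n
  split⇒≅S split = go n ≡.refl
    where
    open IsSplit split using (joined)
    center : ∃ λ x → x ∉ T
    center = ∣T∣<n⇒∃∉ T (ℕ.≤-reflexive 1+∣T∣≡n)
    z = proj₁ center

    adj⇔ : ∀ u v → Adj G u v ⇔ (u ≢ v × (u ≡ z ⊎ v ≡ z))
    adj⇔ u v = mk⇔
      (λ u~v → (λ u≡v → Graph.irrefl G u≡v u~v) , (case u ∈? T of λ where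
        (no u∉T)  → inj₁ (outside-unique u∉T (proj₂ center))
        (yes u∈T) → inj₂ (outside-unique (λ v∈T → independent u∈T v∈T u~v) (proj₂ center))))
      (λ (u≢v , u≡z⊎v≡z) → joined u≢v λ (u∈T , v∈T) → proj₂ center
        ([ (λ u≡z → ≡.subst (_∈ T) u≡z u∈T) , (λ v≡z → ≡.subst (_∈ T) v≡z v∈T) ]′ u≡z⊎v≡z))

    -- `S n` has its centre at the index zero, which exists only once `n` is seen to be a successor;
    -- the isomorphism is the transposition of that index with the vertex outside `T`.
    go : ∀ m → n ≡ m → G ≅ S n
    go zero    ≡.refl = contradiction 1+∣T∣≡n λ ()
    go (suc m) ≡.refl = π , λ u v → mk⇔
      (λ u~v → let u≢v , u≡z⊎v≡z = Equivalence.to (adj⇔ u v) u~v in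
        u≢v ∘ π-injective , Sum.map π-center π-center u≡z⊎v≡z)
      (λ (πu≢πv , c) → Equivalence.from (adj⇔ u v)
        (πu≢πv ∘ ≡.cong (π ⟨$⟩ʳ_) , Sum.map center-π center-π c))
      where
      π = Perm.transpose z zero
      π-injective : ∀ {u v} → π ⟨$⟩ʳ u ≡ π ⟨$⟩ʳ v → u ≡ v
      π-injective eq = ≡.trans (≡.sym (Perm.inverseˡ π)) (≡.trans (≡.cong (π Perm.⟨$⟩ˡ_) eq) (Perm.inverseˡ π))
      πz≡0 : π ⟨$⟩ʳ z ≡ zero
      πz≡0 with z Fin.≟ z
      ... | yes _   = ≡.refl
      ... | no  z≢z = contradiction ≡.refl z≢z
      π-center : ∀ {u} → u ≡ z → toℕ (π ⟨$⟩ʳ u) ≡ 0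
      π-center u≡z = ≡.cong toℕ (≡.trans (≡.cong (π ⟨$⟩ʳ_) u≡z) πz≡0)
      center-π : ∀ {u} → toℕ (π ⟨$⟩ʳ u) ≡ 0 → u ≡ z
      center-π eq = π-injective (≡.trans (Fin.toℕ-injective eq) (≡.sym πz≡0))

-- The graphs `SK n α`

below : ∀ n → ℕ → Subset n
below zero    α       = []
below (suc n) zero    = outside ∷ below n zero
below (suc n) (suc α) = inside ∷ below n α

∈-below⁺ : ∀ {n α} {u : Fin n} → toℕ u ℕ.< α → u ∈ below n α
∈-below⁺ {suc n} {suc α} {zero}  _         = here
∈-below⁺ {suc n} {suc α} {suc u} (s≤s u<α) = there (∈-below⁺ u<α)

∈-below⁻ : ∀ {n α} {u : Fin n} → u ∈ below n α → toℕ u ℕ.< α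
∈-below⁻ {suc n} {zero}  {suc u} (there u∈) = contradiction (∈-below⁻ u∈) λ ()
∈-below⁻ {suc n} {suc α} {zero}  _          = s≤s z≤n
∈-below⁻ {suc n} {suc α} {suc u} (there u∈) = s≤s (∈-below⁻ u∈)

∣below∣ : ∀ {n α} → α ℕ.≤ n → ∣ below n α ∣ ≡ α
∣below∣ {zero}  {zero}  z≤n       = ≡.refl
∣below∣ {suc n} {zero}  z≤n       = ∣below∣ {n} z≤n
∣below∣ {suc n} {suc α} (s≤s α≤n) = ≡.cong suc (∣below∣ α≤n)

SK-isSplit : ∀ n α → IsSplit (SK n α) (below n α)
SK-isSplit n α = record
  { independent = λ u∈ v∈ (u≢v , ¬both) → ¬both (u≢v , ∈-below⁻ u∈ , ∈-below⁻ v∈)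
  ; joined      = λ u≢v ¬both → u≢v , λ (_ , u<α , v<α) → ¬both (∈-below⁺ u<α , ∈-below⁺ v<α)
  }

-- A vertex outside `below n α` is adjacent to all others, so an independent set containing one is a
-- singleton, and `1 ≤ α` covers it; every other independent set lies in `below n α`.
SK-independenceNumber : ∀ {n α} → 1 ℕ.≤ α → α ℕ.≤ n → IndependenceNumber (SK n α) α
SK-independenceNumber {n} {α} 1≤α α≤n =
  (below n α , independent , ∣below∣ α≤n) , bound
  where
  open IsSplit (SK-isSplit n α)
  bound : ∀ T → Independent (SK n α) T → ∣ T ∣ ℕ.≤ α
  bound T indep with Fin.any? (λ v → (v ∈? T) ×-dec ¬? (v ∈? below n α))
  ... | yes (v , v∈T , v∉) = ℕ.≤-trans
    (ℕ.≤-trans (Sub.p⊆q⇒∣p∣≤∣q∣ T⊆⁅v⁆) (ℕ.≤-reflexive (Sub.∣⁅x⁆∣≡1 v))) 1≤α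
    where
    T⊆⁅v⁆ : T Sub.⊆ ⁅ v ⁆
    T⊆⁅v⁆ {u} u∈T with u Fin.≟ v
    ... | yes ≡.refl = Sub.x∈⁅x⁆ u
    ... | no  u≢v    = contradiction (joined u≢v (v∉ ∘ proj₂)) (indep u∈T v∈T)
  ... | no ∄v = ≡.subst (∣ T ∣ ℕ.≤_) (∣below∣ α≤n) (Sub.p⊆q⇒∣p∣≤∣q∣ λ {v} v∈T →
    decidable-stable (v ∈? below n α) λ v∉ → ∄v (v , v∈T , v∉))

SK-connected : ∀ {n α} → α ℕ.< n → Connected (SK n α)
SK-connected {n} {α} α<n u v with u Fin.≟ v | (u ∈? below n α) ×-dec (v ∈? below n α)
... | yes ≡.refl | _ = 0 , []
... | no u≢v | no ¬both = 1 , joined u≢v ¬both ∷ []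
  where open IsSplit (SK-isSplit n α)
... | no u≢v | yes (u∈ , v∈) =
  2 , joined (apart u∈) (w∉ ∘ proj₂) ∷ (joined (apart v∈ ∘ ≡.sym) (w∉ ∘ proj₁) ∷ [])
  where
  open IsSplit (SK-isSplit n α)
  -- The vertex numbered `α` is the first one outside the independent set and serves as common
  -- neighbour of any two vertices in it.
  w = fromℕ< α<n
  w∉ : w ∉ below n α
  w∉ w∈ = ℕ.<-irrefl (Fin.toℕ-fromℕ< α<n) (∈-below⁻ w∈)
  apart : ∀ {x} → x ∈ below n α → x ≢ w
  apart x∈ x≡w = w∉ (≡.subst (_∈ below n α) x≡w x∈)

module _ {c ℓ₁ ℓ₂} (ℝ : RealNumbers c ℓ₁ ℓ₂) where

  open RealNumbers ℝ
  open CommutativeRing commutativeRing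
    using (refl; sym; trans; reflexive; setoid; ring; +-cong; +-congˡ; +-congʳ; *-cong;
           *-congˡ; *-congʳ; -‿cong; +-comm; +-assoc; *-comm; *-assoc; +-identityˡ;
           +-identityʳ; *-identityˡ; *-identityʳ; distribʳ; zeroˡ; zeroʳ;
           -‿inverseʳ; +-monoid; +-abelianGroup)
  open IsDecTotalOrder isDecTotalOrder
    using (total; antisym)
    renaming (refl to ≤-refl; trans to ≤-trans; reflexive to ≤-reflexive;
              ≤-respˡ-≈ to ≤-respˡ; ≤-respʳ-≈ to ≤-respʳ)
  open Algebra.Properties.Semiring.Sum semiring
    using (sum-cong-≋; sum-remove; sum-replicate; sum-replicate-zero; ∑-distrib-+; ∑-comm;
           *-distribˡ-sum; *-distribʳ-sum)
  open Algebra.Properties.Ring ring using (-‿distribˡ-*; -‿distribʳ-*)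
  open Algebra.Properties.AbelianGroup +-abelianGroup
    using (⁻¹-involutive; ε⁻¹≈ε; ⁻¹-∙-comm; x∙y⁻¹≈ε⇒x≈y; x≈y⇒x∙y⁻¹≈ε)
  open Algebra.Properties.Semiring.Mult semiring using (×-homo-+; ×1-homo-*)
  open Relation.Binary.Reasoning.Setoid setoid

  infix 4 _≉_
  _≉_ : Carrier → Carrier → Set _
  x ≉ y = ¬ x ≈ y

  -- Integer coefficients let the solver decide cancellations, which it could
  -- not do with coefficients in the abstract field.

  private
    module Mult′ = Algebra.Properties.Monoid.Mult.TCOptimised +-monoid

    -- With the optimised multiple the images of 0 and 1 reduce to `0#` and `1#`, so solver
    -- equations written with `:0` and `:1` match goals that contain the field constants.
    fromℤ : ℤ → Carrier
    fromℤ (+ n)    = n Mult′.× 1#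
    fromℤ -[1+ n ] = - (suc n Mult′.× 1#)

    fromℤ-+ : ∀ n → fromℤ (+ n) ≈ fromℕ n
    fromℤ-+ n = sym (Mult′.×ᵤ≈× n 1#)

    fromℤ-neg : ∀ n → fromℤ (ℤ.- + n) ≈ - fromℕ n
    fromℤ-neg zero    = sym ε⁻¹≈ε
    fromℤ-neg (suc n) = -‿cong (fromℤ-+ (suc n))

    +-cancel-1 : ∀ a b → a - b ≈ (1# + a) - (1# + b)
    +-cancel-1 a b = begin
      a - b                     ≈⟨ +-identityˡ _ ⟨
      0# + (a - b)              ≈⟨ +-congʳ (-‿inverseʳ 1#) ⟨
      (1# - 1#) + (a - b)       ≈⟨ +-assoc _ _ _ ⟩
      1# + (- 1# + (a - b))     ≈⟨ +-congˡ (+-comm _ _) ⟩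
      1# + ((a - b) + - 1#)     ≈⟨ +-congˡ (+-assoc _ _ _) ⟩
      1# + (a + (- b + - 1#))   ≈⟨ +-assoc _ _ _ ⟨
      (1# + a) + (- b + - 1#)   ≈⟨ +-congˡ (+-comm _ _) ⟩
      (1# + a) + (- 1# + - b)   ≈⟨ +-congˡ (⁻¹-∙-comm 1# b) ⟩
      (1# + a) - (1# + b)       ∎

    fromℤ-⊖ : ∀ m n → fromℤ (m ℤ.⊖ n) ≈ fromℕ m - fromℕ n
    fromℤ-⊖ m       zero    = trans (fromℤ-+ m) (sym (trans (+-congˡ ε⁻¹≈ε) (+-identityʳ _)))
    fromℤ-⊖ zero    (suc n) = trans (fromℤ-neg (suc n)) (sym (+-identityˡ _))
    fromℤ-⊖ (suc m) (suc n) = begin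
      fromℤ (suc m ℤ.⊖ suc n)   ≡⟨ ≡.cong fromℤ (ℤ.[1+m]⊖[1+n]≡m⊖n m n) ⟩
      fromℤ (m ℤ.⊖ n)           ≈⟨ fromℤ-⊖ m n ⟩
      fromℕ m - fromℕ n         ≈⟨ +-cancel-1 _ _ ⟩
      fromℕ (suc m) - fromℕ (suc n) ∎

    fromℤ-homo-+ : ∀ i j → fromℤ (i ℤ.+ j) ≈ fromℤ i + fromℤ j
    fromℤ-homo-+ (+ m) (+ n) = begin
      fromℤ (+ (m ℕ.+ n))  ≈⟨ fromℤ-+ (m ℕ.+ n) ⟩
      fromℕ (m ℕ.+ n)      ≈⟨ ×-homo-+ 1# m n ⟩
      fromℕ m + fromℕ n    ≈⟨ +-cong (fromℤ-+ m) (fromℤ-+ n) ⟨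
      fromℤ (+ m) + fromℤ (+ n) ∎
    fromℤ-homo-+ (+ m) -[1+ n ] =
      trans (fromℤ-⊖ m (suc n)) (sym (+-cong (fromℤ-+ m) (fromℤ-neg (suc n))))
    fromℤ-homo-+ -[1+ m ] (+ n) =
      trans (fromℤ-⊖ n (suc m))
        (trans (+-comm _ _) (sym (+-cong (fromℤ-neg (suc m)) (fromℤ-+ n))))
    fromℤ-homo-+ -[1+ m ] -[1+ n ] = begin
      fromℤ (ℤ.- + (suc (suc (m ℕ.+ n))))  ≡⟨ ≡.cong (λ k → fromℤ (ℤ.- + suc k)) (ℕ.+-suc m n) ⟨
      fromℤ (ℤ.- + (suc m ℕ.+ suc n))      ≈⟨ fromℤ-neg (suc m ℕ.+ suc n) ⟩
      - fromℕ (suc m ℕ.+ suc n)            ≈⟨ -‿cong (×-homo-+ 1# (suc m) (suc n)) ⟩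
      - (fromℕ (suc m) + fromℕ (suc n))    ≈⟨ ⁻¹-∙-comm _ _ ⟨
      - fromℕ (suc m) + - fromℕ (suc n)    ≈⟨ +-cong (fromℤ-neg (suc m)) (fromℤ-neg (suc n)) ⟨
      fromℤ -[1+ m ] + fromℤ -[1+ n ]      ∎

    fromℤ-homo-neg : ∀ i → fromℤ (ℤ.- i) ≈ - fromℤ i
    fromℤ-homo-neg (+ n)    = trans (fromℤ-neg n) (-‿cong (sym (fromℤ-+ n)))
    fromℤ-homo-neg -[1+ n ] = sym (⁻¹-involutive _)

    fromℤ-+* : ∀ m n → fromℤ (+ (m ℕ.* n)) ≈ fromℤ (+ m) * fromℤ (+ n)
    fromℤ-+* m n = begin
      fromℤ (+ (m ℕ.* n))  ≈⟨ fromℤ-+ (m ℕ.* n) ⟩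
      fromℕ (m ℕ.* n)      ≈⟨ ×1-homo-* m n ⟩
      fromℕ m * fromℕ n    ≈⟨ *-cong (fromℤ-+ m) (fromℤ-+ n) ⟨
      fromℤ (+ m) * fromℤ (+ n) ∎

    fromℤ-homo-* : ∀ i j → fromℤ (i ℤ.* j) ≈ fromℤ i * fromℤ j
    fromℤ-homo-* (+ m) (+ n) =
      trans (reflexive (≡.cong fromℤ (≡.sym (ℤ.pos-* m n)))) (fromℤ-+* m n)
    fromℤ-homo-* (+ m) -[1+ n ] = begin
      fromℤ (+ m ℤ.* (ℤ.- + suc n))     ≡⟨ ≡.cong fromℤ (ℤ.neg-distribʳ-* (+ m) (+ suc n)) ⟨
      fromℤ (ℤ.- (+ m ℤ.* + suc n))     ≈⟨ fromℤ-homo-neg (+ m ℤ.* + suc n) ⟩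
      - fromℤ (+ m ℤ.* + suc n)         ≈⟨ -‿cong (fromℤ-homo-* (+ m) (+ suc n)) ⟩
      - (fromℤ (+ m) * fromℤ (+ suc n)) ≈⟨ -‿distribʳ-* _ _ ⟩
      fromℤ (+ m) * fromℤ -[1+ n ]      ∎
    fromℤ-homo-* -[1+ m ] (+ n) = begin
      fromℤ ((ℤ.- + suc m) ℤ.* + n)     ≡⟨ ≡.cong fromℤ (ℤ.neg-distribˡ-* (+ suc m) (+ n)) ⟨
      fromℤ (ℤ.- (+ suc m ℤ.* + n))     ≈⟨ fromℤ-homo-neg (+ suc m ℤ.* + n) ⟩
      - fromℤ (+ suc m ℤ.* + n)         ≈⟨ -‿cong (fromℤ-homo-* (+ suc m) (+ n)) ⟩
      - (fromℤ (+ suc m) * fromℤ (+ n)) ≈⟨ -‿distribˡ-* _ _ ⟩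
      fromℤ -[1+ m ] * fromℤ (+ n)      ∎
    fromℤ-homo-* -[1+ m ] -[1+ n ] = begin
      fromℤ (+ (suc m ℕ.* suc n))             ≈⟨ fromℤ-+* (suc m) (suc n) ⟩
      fromℤ (+ suc m) * fromℤ (+ suc n)       ≈⟨ ⁻¹-involutive _ ⟨
      - - (fromℤ (+ suc m) * fromℤ (+ suc n)) ≈⟨ -‿cong (-‿distribˡ-* _ _) ⟩
      - (fromℤ -[1+ m ] * fromℤ (+ suc n))    ≈⟨ -‿distribʳ-* _ _ ⟩
      fromℤ -[1+ m ] * fromℤ -[1+ n ]         ∎

    ℤ-morphism : ℤ.+-*-rawRing ACR.-Raw-AlmostCommutative⟶ ACR.fromCommutativeRing commutativeRing
    ℤ-morphism = record
      { ⟦_⟧    = fromℤ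
      ; +-homo = fromℤ-homo-+
      ; *-homo = fromℤ-homo-*
      ; -‿homo = fromℤ-homo-neg
      ; 0-homo = refl
      ; 1-homo = refl
      }

    fromℤ-≟ : ∀ i j → Maybe (fromℤ i ≈ fromℤ j)
    fromℤ-≟ i j with i ℤ.≟ j
    ... | yes i≡j = just (reflexive (≡.cong fromℤ i≡j))
    ... | no  _   = nothing

  module Solver = Algebra.Solver.Ring ℤ.+-*-rawRing
    (ACR.fromCommutativeRing commutativeRing) ℤ-morphism fromℤ-≟
  open Solver using (solve; _:=_; _:+_; _:*_; _:-_; :-_; con)

  :0 :1 : ∀ {n} → Solver.Polynomial n
  :0 = con (+ 0)
  :1 = con (+ 1)

  -- Ordered fields

  x-y≈0⇒x≈y : ∀ {x y} → x - y ≈ 0# → x ≈ y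
  x-y≈0⇒x≈y = x∙y⁻¹≈ε⇒x≈y _ _

  x≈y⇒x-y≈0 : ∀ {x y} → x ≈ y → x - y ≈ 0#
  x≈y⇒x-y≈0 = x≈y⇒x∙y⁻¹≈ε

  infix 8 _⁻¹[_]
  _⁻¹[_] : ∀ x → x ≉ 0# → Carrier
  x ⁻¹[ x≉0 ] = proj₁ (inverse x x≉0)

  ⁻¹-inverse : ∀ {x} (x≉0 : x ≉ 0#) → x * x ⁻¹[ x≉0 ] ≈ 1#
  ⁻¹-inverse {x} x≉0 = proj₂ (inverse x x≉0)

  *-cancelˡ : ∀ {x y z} → x ≉ 0# → x * y ≈ x * z → y ≈ z
  *-cancelˡ {x} {y} {z} x≉0 xy≈xz = begin
    y              ≈⟨ lemma y ⟩
    x⁻¹ * (x * y)  ≈⟨ *-congˡ xy≈xz ⟩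
    x⁻¹ * (x * z)  ≈⟨ lemma z ⟨
    z              ∎
    where
    x⁻¹ = x ⁻¹[ x≉0 ]
    lemma : ∀ w → w ≈ x⁻¹ * (x * w)
    lemma w = begin
      w              ≈⟨ *-identityˡ w ⟨
      1# * w         ≈⟨ *-congʳ (⁻¹-inverse x≉0) ⟨
      x * x⁻¹ * w    ≈⟨ solve 3 (λ x y w → x :* y :* w := y :* (x :* w)) refl x x⁻¹ w ⟩
      x⁻¹ * (x * w)  ∎

  xy≈0⇒y≈0 : ∀ {x y} → x ≉ 0# → x * y ≈ 0# → y ≈ 0#
  xy≈0⇒y≈0 x≉0 xy≈0 = *-cancelˡ x≉0 (trans xy≈0 (sym (zeroʳ _)))

  *-nonzero : ∀ {x y} → x ≉ 0# → y ≉ 0# → x * y ≉ 0#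
  *-nonzero x≉0 y≉0 xy≈0 = y≉0 (xy≈0⇒y≈0 x≉0 xy≈0)

  x≤y⇒0≤y-x : ∀ {x y} → x ≤ y → 0# ≤ y - x
  x≤y⇒0≤y-x {x} x≤y = ≤-respˡ (-‿inverseʳ x) (+-monoˡ-≤ (- x) x≤y)

  0≤y-x⇒x≤y : ∀ {x y} → 0# ≤ y - x → x ≤ y
  0≤y-x⇒x≤y {x} {y} 0≤y-x =
    ≤-respˡ (+-identityˡ x)
      (≤-respʳ (solve 2 (λ x y → y :- x :+ x := y) refl x y) (+-monoˡ-≤ x 0≤y-x))

  +-mono-≤ : ∀ {x y u v} → x ≤ y → u ≤ v → x + u ≤ y + v
  +-mono-≤ {x} {y} {u} {v} x≤y u≤v =
    ≤-trans (+-monoˡ-≤ u x≤y)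
      (≤-respˡ (+-comm u y) (≤-respʳ (+-comm v y) (+-monoˡ-≤ y u≤v)))

  +-nonNegative : ∀ {x y} → 0# ≤ x → 0# ≤ y → 0# ≤ x + y
  +-nonNegative 0≤x 0≤y = ≤-respˡ (+-identityˡ 0#) (+-mono-≤ 0≤x 0≤y)

  x*x-nonNegative : ∀ x → 0# ≤ x * x
  x*x-nonNegative x with total 0# x
  ... | inj₁ 0≤x = *-nonNegative 0≤x 0≤x
  ... | inj₂ x≤0 =
    ≤-respʳ (solve 1 (λ x → (:0 :- x) :* (:0 :- x) := x :* x) refl x)
      (*-nonNegative (x≤y⇒0≤y-x x≤0) (x≤y⇒0≤y-x x≤0))

  0≤1 : 0# ≤ 1#
  0≤1 = ≤-respʳ (*-identityˡ 1#) (x*x-nonNegative 1#)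

  *-monoˡ-≤ : ∀ {x y z} → 0# ≤ z → x ≤ y → z * x ≤ z * y
  *-monoˡ-≤ {x} {y} {z} 0≤z x≤y = 0≤y-x⇒x≤y
    (≤-respʳ (solve 3 (λ x y z → z :* (y :- x) := z :* y :- z :* x) refl x y z)
      (*-nonNegative 0≤z (x≤y⇒0≤y-x x≤y)))

  *-monoʳ-≤ : ∀ {x y z} → 0# ≤ z → x ≤ y → x * z ≤ y * z
  *-monoʳ-≤ 0≤z x≤y = ≤-respˡ (*-comm _ _) (≤-respʳ (*-comm _ _) (*-monoˡ-≤ 0≤z x≤y))

  ≤-<-contradiction : ∀ {x y} → x ≤ y → ¬ y < x
  ≤-<-contradiction x≤y (y≤x , y≉x) = y≉x (antisym y≤x x≤y)

  ≰⇒< : ∀ {x y} → ¬ x ≤ y → y < x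
  ≰⇒< {x} {y} x≰y with total x y
  ... | inj₁ x≤y = contradiction x≤y x≰y
  ... | inj₂ y≤x = y≤x , λ y≈x → x≰y (≤-reflexive (sym y≈x))

  *-cancelʳ-≤ : ∀ {x y z} → 0# < z → x * z ≤ y * z → x ≤ y
  *-cancelʳ-≤ {x} {y} {z} (0≤z , 0≉z) xz≤yz with x ≤? y
  ... | yes x≤y = x≤y
  ... | no  x≰y with ≰⇒< x≰y
  ...   | y≤x , y≉x = contradiction
    (*-cancelˡ (0≉z ∘ sym) (trans (*-comm z y)
      (trans (antisym (*-monoʳ-≤ 0≤z y≤x) xz≤yz) (*-comm x z)))) y≉x

  fromℕ-mono : ∀ {m n} → m ℕ.≤ n → fromℕ m ≤ fromℕ n
  fromℕ-mono {n = zero}  z≤n = ≤-refl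
  fromℕ-mono {n = suc n} z≤n = +-nonNegative 0≤1 (fromℕ-mono {n = n} z≤n)
  fromℕ-mono (s≤s m≤n) = +-mono-≤ ≤-refl (fromℕ-mono m≤n)

  -- Characteristic zero comes from the order: the sum is at least `1#`, so if it vanished, `1#`
  -- would be squeezed between `0#` and `0#`.
  fromℕ-suc≉0 : ∀ n → fromℕ (suc n) ≉ 0#
  fromℕ-suc≉0 n 1+n≈0 =
    0≉1 (antisym 0≤1 (≤-respʳ 1+n≈0
      (≤-respˡ (+-identityʳ 1#) (+-mono-≤ ≤-refl (fromℕ-mono {0} {n} z≤n)))))

  fromℕ-mono-< : ∀ {m n} → m ℕ.< n → fromℕ m < fromℕ n
  fromℕ-mono-< {m} {n} m<n = fromℕ-mono (ℕ.<⇒≤ m<n) , λ m≈n →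
    0≉1 (sym (begin
      1#                     ≈⟨ solve 1 (λ x → :1 := (:1 :+ x) :- x) refl (fromℕ m) ⟩
      fromℕ (suc m) - fromℕ m ≈⟨ x≈y⇒x-y≈0 (antisym (≤-respʳ (sym m≈n) (fromℕ-mono m<n))
                                   (fromℕ-mono (ℕ.n≤1+n m))) ⟩
      0#                     ∎))

  -- Sums

  sum-zero : ∀ {n} {f : Vector Carrier n} → (∀ i → f i ≈ 0#) → sum f ≈ 0#
  sum-zero {n} f≈0 = trans (sum-cong-≋ f≈0) (sum-replicate-zero n)

  sum-single : ∀ {n} {f : Vector Carrier n} i → (∀ j → j ≢ i → f j ≈ 0#) → sum f ≈ f i
  sum-single {suc n} {f} i f≈0 = begin
    sum f                           ≈⟨ sum-remove f ⟩
    f i + sum (λ j → f (punchIn i j)) ≈⟨ +-congˡ (sum-zero (λ j → f≈0 _ (Fin.punchInᵢ≢i i j))) ⟩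
    f i + 0#                        ≈⟨ +-identityʳ _ ⟩
    f i                             ∎

  sum-mono : ∀ {n} {f g : Vector Carrier n} → (∀ i → f i ≤ g i) → sum f ≤ sum g
  sum-mono {zero}  f≤g = ≤-refl
  sum-mono {suc n} f≤g = +-mono-≤ (f≤g zero) (sum-mono (f≤g ∘ suc))

  sum-nonNegative : ∀ {n} {f : Vector Carrier n} → (∀ i → 0# ≤ f i) → 0# ≤ sum f
  sum-nonNegative {n} 0≤f = ≤-respˡ (sum-replicate-zero n) (sum-mono 0≤f)

  sum-zero⇒zero : ∀ {n} {f : Vector Carrier n} → (∀ i → 0# ≤ f i) → sum f ≤ 0# →
                  ∀ i → f i ≈ 0#
  sum-zero⇒zero {suc n} {f} 0≤f Σ≤0 i = antisym
    (≤-respˡ (+-identityʳ (f i))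
      (≤-trans (+-mono-≤ ≤-refl (sum-nonNegative {f = λ j → f (punchIn i j)} (λ j → 0≤f _)))
        (≤-respˡ (sum-remove {i = i} f) Σ≤0)))
    (0≤f i)

  infix 8 _∙_
  _∙_ : ∀ {n} → Vector Carrier n → Vector Carrier n → Carrier
  y ∙ z = sum λ i → y i * z i

  ∙-congˡ : ∀ {n} (y z z′ : Vector Carrier n) → (∀ i → z i ≈ z′ i) → y ∙ z ≈ y ∙ z′
  ∙-congˡ y z z′ z≈z′ = sum-cong-≋ (λ i → *-congˡ {y i} (z≈z′ i))

  ∙-congʳ : ∀ {n} (y y′ z : Vector Carrier n) → (∀ i → y i ≈ y′ i) → y ∙ z ≈ y′ ∙ z
  ∙-congʳ y y′ z y≈y′ = sum-cong-≋ (λ i → *-congʳ {z i} (y≈y′ i))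

  ∙-zeroˡ : ∀ {n} (y z : Vector Carrier n) → (∀ i → y i ≈ 0#) → y ∙ z ≈ 0#
  ∙-zeroˡ y z y≈0 = sum-zero (λ i → trans (*-congʳ {z i} (y≈0 i)) (zeroˡ (z i)))

  ∙-comm : ∀ {n} (y z : Vector Carrier n) → y ∙ z ≈ z ∙ y
  ∙-comm y z = sum-cong-≋ (λ i → *-comm (y i) (z i))

  ∙-linearʳ : ∀ {n} (y : Vector Carrier n) a z b z′ →
              y ∙ (λ i → a * z i + b * z′ i) ≈ a * (y ∙ z) + b * (y ∙ z′)
  ∙-linearʳ y a z b z′ = begin
    y ∙ (λ i → a * z i + b * z′ i)
      ≈⟨ sum-cong-≋ (λ i → solve 5 (λ y a z b w → y :* (a :* z :+ b :* w)
           := a :* (y :* z) :+ b :* (y :* w)) refl (y i) a (z i) b (z′ i)) ⟩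
    sum (λ i → a * (y i * z i) + b * (y i * z′ i))
      ≈⟨ ∑-distrib-+ (λ i → a * (y i * z i)) (λ i → b * (y i * z′ i)) ⟩
    sum (λ i → a * (y i * z i)) + sum (λ i → b * (y i * z′ i))
      ≈⟨ +-cong (*-distribˡ-sum a (λ i → y i * z i)) (*-distribˡ-sum b (λ i → y i * z′ i)) ⟨
    a * (y ∙ z) + b * (y ∙ z′)
      ∎

  ∙-linearˡ : ∀ {n} a (y : Vector Carrier n) b y′ z →
              (λ i → a * y i + b * y′ i) ∙ z ≈ a * (y ∙ z) + b * (y′ ∙ z)
  ∙-linearˡ a y b y′ z = begin
    (λ i → a * y i + b * y′ i) ∙ z   ≈⟨ ∙-comm (λ i → a * y i + b * y′ i) z ⟩
    z ∙ (λ i → a * y i + b * y′ i)   ≈⟨ ∙-linearʳ z a y b y′ ⟩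
    a * (z ∙ y) + b * (z ∙ y′)       ≈⟨ +-cong (*-congˡ (∙-comm z y)) (*-congˡ (∙-comm z y′)) ⟩
    a * (y ∙ z) + b * (y′ ∙ z)       ∎

  -- Associativity of row times matrix times column. The symmetry of forms and their expansion along
  -- combinations of vectors both rest on it.
  ∙-exchange : ∀ {m n} (y : Vector Carrier m) (A : Fin m → Vector Carrier n) z →
               y ∙ (λ i → A i ∙ z) ≈ (λ j → y ∙ (λ i → A i j)) ∙ z
  ∙-exchange y A z = begin
    sum (λ i → y i * sum (λ j → A i j * z j))
      ≈⟨ sum-cong-≋ (λ i → *-distribˡ-sum (y i) (λ j → A i j * z j)) ⟩
    sum (λ i → sum (λ j → y i * (A i j * z j)))
      ≈⟨ ∑-comm (λ i j → y i * (A i j * z j)) ⟩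
    sum (λ j → sum (λ i → y i * (A i j * z j)))
      ≈⟨ sum-cong-≋ (λ j → sum-cong-≋ (λ i → sym (*-assoc (y i) (A i j) (z j)))) ⟩
    sum (λ j → sum (λ i → y i * A i j * z j))
      ≈⟨ sum-cong-≋ (λ j → *-distribʳ-sum (z j) (λ i → y i * A i j)) ⟨
    sum (λ j → sum (λ i → y i * A i j) * z j)
      ∎

  -- Determinants

  Mat : ℕ → Set _
  Mat = Matrix ℝ

  Δ : ∀ {n} → Mat n → Carrier
  Δ = det ℝ

  sgn : ∀ {n} → Fin n → Carrier
  sgn = sign ℝ

  minor : ∀ {n} → Mat (suc n) → Fin (suc n) → Mat n
  minor M j r s = M (suc r) (punchIn j s)

  det-cong : ∀ {n} (M N : Mat n) → (∀ r s → M r s ≈ N r s) → Δ M ≈ Δ N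
  det-cong {zero}  M N M≈N = refl
  det-cong {suc n} M N M≈N = sum-cong-≋ λ j →
    *-cong (*-congˡ {sgn j} (M≈N zero j)) (det-cong (minor M j) (minor N j) λ r s → M≈N (suc r) (punchIn j s))

  -- In the expansion along the first row, the term for column `j` has a linear entry and a minor
  -- without that column; every other term has a fixed entry and a minor that is linear in what
  -- remains of column `j`, by induction.
  det-linear : ∀ {n} j a b {A A′ A″ : Mat n} →
    (∀ r s → s ≢ j → A r s ≈ A′ r s) → (∀ r s → s ≢ j → A r s ≈ A″ r s) →
    (∀ r → A r j ≈ a * A′ r j + b * A″ r j) → Δ A ≈ a * Δ A′ + b * Δ A″
  det-linear {suc n} j a b {A} {A′} {A″} A≈A′ A≈A″ A≈ = begin
    Δ A                                           ≈⟨ sum-cong-≋ term ⟩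
    sum (λ k → a * t A′ k + b * t A″ k)           ≈⟨ ∑-distrib-+ (λ k → a * t A′ k) (λ k → b * t A″ k) ⟩
    sum (λ k → a * t A′ k) + sum (λ k → b * t A″ k)
      ≈⟨ +-cong (*-distribˡ-sum a (t A′)) (*-distribˡ-sum b (t A″)) ⟨
    a * Δ A′ + b * Δ A″                           ∎
    where
    t : Mat (suc n) → Fin (suc n) → Carrier
    t M k = sgn k * M zero k * Δ (minor M k)

    term : ∀ k → t A k ≈ a * t A′ k + b * t A″ k
    term k with k Fin.≟ j
    ... | yes ≡.refl = begin
      sgn k * A zero k * Δ (minor A k)
        ≈⟨ *-congʳ (*-congˡ (A≈ zero)) ⟩
      sgn k * (a * A′ zero k + b * A″ zero k) * Δ (minor A k)
        ≈⟨ solve 6 (λ s a b x y d → s :* (a :* x :+ b :* y) :* d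
             := a :* (s :* x :* d) :+ b :* (s :* y :* d)) refl
             (sgn k) a b (A′ zero k) (A″ zero k) (Δ (minor A k)) ⟩
      a * (sgn k * A′ zero k * Δ (minor A k)) + b * (sgn k * A″ zero k * Δ (minor A k))
        ≈⟨ +-cong
             (*-congˡ (*-congˡ (det-cong (minor A k) (minor A′ k) λ r s → A≈A′ (suc r) _ (Fin.punchInᵢ≢i k s))))
             (*-congˡ (*-congˡ (det-cong (minor A k) (minor A″ k) λ r s → A≈A″ (suc r) _ (Fin.punchInᵢ≢i k s)))) ⟩
      a * t A′ k + b * t A″ k
        ∎
    ... | no k≢j = begin
      sgn k * A zero k * Δ (minor A k)
        ≈⟨ *-congˡ (det-linear j′ a b {minor A k} {minor A′ k} {minor A″ k}
             (λ r s s≢j′ → A≈A′ (suc r) _ (s≢j′ ∘ off s))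
             (λ r s s≢j′ → A≈A″ (suc r) _ (s≢j′ ∘ off s)) (λ r → on r)) ⟩
      sgn k * A zero k * (a * Δ (minor A′ k) + b * Δ (minor A″ k))
        ≈⟨ solve 6 (λ s x a d b e → s :* x :* (a :* d :+ b :* e)
             := a :* (s :* x :* d) :+ b :* (s :* x :* e)) refl
             (sgn k) (A zero k) a (Δ (minor A′ k)) b (Δ (minor A″ k)) ⟩
      a * (sgn k * A zero k * Δ (minor A′ k)) + b * (sgn k * A zero k * Δ (minor A″ k))
        ≈⟨ +-cong (*-congˡ (*-congʳ (*-congˡ (A≈A′ zero k k≢j))))
                  (*-congˡ (*-congʳ (*-congˡ (A≈A″ zero k k≢j)))) ⟩
      a * t A′ k + b * t A″ k
        ∎
      where
      j′ = punchOut k≢j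
      j′↦j : punchIn k j′ ≡ j
      j′↦j = Fin.punchIn-punchOut k≢j
      off : ∀ s → punchIn k s ≡ j → s ≡ j′
      off s eq = Fin.punchIn-injective k s j′ (≡.trans eq (≡.sym j′↦j))
      on : ∀ r → minor A k r j′ ≈ a * minor A′ k r j′ + b * minor A″ k r j′
      on r = ≡.subst (λ i → A (suc r) i ≈ a * A′ (suc r) i + b * A″ (suc r) i)
               (≡.sym j′↦j) (A≈ (suc r))

  infixl 9 _[_≔_]
  _[_≔_] : ∀ {m n} → (Fin m → Vector Carrier n) → Fin n → Vector Carrier m → Fin m → Vector Carrier n
  (A [ j ≔ c ]) r s with s Fin.≟ j
  ... | yes _ = c r
  ... | no  _ = A r s

  ≔-on : ∀ {m n} (A : Fin m → Vector Carrier n) j c r → (A [ j ≔ c ]) r j ≡ c r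
  ≔-on A j c r with j Fin.≟ j
  ... | yes _   = ≡.refl
  ... | no  j≢j = contradiction ≡.refl j≢j

  ≔-off : ∀ {m n} (A : Fin m → Vector Carrier n) j c r {s} → s ≢ j → (A [ j ≔ c ]) r s ≡ A r s
  ≔-off A j c r {s} s≢j with s Fin.≟ j
  ... | yes s≡j = contradiction s≡j s≢j
  ... | no  _   = ≡.refl

  private
    suc≢inject₁ : ∀ {n} (j : Fin n) → suc j ≢ inject₁ j
    suc≢inject₁ j eq = ℕ.1+n≢n (≡.trans (≡.cong toℕ eq) (Fin.toℕ-inject₁ j))

    punchIn-adjacent : ∀ {n} (j : Fin n) s → s ≢ j →
      punchIn (inject₁ j) s ≡ punchIn (suc j) s
    punchIn-adjacent zero    zero    s≢j = contradiction ≡.refl s≢j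
    punchIn-adjacent zero    (suc s) s≢j = ≡.refl
    punchIn-adjacent (suc j) zero    s≢j = ≡.refl
    punchIn-adjacent (suc j) (suc s) s≢j = ≡.cong suc (punchIn-adjacent j s (s≢j ∘ ≡.cong suc))

    punchIn-inject₁ : ∀ {n} (j : Fin n) → punchIn (inject₁ j) j ≡ suc j
    punchIn-inject₁ zero    = ≡.refl
    punchIn-inject₁ (suc j) = ≡.cong suc (punchIn-inject₁ j)

    punchIn-suc : ∀ {n} (j : Fin n) → punchIn (suc j) j ≡ inject₁ j
    punchIn-suc zero    = ≡.refl
    punchIn-suc (suc j) = ≡.cong suc (punchIn-suc j)

    punchOut-adjacent : ∀ {n} (k : Fin (suc (suc n))) (j : Fin (suc n)) →
      k ≢ inject₁ j → k ≢ suc j →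
      ∃ λ (i : Fin n) → punchIn k (inject₁ i) ≡ inject₁ j × punchIn k (suc i) ≡ suc j
    punchOut-adjacent         zero          zero    k≢ k≢′ = contradiction ≡.refl k≢
    punchOut-adjacent         zero          (suc j) k≢ k≢′ = j , ≡.refl , ≡.refl
    punchOut-adjacent         (suc zero)    zero    k≢ k≢′ = contradiction ≡.refl k≢′
    punchOut-adjacent {suc n} (suc (suc k)) zero    k≢ k≢′ = zero , ≡.refl , ≡.refl
    punchOut-adjacent {suc n} (suc k)       (suc j) k≢ k≢′
      with punchOut-adjacent k j (k≢ ∘ ≡.cong suc) (k≢′ ∘ ≡.cong suc)
    ... | i , eq , eq′ = suc i , ≡.cong suc eq , ≡.cong suc eq′

    sign-inject₁ : ∀ {n} (j : Fin n) → sgn (inject₁ j) ≈ sgn j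
    sign-inject₁ zero    = refl
    sign-inject₁ (suc j) = -‿cong (sign-inject₁ j)

    sum-adjacent : ∀ {n} (j : Fin n) (f : Vector Carrier (suc n)) →
      f (inject₁ j) + f (suc j) ≈ 0# →
      (∀ k → k ≢ inject₁ j → k ≢ suc j → f k ≈ 0#) → sum f ≈ 0#
    sum-adjacent zero f f₀+f₁≈0 f≈0 = begin
      f zero + (f (suc zero) + sum (λ k → f (suc (suc k))))
        ≈⟨ +-assoc _ _ _ ⟨
      f zero + f (suc zero) + sum (λ k → f (suc (suc k)))
        ≈⟨ +-cong f₀+f₁≈0 (sum-zero λ k → f≈0 (suc (suc k)) (λ ()) (λ ())) ⟩
      0# + 0#
        ≈⟨ +-identityˡ 0# ⟩
      0# ∎
    sum-adjacent (suc j) f fⱼ+fⱼ₊₁≈0 f≈0 = begin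
      f zero + sum (λ k → f (suc k))
        ≈⟨ +-cong (f≈0 zero (λ ()) (λ ())) (sum-adjacent j (f ∘ suc) fⱼ+fⱼ₊₁≈0
             λ k k≢ k≢′ → f≈0 (suc k) (k≢ ∘ Fin.suc-injective) (k≢′ ∘ Fin.suc-injective)) ⟩
      0# + 0#
        ≈⟨ +-identityˡ 0# ⟩
      0# ∎

  -- The terms at the two equal columns have equal minors and opposite signs. Every other minor
  -- still contains both columns, again side by side, and vanishes by induction.
  det-alternating-adjacent : ∀ {n} (j : Fin n) (A : Mat (suc n)) →
    (∀ r → A r (inject₁ j) ≈ A r (suc j)) → Δ A ≈ 0#
  det-alternating-adjacent {suc n} j A eq = sum-adjacent j _ cancel vanish
    where
    minors : ∀ r s → minor A (inject₁ j) r s ≈ minor A (suc j) r s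
    minors r s with s Fin.≟ j
    ... | no  s≢j    = reflexive (≡.cong (A (suc r)) (punchIn-adjacent j s s≢j))
    ... | yes ≡.refl = trans (reflexive (≡.cong (A (suc r)) (punchIn-inject₁ s)))
      (trans (sym (eq (suc r))) (sym (reflexive (≡.cong (A (suc r)) (punchIn-suc s)))))

    cancel : sgn (inject₁ j) * A zero (inject₁ j) * Δ (minor A (inject₁ j)) +
             sgn (suc j) * A zero (suc j) * Δ (minor A (suc j)) ≈ 0#
    cancel = begin
      sgn (inject₁ j) * A zero (inject₁ j) * Δ (minor A (inject₁ j)) +
      sgn (suc j) * A zero (suc j) * Δ (minor A (suc j))
        ≈⟨ +-congʳ (*-cong (*-cong (sign-inject₁ j) (eq zero)) (det-cong (minor A (inject₁ j)) (minor A (suc j)) minors)) ⟩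
      sgn j * A zero (suc j) * Δ (minor A (suc j)) +
      (- sgn j) * A zero (suc j) * Δ (minor A (suc j))
        ≈⟨ solve 3 (λ s a d → s :* a :* d :+ (:- s) :* a :* d := :0) refl
             (sgn j) (A zero (suc j)) (Δ (minor A (suc j))) ⟩
      0# ∎

    vanish : ∀ k → k ≢ inject₁ j → k ≢ suc j → sgn k * A zero k * Δ (minor A k) ≈ 0#
    vanish k k≢ k≢′ with punchOut-adjacent k j k≢ k≢′
    ... | i , eq₁ , eq₂ = trans (*-congˡ (det-alternating-adjacent i (minor A k) λ r →
      trans (reflexive (≡.cong (A (suc r)) eq₁))
        (trans (eq (suc r)) (sym (reflexive (≡.cong (A (suc r)) eq₂)))))) (zeroʳ _)

  swapColumns : ∀ {n} → Fin n → Mat (suc n) → Mat (suc n)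
  swapColumns j A = A [ inject₁ j ≔ (λ r → A r (suc j)) ] [ suc j ≔ (λ r → A r (inject₁ j)) ]

  -- Expand the determinant with the sum of the two columns in both places.
  det-swapColumns : ∀ {n} (j : Fin n) (A : Mat (suc n)) → Δ A + Δ (swapColumns j A) ≈ 0#
  det-swapColumns {n} j A = begin
    Δ A + Δ (swapColumns j A)
      ≈⟨ +-cong (det-cong A (B x y) A≈) refl ⟩
    Δ (B x y) + Δ (B y x)
      ≈⟨ solve 2 (λ a b → a :+ b := (:0 :+ b) :+ (a :+ :0)) refl (Δ (B x y)) (Δ (B y x)) ⟩
    (0# + Δ (B y x)) + (Δ (B x y) + 0#)
      ≈⟨ +-cong (+-congʳ (vanish x)) (+-congˡ (vanish y)) ⟨
    (Δ (B x x) + Δ (B y x)) + (Δ (B x y) + Δ (B y y))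
      ≈⟨ +-cong (additiveˡ x) (additiveˡ y) ⟨
    Δ (B z x) + Δ (B z y)
      ≈⟨ additiveʳ z ⟨
    Δ (B z z)
      ≈⟨ vanish z ⟩
    0# ∎
    where
    p = inject₁ j
    q = suc j
    x y z : Vector Carrier (suc n)
    x r = A r p
    y r = A r q
    z r = x r + y r
    B : (u v : Vector Carrier (suc n)) → Mat (suc n)
    B u v = A [ p ≔ u ] [ q ≔ v ]

    B-p : ∀ u v r → B u v r p ≡ u r
    B-p u v r = ≡.trans (≔-off (A [ p ≔ u ]) q v r (suc≢inject₁ j ∘ ≡.sym)) (≔-on A p u r)

    B-q : ∀ u v r → B u v r q ≡ v r
    B-q u v r = ≔-on (A [ p ≔ u ]) q v r

    B-off : ∀ u v r {s} → s ≢ p → s ≢ q → B u v r s ≡ A r s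
    B-off u v r s≢p s≢q = ≡.trans (≔-off (A [ p ≔ u ]) q v r s≢q) (≔-off A p u r s≢p)

    A≈ : ∀ r s → A r s ≈ B x y r s
    A≈ r s = go s (s Fin.≟ p) (s Fin.≟ q)
      where
      go : ∀ s → Dec (s ≡ p) → Dec (s ≡ q) → A r s ≈ B x y r s
      go _ (yes ≡.refl) _            = sym (reflexive (B-p x y r))
      go _ (no _)       (yes ≡.refl) = sym (reflexive (B-q x y r))
      go _ (no s≢p)     (no s≢q)     = sym (reflexive (B-off x y r s≢p s≢q))

    vanish : ∀ u → Δ (B u u) ≈ 0#
    vanish u = det-alternating-adjacent j (B u u)
      λ r → reflexive (≡.trans (B-p u u r) (≡.sym (B-q u u r)))

    1*+1* : ∀ a b → a + b ≈ 1# * a + 1# * b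
    1*+1* a b = sym (+-cong (*-identityˡ a) (*-identityˡ b))

    sameˡ : ∀ u u′ v r s → s ≢ p → B u v r s ≈ B u′ v r s
    sameˡ u u′ v r s s≢p = reflexive (case s Fin.≟ q of λ where
      (yes ≡.refl) → ≡.trans (B-q u v r) (≡.sym (B-q u′ v r))
      (no s≢q)     → ≡.trans (B-off u v r s≢p s≢q) (≡.sym (B-off u′ v r s≢p s≢q)))

    sameʳ : ∀ u v v′ r s → s ≢ q → B u v r s ≈ B u v′ r s
    sameʳ u v v′ r s s≢q = reflexive (case s Fin.≟ p of λ where
      (yes ≡.refl) → ≡.trans (B-p u v r) (≡.sym (B-p u v′ r))
      (no s≢p)     → ≡.trans (B-off u v r s≢p s≢q) (≡.sym (B-off u v′ r s≢p s≢q)))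

    additiveˡ : ∀ v → Δ (B z v) ≈ Δ (B x v) + Δ (B y v)
    additiveˡ v = trans
      (det-linear p 1# 1# {B z v} {B x v} {B y v} (sameˡ z x v) (sameˡ z y v) λ r →
        trans (reflexive (B-p z v r)) (trans (1*+1* (x r) (y r))
          (sym (+-cong (*-congˡ (reflexive (B-p x v r))) (*-congˡ (reflexive (B-p y v r)))))))
      (sym (1*+1* _ _))

    additiveʳ : ∀ u → Δ (B u z) ≈ Δ (B u x) + Δ (B u y)
    additiveʳ u = trans
      (det-linear q 1# 1# {B u z} {B u x} {B u y} (sameʳ u z x) (sameʳ u z y) λ r →
        trans (reflexive (B-q u z r)) (trans (1*+1* (x r) (y r))
          (sym (+-cong (*-congˡ (reflexive (B-q u x r))) (*-congˡ (reflexive (B-q u y r)))))))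
      (sym (1*+1* _ _))

  private
    -- The right one of the two equal columns is moved left by swaps of neighbours, each of which
    -- only changes the sign, until the two are adjacent. The bound `k` on its position is the
    -- measure of the recursion.
    det-alternating-< : ∀ {n} k (i j : Fin n) (A : Mat n) → toℕ j ℕ.≤ k → toℕ i ℕ.< toℕ j →
      (∀ r → A r i ≈ A r j) → Δ A ≈ 0#
    det-alternating-< {suc n} (suc k) i (suc j) A (s≤s j≤k) i<j Aᵢ≈Aⱼ with i Fin.≟ inject₁ j
    ... | yes ≡.refl = det-alternating-adjacent j A Aᵢ≈Aⱼ
    ... | no  i≢j    = begin
      Δ A                        ≈⟨ +-identityʳ _ ⟨
      Δ A + 0#                   ≈⟨ +-congˡ swapped≈0 ⟨
      Δ A + Δ (swapColumns j A)  ≈⟨ det-swapColumns j A ⟩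
      0#                         ∎
      where
      i<j′ : toℕ i ℕ.< toℕ j
      i<j′ = ℕ.≤∧≢⇒< (ℕ.≤-pred i<j)
        λ eq → i≢j (Fin.toℕ-injective (≡.trans eq (≡.sym (Fin.toℕ-inject₁ j))))
      A₁ = A [ inject₁ j ≔ (λ r → A r (suc j)) ]
      i≢1+j : i ≢ suc j
      i≢1+j eq = ℕ.<⇒≢ i<j (≡.cong toℕ eq)
      swapped≈0 : Δ (swapColumns j A) ≈ 0#
      swapped≈0 = det-alternating-< k i (inject₁ j) (swapColumns j A)
        (ℕ.≤-trans (ℕ.≤-reflexive (Fin.toℕ-inject₁ j)) j≤k)
        (ℕ.<-≤-trans i<j′ (ℕ.≤-reflexive (≡.sym (Fin.toℕ-inject₁ j)))) λ r → begin
        swapColumns j A r i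
          ≡⟨ ≔-off A₁ (suc j) _ r i≢1+j ⟩
        A₁ r i
          ≡⟨ ≔-off A (inject₁ j) _ r i≢j ⟩
        A r i
          ≈⟨ Aᵢ≈Aⱼ r ⟩
        A r (suc j)
          ≡⟨ ≔-on A (inject₁ j) _ r ⟨
        A₁ r (inject₁ j)
          ≡⟨ ≔-off A₁ (suc j) _ r (suc≢inject₁ j ∘ ≡.sym) ⟨
        swapColumns j A r (inject₁ j)
          ∎

  det-alternating : ∀ {n} {i j : Fin n} (A : Mat n) → i ≢ j →
    (∀ r → A r i ≈ A r j) → Δ A ≈ 0#
  det-alternating {i = i} {j} A i≢j Aᵢ≈Aⱼ with ℕ.<-cmp (toℕ i) (toℕ j)
  ... | tri< i<j _ _ = det-alternating-< _ i j A ℕ.≤-refl i<j Aᵢ≈Aⱼ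
  ... | tri≈ _ i≡j _ = contradiction (Fin.toℕ-injective i≡j) i≢j
  ... | tri> _ _ j<i = det-alternating-< _ j i A ℕ.≤-refl j<i (sym ∘ Aᵢ≈Aⱼ)

  det-pivot : ∀ {n} (M : Mat (suc n)) p → (∀ j → j ≢ p → M zero j ≈ 0#) →
    Δ M ≈ sgn p * M zero p * Δ (minor M p)
  det-pivot M p M₀≈0 = sum-single {f = λ j → sgn j * M zero j * Δ (minor M j)} p λ j j≢p → begin
    sgn j * M zero j * Δ (minor M j)  ≈⟨ *-congʳ {Δ (minor M j)} (*-congˡ {sgn j} (M₀≈0 j j≢p)) ⟩
    sgn j * 0# * Δ (minor M j)        ≈⟨ solve 2 (λ s d → s :* :0 :* d := :0) refl (sgn j) (Δ (minor M j)) ⟩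
    0#                                ∎

  -- Alternating multilinear functions of the columns

  -- Abstracted from `Δ` so that one elimination argument serves `Δ`, the function sending `A` to
  -- `Δ (Q ⊗ A)`, and the restrictions of both to block matrices.
  record IsAlternating {n} (F : Mat n → Carrier) : Set (c ⊔ ℓ₁) where
    field
      congruent   : ∀ A B → (∀ r s → A r s ≈ B r s) → F A ≈ F B
      linear      : ∀ j a b A A′ A″ →
        (∀ r s → s ≢ j → A r s ≈ A′ r s) → (∀ r s → s ≢ j → A r s ≈ A″ r s) →
        (∀ r → A r j ≈ a * A′ r j + b * A″ r j) → F A ≈ a * F A′ + b * F A″
      alternating : ∀ {i j} A → i ≢ j → (∀ r → A r i ≈ A r j) → F A ≈ 0#

  det-isAlternating : ∀ {n} → IsAlternating (Δ {n})
  det-isAlternating = record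
    { congruent   = det-cong
    ; linear      = λ j a b A A′ A″ → det-linear j a b {A} {A′} {A″}
    ; alternating = det-alternating
    }

  clear : ∀ {n} → Fin n → Vector Carrier n → Vector Carrier n
  clear j c i with i Fin.≟ j
  ... | yes _ = 0#
  ... | no  _ = c i

  clear-on : ∀ {n} j (c : Vector Carrier n) → clear j c j ≡ 0#
  clear-on j c with j Fin.≟ j
  ... | yes _  = ≡.refl
  ... | no j≢j = contradiction ≡.refl j≢j

  clear-off : ∀ {n} j (c : Vector Carrier n) {i} → i ≢ j → clear j c i ≡ c i
  clear-off j c {i} i≢j with i Fin.≟ j
  ... | yes i≡j = contradiction i≡j i≢j
  ... | no  _   = ≡.refl

  -- Induction on the number of coordinates that may be nonzero: `go k` treats the vectors that
  -- vanish from index `k` on. A simultaneous column operation is thereby reduced to one column at a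
  -- time.
  vector-induction : ∀ {n p} (P : Vector Carrier n → Set p) →
    (∀ c c′ → (∀ i → c i ≈ c′ i) → P c → P c′) → P (λ _ → 0#) →
    (∀ c j → P (clear j c) → P c) → ∀ c → P c
  vector-induction {n} P resp base step c = go n c (λ i n≤i → contradiction n≤i (ℕ.<⇒≱ (Fin.toℕ<n i)))
    where
    go : ∀ k c → (∀ i → k ℕ.≤ toℕ i → c i ≈ 0#) → P c
    go zero    c c≈0 = resp _ c (λ i → sym (c≈0 i z≤n)) base
    go (suc k) c c≈0 with k ℕ.<? n
    ... | no  k≮n = go k c λ i k≤i → contradiction (ℕ.≤-<-trans k≤i (Fin.toℕ<n i)) k≮n
    ... | yes k<n = step c j (go k (clear j c) cleared)
      where
      j = fromℕ< k<n
      cleared : ∀ i → k ℕ.≤ toℕ i → clear j c i ≈ 0#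
      cleared i k≤i with i Fin.≟ j
      ... | yes _  = refl
      ... | no i≢j = c≈0 i (ℕ.≤∧≢⇒< k≤i λ k≡i →
        i≢j (Fin.toℕ-injective (≡.trans (≡.sym k≡i) (≡.sym (Fin.toℕ-fromℕ< k<n)))))

  addColumn : ∀ {m n} → Vector Carrier n → Fin n → (Fin m → Vector Carrier n) → Fin m → Vector Carrier n
  addColumn c p A r s = A r s + c s * A r p

  private
    x+0*y≈x : ∀ {c} x y → c ≈ 0# → x + c * y ≈ x
    x+0*y≈x x y c≈0 = trans (+-congˡ (trans (*-congʳ c≈0) (zeroˡ y))) (+-identityʳ x)

    x≈0*u+0*v : ∀ u v {x} → x ≈ 0# → x ≈ 0# * u + 0# * v
    x≈0*u+0*v u v x≈0 = trans x≈0 (solve 2 (λ u v → :0 := :0 :* u :+ :0 :* v) refl u v)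

  module _ {n} {F : Mat n → Carrier} (isAlternating : IsAlternating F) where
    open IsAlternating isAlternating

    zeroColumn⇒0 : ∀ A j → (∀ r → A r j ≈ 0#) → F A ≈ 0#
    zeroColumn⇒0 A j Aⱼ≈0 = trans
      (linear j 0# 0# A A A (λ _ _ _ → refl) (λ _ _ _ → refl) λ r → x≈0*u+0*v _ _ (Aⱼ≈0 r))
      (sym (x≈0*u+0*v _ _ refl))

    linear-sum : ∀ A j {k} (w : Vector Carrier k) (X : Fin k → Vector Carrier n) →
      F (A [ j ≔ (λ r → w ∙ (λ i → X i r)) ]) ≈ w ∙ (λ i → F (A [ j ≔ X i ]))
    linear-sum A j {zero}  w X = zeroColumn⇒0 _ j λ r → reflexive (≔-on A j _ r)
    linear-sum A j {suc k} w X = begin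
      F (A [ j ≔ u ])
        ≈⟨ linear j (w zero) 1# (A [ j ≔ u ]) (A [ j ≔ X zero ]) (A [ j ≔ u′ ])
             (λ r s s≢j → reflexive (≡.trans (≔-off A j u r s≢j) (≡.sym (≔-off A j (X zero) r s≢j))))
             (λ r s s≢j → reflexive (≡.trans (≔-off A j u r s≢j) (≡.sym (≔-off A j u′ r s≢j))))
             (λ r → trans (reflexive (≔-on A j u r)) (+-cong
               (*-congˡ (sym (reflexive (≔-on A j (X zero) r))))
               (sym (trans (*-identityˡ _) (reflexive (≔-on A j u′ r)))))) ⟩
      w zero * F (A [ j ≔ X zero ]) + 1# * F (A [ j ≔ u′ ])
        ≈⟨ +-congˡ (trans (*-identityˡ _) (linear-sum A j (w ∘ suc) (X ∘ suc))) ⟩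
      w ∙ (λ i → F (A [ j ≔ X i ])) ∎
      where
      u u′ : Vector Carrier n
      u r = w ∙ (λ i → X i r)
      u′ r = (w ∘ suc) ∙ (λ i → X (suc i) r)

    -- Replacing column `p` by the combination of all columns with coefficients `v` multiplies `F`
    -- by `v p`, because the other summands repeat a column. But that combination is zero.
    kernel⇒0 : ∀ A v p → v p ≉ 0# → (∀ r → A r ∙ v ≈ 0#) → F A ≈ 0#
    kernel⇒0 A v p vₚ≉0 Av≈0 = xy≈0⇒y≈0 vₚ≉0 (begin
      v p * F A
        ≈⟨ *-congˡ (congruent _ _ λ r s → sym (same r s)) ⟩
      v p * F (A [ p ≔ (λ r → A r p) ])
        ≈⟨ sum-single p (λ j j≢p → trans (*-congˡ (alternating _ (j≢p ∘ ≡.sym) λ r → reflexive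
             (≡.trans (≔-on A p _ r) (≡.sym (≔-off A p _ r j≢p))))) (zeroʳ _)) ⟨
      v ∙ (λ j → F (A [ p ≔ (λ r → A r j) ]))
        ≈⟨ linear-sum A p v (λ j r → A r j) ⟨
      F (A [ p ≔ (λ r → v ∙ A r) ])
        ≈⟨ zeroColumn⇒0 _ p (λ r → trans (reflexive (≔-on A p _ r)) (trans (∙-comm v (A r)) (Av≈0 r))) ⟩
      0# ∎)
      where
      same : ∀ r s → (A [ p ≔ (λ r → A r p) ]) r s ≈ A r s
      same r s with s Fin.≟ p
      ... | yes ≡.refl = refl
      ... | no  _      = refl

    -- Clearing one coordinate of `c` changes `F` by a multiple of its value at a matrix in which
    -- column `p` occurs twice.
    addColumn-invariant : ∀ A p c → c p ≈ 0# → F (addColumn c p A) ≈ F A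
    addColumn-invariant A p = vector-induction
      (λ c → c p ≈ 0# → F (addColumn c p A) ≈ F A)
      (λ c c′ c≈c′ ih c′≈0 → trans
        (congruent _ _ λ r s → +-congˡ (*-congʳ (sym (c≈c′ s)))) (ih (trans (c≈c′ p) c′≈0)))
      (λ _ → congruent _ _ λ r s → x+0*y≈x _ _ refl)
      step
      where
      step : ∀ c j → (clear j c p ≈ 0# → F (addColumn (clear j c) p A) ≈ F A) →
             c p ≈ 0# → F (addColumn c p A) ≈ F A
      step c j ih cₚ≈0 with j Fin.≟ p
      ... | yes ≡.refl = trans (congruent _ _ λ r s → +-congˡ (*-congʳ (same s)))
                               (ih (reflexive (clear-on j c)))
        where
        same : ∀ s → c s ≈ clear j c s
        same s with s Fin.≟ j
        ... | yes ≡.refl = cₚ≈0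
        ... | no  _      = refl
      ... | no  j≢p    = begin
        F B
          ≈⟨ linear j 1# (c j) B B′ B″
               (λ r s s≢j → +-congˡ (*-congʳ (sym (reflexive (clear-off j c s≢j)))))
               (λ r s s≢j → sym (reflexive (≔-off B j _ r s≢j)))
               (λ r → sym (+-cong
                  (trans (*-identityˡ _) (x+0*y≈x (A r j) (A r p) (reflexive (clear-on j c))))
                  (*-congˡ (reflexive (≔-on B j _ r))))) ⟩
        1# * F B′ + c j * F B″
          ≈⟨ +-cong (*-identityˡ _) (trans (*-congˡ (alternating B″ j≢p λ r →
               trans (reflexive (≔-on B j _ r)) (sym (trans (reflexive (≔-off B j _ r (j≢p ∘ ≡.sym)))
                 (x+0*y≈x (A r p) (A r p) cₚ≈0))))) (zeroʳ (c j))) ⟩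
        F B′ + 0#
          ≈⟨ +-identityʳ _ ⟩
        F B′
          ≈⟨ ih (trans (reflexive (clear-off j c (j≢p ∘ ≡.sym))) cₚ≈0) ⟩
        F A ∎
        where
        B  = addColumn c p A
        B′ = addColumn (clear j c) p A
        B″ = B [ j ≔ (λ r → A r p) ]

  -- Gaussian elimination by columns, and kernels

  -- The numbers of rows and columns are independent, so that the same step serves both wide systems
  -- of equations and determinants.
  module Elimination {m n} (A : Fin (suc m) → Vector Carrier n) (p : Fin n) (a≉0 : A zero p ≉ 0#) where

    factors : Vector Carrier n
    factors = clear p (λ j → - (A zero j * A zero p ⁻¹[ a≉0 ]))

    factors-pivot : factors p ≈ 0#
    factors-pivot = reflexive (clear-on p _)

    eliminated : Fin (suc m) → Vector Carrier n
    eliminated = addColumn factors p A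

    eliminated-pivot : ∀ r → eliminated r p ≈ A r p
    eliminated-pivot r = x+0*y≈x _ _ factors-pivot

    eliminated-row : ∀ j → j ≢ p → eliminated zero j ≈ 0#
    eliminated-row j j≢p = begin
      x + factors j * a      ≈⟨ +-congˡ (*-congʳ (reflexive (clear-off p _ j≢p))) ⟩
      x + - (x * b) * a      ≈⟨ solve 3 (λ x a b → x :+ (:- (x :* b)) :* a := x :+ :- (x :* (a :* b))) refl x a b ⟩
      x + - (x * (a * b))    ≈⟨ +-congˡ (-‿cong (trans (*-congˡ (⁻¹-inverse a≉0)) (*-identityʳ x))) ⟩
      x - x                  ≈⟨ -‿inverseʳ x ⟩
      0#                     ∎
      where
      x = A zero j
      a = A zero p
      b = a ⁻¹[ a≉0 ]

  firstNonzero : ∀ {n} (x : Vector Carrier n) → (∃ λ j → x j ≉ 0#) ⊎ (∀ j → x j ≈ 0#)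
  firstNonzero x with Fin.any? (λ j → ¬? (x j ≟ 0#))
  ... | yes nonzero = inj₁ nonzero
  ... | no  ∄nonzero = inj₂ λ j → decidable-stable (x j ≟ 0#) (λ xⱼ≉0 → ∄nonzero (j , xⱼ≉0))

  -- The nonzero coordinate `p` is part of the data: it later tells which unit vector to drop when
  -- the kernel vector is completed to a basis.
  Kernel : ∀ {m n} → (Fin m → Vector Carrier n) → Set _
  Kernel {n = n} A = ∃ λ (v : Vector Carrier n) → ∃ λ p → v p ≉ 0# × (∀ r → A r ∙ v ≈ 0#)

  kernel-extend : ∀ {m n} (A : Fin (suc m) → Vector Carrier (suc n)) p (a≉0 : A zero p ≉ 0#) →
    let open Elimination A p a≉0 in
    Kernel (λ r s → eliminated (suc r) (punchIn p s)) → Kernel A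
  kernel-extend A p a≉0 (w , q , w≉0 , Aw≈0) = v , punchIn p q , vq≉0 , λ r → trans (Av r) (Aw r)
    where
    open Elimination A p a≉0
    -- With this coordinate at `p`, applying `A` to `v` is the same as applying the eliminated
    -- matrix, without its pivot column, to `w`.
    x = (factors ∘ punchIn p) ∙ w
    v = insertAt w p x
    vₚ : v p ≡ x
    vₚ = insertAt-lookup w p x
    v-off : ∀ s → v (punchIn p s) ≡ w s
    v-off = insertAt-punchIn w p x

    vq≉0 : v (punchIn p q) ≉ 0#
    vq≉0 eq = w≉0 (trans (sym (reflexive (v-off q))) eq)

    Av : ∀ r → A r ∙ v ≈ (λ s → eliminated r (punchIn p s)) ∙ w
    Av r = begin
      A r ∙ v
        ≈⟨ sum-remove {i = p} (λ s → A r s * v s) ⟩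
      A r p * v p + sum (λ s → A r (punchIn p s) * v (punchIn p s))
        ≈⟨ +-cong (*-congˡ (reflexive vₚ)) (sum-cong-≋ λ s → *-congˡ (reflexive (v-off s))) ⟩
      A r p * x + (λ s → A r (punchIn p s)) ∙ w
        ≈⟨ solve 2 (λ a b → a :+ b := :1 :* b :+ a) refl (A r p * x) _ ⟩
      1# * ((λ s → A r (punchIn p s)) ∙ w) + A r p * x
        ≈⟨ ∙-linearˡ 1# (λ s → A r (punchIn p s)) (A r p) (factors ∘ punchIn p) w ⟨
      (λ s → 1# * A r (punchIn p s) + A r p * factors (punchIn p s)) ∙ w
        ≈⟨ ∙-congʳ (λ s → 1# * A r (punchIn p s) + A r p * factors (punchIn p s))
             (λ s → eliminated r (punchIn p s)) w (λ s → +-cong (*-identityˡ _) (*-comm _ _)) ⟩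
      (λ s → eliminated r (punchIn p s)) ∙ w ∎

    Aw : ∀ r → (λ s → eliminated r (punchIn p s)) ∙ w ≈ 0#
    Aw zero    = ∙-zeroˡ (λ s → eliminated zero (punchIn p s)) w
      λ s → eliminated-row _ (Fin.punchInᵢ≢i p s)
    Aw (suc r) = Aw≈0 r

  wide⇒kernel : ∀ {m} (A : Fin m → Vector Carrier (suc m)) → Kernel A
  wide⇒kernel {zero}  A = (λ _ → 1#) , zero , 0≉1 ∘ sym , λ ()
  wide⇒kernel {suc m} A with firstNonzero (A zero)
  ... | inj₁ (p , a≉0) = kernel-extend A p a≉0 (wide⇒kernel (λ r s → eliminated (suc r) (punchIn p s)))
    where open Elimination A p a≉0
  -- A zero row imposes nothing, so one unknown can be set to zero to keep exactly one unknown more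
  -- than there are equations.
  ... | inj₂ A₀≈0 with wide⇒kernel (λ r s → A (suc r) (suc s))
  ...   | w , q , w≉0 , Aw≈0 = extended w , suc q , w≉0 , λ where
          zero    → ∙-zeroˡ (A zero) (extended w) A₀≈0
          (suc r) → trans (trans (+-congʳ (zeroʳ _)) (+-identityˡ _)) (Aw≈0 r)
    where
    extended : Vector Carrier (suc m) → Vector Carrier (suc (suc m))
    extended w zero    = 0#
    extended w (suc s) = w s

  zeroRow⇒kernel : ∀ {n} (A : Mat (suc n)) → (∀ s → A zero s ≈ 0#) → Kernel A
  zeroRow⇒kernel A A₀≈0 with wide⇒kernel (A ∘ suc)
  ... | v , p , vₚ≉0 , Av≈0 = v , p , vₚ≉0 , λ where
    zero    → ∙-zeroˡ (A zero) v A₀≈0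
    (suc r) → Av≈0 r

  sign≉0 : ∀ {n} (j : Fin n) → sgn j ≉ 0#
  sign≉0 zero    = 0≉1 ∘ sym
  sign≉0 (suc j) eq = sign≉0 j
    (trans (sym (⁻¹-involutive (sgn j))) (trans (-‿cong eq) ε⁻¹≈ε))

  -- Elimination preserves the determinant, and expansion at the pivot passes its vanishing on to
  -- the minor. Applied to `x B - M` at a root, this is the source of eigenvectors.
  singular⇒kernel : ∀ {n} (A : Mat n) → Δ A ≈ 0# → Kernel A
  singular⇒kernel {zero}  A 1≈0 = contradiction (sym 1≈0) 0≉1
  singular⇒kernel {suc n} A detA≈0 with firstNonzero (A zero)
  ... | inj₂ A₀≈0 = zeroRow⇒kernel A A₀≈0
  ... | inj₁ (p , a≉0) = kernel-extend A p a≉0 (singular⇒kernel (minor eliminated p)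
    (xy≈0⇒y≈0 (*-nonzero (sign≉0 p) (λ eq → a≉0 (trans (sym (eliminated-pivot zero)) eq)))
      (begin
        sgn p * eliminated zero p * Δ (minor eliminated p)
          ≈⟨ det-pivot eliminated p eliminated-row ⟨
        Δ eliminated
          ≈⟨ addColumn-invariant det-isAlternating A p factors factors-pivot ⟩
        Δ A
          ≈⟨ detA≈0 ⟩
        0# ∎)))
    where open Elimination A p a≉0

  -- Uniqueness of alternating functions and multiplicativity of the determinant

  block : ∀ {n} → Mat n → Mat (suc n)
  block N zero    zero    = 1#
  block N zero    (suc s) = 0#
  block N (suc r) zero    = 0#
  block N (suc r) (suc s) = N r s

  -- Built from blocks so that `F I` is by definition the value of `F ∘ block` at the smaller
  -- identity, as the induction in `alternating-unique` requires.
  I : ∀ {n} → Mat n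
  I {suc n} = block I

  block-isAlternating : ∀ {n} {F : Mat (suc n) → Carrier} → IsAlternating F → IsAlternating (F ∘ block)
  block-isAlternating {n} {F} alt = record
    { congruent   = λ A B A≈B → congruent (block A) (block B) (block-cong A B A≈B)
    ; linear      = λ j a b A A′ A″ A≈A′ A≈A″ A≈ →
        linear (suc j) a b (block A) (block A′) (block A″) (off j A A′ A≈A′) (off j A A″ A≈A″) λ where
          zero    → sym (trans (+-cong (zeroʳ a) (zeroʳ b)) (+-identityˡ 0#))
          (suc r) → A≈ r
    ; alternating = λ A i≢j Aᵢ≈Aⱼ → alternating (block A) (i≢j ∘ Fin.suc-injective) λ where
        zero    → refl
        (suc r) → Aᵢ≈Aⱼ r
    }
    where
    open IsAlternating alt
    block-cong : ∀ A B → (∀ r s → A r s ≈ B r s) → ∀ r s → block A r s ≈ block B r s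
    block-cong A B A≈B zero    zero    = refl
    block-cong A B A≈B zero    (suc s) = refl
    block-cong A B A≈B (suc r) zero    = refl
    block-cong A B A≈B (suc r) (suc s) = A≈B r s

    off : ∀ j (A B : Mat n) → (∀ r s → s ≢ j → A r s ≈ B r s) →
          ∀ r s → s ≢ suc j → block A r s ≈ block B r s
    off j A B A≈B zero    zero    s≢j = refl
    off j A B A≈B zero    (suc s) s≢j = refl
    off j A B A≈B (suc r) zero    s≢j = refl
    off j A B A≈B (suc r) (suc s) s≢j = A≈B r s (s≢j ∘ ≡.cong suc)

  det-block : ∀ {n} (N : Mat n) → Δ (block N) ≈ Δ N
  det-block N = trans
    (det-pivot (block N) zero λ where
      zero    0≢0 → contradiction ≡.refl 0≢0
      (suc j) _   → refl)
    (trans (*-congʳ (*-identityˡ 1#)) (*-identityˡ (Δ N)))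

  module _ {n} {F : Mat (suc n) → Carrier} (isAlternating : IsAlternating F) where
    open IsAlternating isAlternating

    -- A zero row leaves fewer equations than unknowns, so the columns are linearly dependent.
    zeroRow⇒0 : ∀ A → (∀ s → A zero s ≈ 0#) → F A ≈ 0#
    zeroRow⇒0 A A₀≈0 with zeroRow⇒kernel A A₀≈0
    ... | v , p , vₚ≉0 , Av≈0 = kernel⇒0 isAlternating A v p vₚ≉0 Av≈0

    -- After elimination the first column is the corner entry times a unit vector plus a column that
    -- starts with zero. The matrix with the latter column has a zero first row and contributes
    -- nothing.
    reduce-to-block : ∀ A (a≉0 : A zero zero ≉ 0#) →
      F A ≈ A zero zero * F (block (minor (Elimination.eliminated A zero a≉0) zero))
    reduce-to-block A a≉0 = begin
      F A
        ≈⟨ addColumn-invariant isAlternating A zero factors factors-pivot ⟨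
      F eliminated
        ≈⟨ linear zero (A zero zero) 1# eliminated (block N) Z
             offB offZ on ⟩
      A zero zero * F (block N) + 1# * F Z
        ≈⟨ +-congˡ (trans (*-identityˡ _) (zeroRow⇒0 Z rowZ)) ⟩
      A zero zero * F (block N) + 0#
        ≈⟨ +-identityʳ _ ⟩
      A zero zero * F (block N)
        ∎
      where
      open Elimination A zero a≉0
      N = minor eliminated zero
      Z : Mat (suc n)
      Z zero    zero    = 0#
      Z (suc r) zero    = eliminated (suc r) zero
      Z r       (suc s) = eliminated r (suc s)

      rowZ : ∀ s → Z zero s ≈ 0#
      rowZ zero    = refl
      rowZ (suc s) = eliminated-row (suc s) λ ()

      offB : ∀ r s → s ≢ zero → eliminated r s ≈ block N r s
      offB r       zero    s≢0 = contradiction ≡.refl s≢0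
      offB zero    (suc s) s≢0 = eliminated-row (suc s) s≢0
      offB (suc r) (suc s) s≢0 = refl

      offZ : ∀ r s → s ≢ zero → eliminated r s ≈ Z r s
      offZ r       zero    s≢0 = contradiction ≡.refl s≢0
      offZ zero    (suc s) s≢0 = refl
      offZ (suc r) (suc s) s≢0 = refl

      on : ∀ r → eliminated r zero ≈ A zero zero * block N r zero + 1# * Z r zero
      on zero    = trans (eliminated-pivot zero)
        (solve 1 (λ a → a := a :* :1 :+ :1 :* :0) refl (A zero zero))
      on (suc r) = solve 2 (λ a b → b := a :* :0 :+ :1 :* b) refl (A zero zero) (eliminated (suc r) zero)

  -- Induction on the size: elimination at a nonzero corner takes `F` and `Δ` to the same block
  -- matrix with the same factor, and if the first row is zero, both vanish.
  alternating-unique : ∀ {n} {F : Mat n → Carrier} → IsAlternating F → ∀ A → F A ≈ F I * Δ A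
  alternating-unique {zero}      alt A =
    trans (IsAlternating.congruent alt A I λ ()) (sym (*-identityʳ _))
  alternating-unique {suc n} {F} alt A with firstNonzero (A zero)
  ... | inj₂ A₀≈0 = trans (zeroRow⇒0 alt A A₀≈0)
    (sym (trans (*-congˡ (zeroRow⇒0 det-isAlternating A A₀≈0)) (zeroʳ _)))
  ... | inj₁ (p , Aₚ≉0) = nonzeroRow p Aₚ≉0 (A zero zero ≟ 0#)
    where
    pivot : ∀ A → A zero zero ≉ 0# → F A ≈ F I * Δ A
    pivot A a≉0 = begin
      F A                     ≈⟨ reduce-to-block alt A a≉0 ⟩
      a * F (block N)         ≈⟨ *-congˡ (alternating-unique (block-isAlternating alt) N) ⟩
      a * (F I * Δ N)         ≈⟨ solve 3 (λ a f d → a :* (f :* d) := f :* (a :* d)) refl a (F I) (Δ N) ⟩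
      F I * (a * Δ N)         ≈⟨ *-congˡ (*-congˡ (det-block N)) ⟨
      F I * (a * Δ (block N)) ≈⟨ *-congˡ (reduce-to-block det-isAlternating A a≉0) ⟨
      F I * Δ A               ∎
      where
      a = A zero zero
      N = minor (Elimination.eliminated A zero a≉0) zero

    nonzeroRow : ∀ p → A zero p ≉ 0# → Dec (A zero zero ≈ 0#) → F A ≈ F I * Δ A
    nonzeroRow p       Aₚ≉0 (no  a≉0) = pivot A a≉0
    nonzeroRow zero    a≉0  (yes a≈0) = contradiction a≈0 a≉0
    -- The coefficients `I zero` add column `suc p` to column `zero` alone, which makes the corner
    -- nonzero.
    nonzeroRow (suc p) Aₚ≉0 (yes a≈0) = begin
      F A          ≈⟨ addColumn-invariant alt A (suc p) (I zero) refl ⟨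
      F A₁         ≈⟨ pivot A₁ (λ eq → Aₚ≉0 (begin
        A zero (suc p)            ≈⟨ solve 1 (λ x → x := :0 :+ :1 :* x) refl (A zero (suc p)) ⟩
        0# + 1# * A zero (suc p)  ≈⟨ +-congʳ a≈0 ⟨
        A₁ zero zero              ≈⟨ eq ⟩
        0#                        ∎)) ⟩
      F I * Δ A₁   ≈⟨ *-congˡ (addColumn-invariant det-isAlternating A (suc p) (I zero) refl) ⟩
      F I * Δ A    ∎
      where
      A₁ = addColumn (I zero) (suc p) A

  infixl 7 _⊗_
  _⊗_ : ∀ {n} → Mat n → Mat n → Mat n
  (Q ⊗ A) i j = Q i ∙ (λ k → A k j)

  leftProduct-isAlternating : ∀ {n} (Q : Mat n) → IsAlternating (λ A → Δ (Q ⊗ A))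
  leftProduct-isAlternating Q = record
    { congruent   = λ A B A≈B → det-cong (Q ⊗ A) (Q ⊗ B) λ r s →
        ∙-congˡ (Q r) (λ k → A k s) (λ k → B k s) (λ k → A≈B k s)
    ; linear      = λ j a b A A′ A″ A≈A′ A≈A″ A≈ →
        det-linear j a b {Q ⊗ A} {Q ⊗ A′} {Q ⊗ A″}
          (λ r s s≢j → ∙-congˡ (Q r) (λ k → A k s) (λ k → A′ k s) (λ k → A≈A′ k s s≢j))
          (λ r s s≢j → ∙-congˡ (Q r) (λ k → A k s) (λ k → A″ k s) (λ k → A≈A″ k s s≢j))
          (λ r → trans (∙-congˡ (Q r) (λ k → A k j) (λ k → a * A′ k j + b * A″ k j) A≈)
            (∙-linearʳ (Q r) a (λ k → A′ k j) b (λ k → A″ k j)))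
    ; alternating = λ {i} {j} A i≢j Aᵢ≈Aⱼ →
        det-alternating (Q ⊗ A) i≢j λ r → ∙-congˡ (Q r) (λ k → A k i) (λ k → A k j) Aᵢ≈Aⱼ
    }

  I-on : ∀ {n} (i : Fin n) → I i i ≈ 1#
  I-on zero    = refl
  I-on (suc i) = I-on i

  I-off : ∀ {n} {i j : Fin n} → i ≢ j → I i j ≈ 0#
  I-off {i = zero}  {zero}  i≢j = contradiction ≡.refl i≢j
  I-off {i = zero}  {suc j} i≢j = refl
  I-off {i = suc i} {zero}  i≢j = refl
  I-off {i = suc i} {suc j} i≢j = I-off (i≢j ∘ ≡.cong suc)

  ∙-unit : ∀ {n} (y : Vector Carrier n) j → y ∙ (λ k → I k j) ≈ y j
  ∙-unit y j = begin
    y ∙ (λ k → I k j)  ≈⟨ sum-single {f = λ k → y k * I k j} j (λ k k≢j → trans (*-congˡ {y k} (I-off k≢j)) (zeroʳ (y k))) ⟩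
    y j * I j j        ≈⟨ *-congˡ (I-on j) ⟩
    y j * 1#           ≈⟨ *-identityʳ _ ⟩
    y j                ∎

  -- For fixed `Q` the left side is alternating in the columns of `A`, and its value at `I` is
  -- `Δ Q`.
  det-⊗ : ∀ {n} (Q A : Mat n) → Δ (Q ⊗ A) ≈ Δ Q * Δ A
  det-⊗ Q A = trans (alternating-unique (leftProduct-isAlternating Q) A)
    (*-congʳ (det-cong (Q ⊗ I) Q λ r s → ∙-unit (Q r) s))

  -- Polynomial functions

  -- p is given by a polynomial with at most d coefficients: p vanishes if
  -- d = 0, and otherwise every p(x) - p(a) has the factor x - a.
  Polynomial< : ℕ → (Carrier → Carrier) → Set (c ⊔ ℓ₁)
  Polynomial< zero    p = ∀ x → p x ≈ 0#
  Polynomial< (suc d) p =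
    ∀ a → ∃ λ q → Polynomial< d q × (∀ x → p x ≈ p a + (x - a) * q x)

  polynomial-zero : ∀ d → Polynomial< d (λ _ → 0#)
  polynomial-zero zero    x = refl
  polynomial-zero (suc d) a = (λ _ → 0#) , polynomial-zero d , λ x →
    solve 2 (λ x a → :0 := :0 :+ (x :- a) :* :0) refl x a

  polynomial-≤ : ∀ {d e p} → d ℕ.≤ e → Polynomial< d p → Polynomial< e p
  polynomial-≤ {e = zero}  z≤n p≈0 = p≈0
  polynomial-≤ {e = suc e} {p} z≤n p≈0 a = (λ _ → 0#) , polynomial-zero e , λ x → begin
    p x                    ≈⟨ p≈0 x ⟩
    0#                     ≈⟨ solve 2 (λ x a → :0 := :0 :+ (x :- a) :* :0) refl x a ⟩
    0# + (x - a) * 0#      ≈⟨ +-congʳ (p≈0 a) ⟨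
    p a + (x - a) * 0#     ∎
  polynomial-≤ (s≤s d≤e) poly a with poly a
  ... | q , poly-q , eq = q , polynomial-≤ d≤e poly-q , eq

  polynomial-+ : ∀ {d p r} → Polynomial< d p → Polynomial< d r → Polynomial< d (λ x → p x + r x)
  polynomial-+ {zero}  p≈0 r≈0 x = trans (+-cong (p≈0 x) (r≈0 x)) (+-identityˡ 0#)
  polynomial-+ {suc d} {p} {r} poly-p poly-r a with poly-p a | poly-r a
  ... | q , poly-q , p≈ | s , poly-s , r≈ = (λ x → q x + s x) , polynomial-+ poly-q poly-s , λ x →
    trans (+-cong (p≈ x) (r≈ x))
      (solve 5 (λ p r y q s → (p :+ y :* q) :+ (r :+ y :* s) := (p :+ r) :+ y :* (q :+ s))
        refl (p a) (r a) (x - a) (q x) (s x))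

  polynomial-scale : ∀ {d p} b → Polynomial< d p → Polynomial< d (λ x → b * p x)
  polynomial-scale {zero}  b p≈0 x = trans (*-congˡ (p≈0 x)) (zeroʳ b)
  polynomial-scale {suc d} {p} b poly-p a with poly-p a
  ... | q , poly-q , p≈ = (λ x → b * q x) , polynomial-scale b poly-q , λ x →
    trans (*-congˡ (p≈ x))
      (solve 4 (λ b p y q → b :* (p :+ y :* q) := b :* p :+ y :* (b :* q))
        refl b (p a) (x - a) (q x))

  polynomial-* : ∀ {d e p r} → Polynomial< d p → Polynomial< e r →
                 Polynomial< (d ℕ.+ e) (λ x → p x * r x)
  polynomial-* {zero} {e} {p} {r} p≈0 _ = polynomial-≤ {zero} {e} z≤n λ x →
    trans (*-congʳ (p≈0 x)) (zeroˡ (r x))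
  polynomial-* {suc d} {zero} {p} {r} _ r≈0 = polynomial-≤ {zero} {suc d ℕ.+ zero} z≤n λ x →
    trans (*-congˡ (r≈0 x)) (zeroʳ (p x))
  polynomial-* {suc d} {suc e} {p} {r} poly-p poly-r a with poly-p a | poly-r a
  ... | q , poly-q , p≈ | s , poly-s , r≈ =
    -- The quotient comes from p r - p(a) r(a) = (p - p(a)) r + p(a) (r - r(a)), as in the product
    -- rule.
    (λ x → q x * r x + p a * s x) ,
    polynomial-+ (polynomial-* poly-q poly-r)
      (polynomial-≤ (ℕ.≤-trans (ℕ.n≤1+n e) (ℕ.m≤n+m (suc e) d)) (polynomial-scale (p a) poly-s)) ,
    λ x → begin
      p x * r x
        ≈⟨ *-congʳ (p≈ x) ⟩
      (p a + (x - a) * q x) * r x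
        ≈⟨ distribʳ _ _ _ ⟩
      p a * r x + (x - a) * q x * r x
        ≈⟨ +-congʳ (*-congˡ (r≈ x)) ⟩
      p a * (r a + (x - a) * s x) + (x - a) * q x * r x
        ≈⟨ solve 6 (λ p ra y s q rx → p :* (ra :+ y :* s) :+ y :* q :* rx
             := p :* ra :+ y :* (q :* rx :+ p :* s)) refl (p a) (r a) (x - a) (s x) (q x) (r x) ⟩
      p a * r a + (x - a) * (q x * r x + p a * s x)
        ∎

  IsPolynomial : (Carrier → Carrier) → Set (c ⊔ ℓ₁)
  IsPolynomial p = ∃ λ d → Polynomial< d p

  isPolynomial-const : ∀ b → IsPolynomial (λ _ → b)
  isPolynomial-const b = 1 , λ a → (λ _ → 0#) , polynomial-zero 0 , λ x →
    solve 3 (λ x a b → b := b :+ (x :- a) :* :0) refl x a b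

  isPolynomial-id : IsPolynomial (λ x → x)
  isPolynomial-id = 2 , λ a → (λ _ → 1#) , proj₂ (isPolynomial-const 1#) , λ x →
    solve 2 (λ x a → x := a :+ (x :- a) :* :1) refl x a

  isPolynomial-* : ∀ {p r} → IsPolynomial p → IsPolynomial r → IsPolynomial (λ x → p x * r x)
  isPolynomial-* (_ , poly-p) (_ , poly-r) = _ , polynomial-* poly-p poly-r

  isPolynomial-+ : ∀ {p r} → IsPolynomial p → IsPolynomial r → IsPolynomial (λ x → p x + r x)
  isPolynomial-+ (d , poly-p) (e , poly-r) = d ℕ.+ e ,
    polynomial-+ (polynomial-≤ (ℕ.m≤m+n d e) poly-p) (polynomial-≤ (ℕ.m≤n+m e d) poly-r)

  isPolynomial-linear : ∀ a b → IsPolynomial (λ x → x * a - b)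
  isPolynomial-linear a b =
    isPolynomial-+ (isPolynomial-* isPolynomial-id (isPolynomial-const a)) (isPolynomial-const (- b))

  isPolynomial-sum : ∀ {n} {p : Fin n → Carrier → Carrier} → (∀ i → IsPolynomial (p i)) →
                     IsPolynomial (λ x → sum λ i → p i x)
  isPolynomial-sum {zero}  poly = isPolynomial-const 0#
  isPolynomial-sum {suc n} poly = isPolynomial-+ (poly zero) (isPolynomial-sum (poly ∘ suc))

  isPolynomial-det : ∀ {n} (A : Carrier → Mat n) → (∀ i j → IsPolynomial (λ x → A x i j)) →
                     IsPolynomial (λ x → Δ (A x))
  isPolynomial-det {zero}  A poly = isPolynomial-const 1#
  isPolynomial-det {suc n} A poly = isPolynomial-sum λ j →
    isPolynomial-* (isPolynomial-* (isPolynomial-const (sgn j)) (poly zero j))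
      (isPolynomial-det (λ x → minor (A x) j) (λ r s → poly (suc r) (punchIn j s)))

  rootProduct : ∀ {n} → Vec Carrier n → Carrier → Carrier
  rootProduct λs x = product λ i → x - lookup λs i

  isPolynomial-rootProduct : ∀ {n} (λs : Vec Carrier n) → IsPolynomial (rootProduct λs)
  isPolynomial-rootProduct []       = isPolynomial-const 1#
  isPolynomial-rootProduct (a ∷ λs) =
    isPolynomial-* (isPolynomial-+ isPolynomial-id (isPolynomial-const (- a)))
      (isPolynomial-rootProduct λs)

  -- Splitting off the root `t 0` leaves a quotient with one coefficient less, which vanishes at all
  -- later `t k`. An infinite sequence of roots spares the comparison of their number with the
  -- degree.
  polynomial-infinite-roots : ∀ d {p} → Polynomial< d p → (t : ℕ → Carrier) →
    (∀ {k l} → k ℕ.< l → t k ≉ t l) → (∀ k → p (t k) ≈ 0#) → ∀ x → p x ≈ 0#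
  polynomial-infinite-roots zero    p≈0  t t-distinct roots x = p≈0 x
  polynomial-infinite-roots (suc d) {p} poly t t-distinct roots x with poly (t 0)
  ... | q , poly-q , p≈ = begin
    p x                             ≈⟨ p≈ x ⟩
    p (t 0) + (x - t 0) * q x       ≈⟨ +-cong (roots 0) (*-congˡ (q≈0 x)) ⟩
    0# + (x - t 0) * 0#             ≈⟨ solve 1 (λ y → :0 :+ y :* :0 := :0) refl (x - t 0) ⟩
    0#                              ∎
    where
    q≈0 : ∀ x → q x ≈ 0#
    q≈0 = polynomial-infinite-roots d poly-q (t ∘ suc) (t-distinct ∘ s≤s) λ k →
      xy≈0⇒y≈0 (λ eq → t-distinct {0} {suc k} (s≤s z≤n) (sym (x-y≈0⇒x≈y eq))) (begin
        (t (suc k) - t 0) * q (t (suc k))            ≈⟨ +-identityˡ _ ⟨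
        0# + (t (suc k) - t 0) * q (t (suc k))       ≈⟨ +-congʳ (roots 0) ⟨
        p (t 0) + (t (suc k) - t 0) * q (t (suc k))  ≈⟨ p≈ (t (suc k)) ⟨
        p (t (suc k))                                ≈⟨ roots (suc k) ⟩
        0#                                           ∎)

  -- The hypothesis says nothing at `a` itself, but it makes `p` vanish at a + 1, a + 2, and so on,
  -- which are infinitely many points because the characteristic is zero.
  cancel-root : ∀ {p} → IsPolynomial p → ∀ a → (∀ x → (x - a) * p x ≈ 0#) → ∀ x → p x ≈ 0#
  cancel-root (d , poly) a eq = polynomial-infinite-roots d poly (λ k → a + fromℕ (suc k))
    (λ {k} {l} k<l tₖ≈tₗ → proj₂ (fromℕ-mono-< k<l) (begin
      fromℕ k                        ≈⟨ solve 2 (λ a y → y := (a :+ (:1 :+ y)) :- (a :+ :1)) refl a (fromℕ k) ⟩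
      a + fromℕ (suc k) - (a + 1#)   ≈⟨ +-congʳ tₖ≈tₗ ⟩
      a + fromℕ (suc l) - (a + 1#)   ≈⟨ solve 2 (λ a y → y := (a :+ (:1 :+ y)) :- (a :+ :1)) refl a (fromℕ l) ⟨
      fromℕ l                        ∎))
    (λ k → xy≈0⇒y≈0 (λ a+1+k-a≈0 → fromℕ-suc≉0 k (begin
      fromℕ (suc k)           ≈⟨ solve 2 (λ a y → y := (a :+ y) :- a) refl a (fromℕ (suc k)) ⟩
      a + fromℕ (suc k) - a   ≈⟨ a+1+k-a≈0 ⟩
      0#                      ∎)) (eq (a + fromℕ (suc k))))

  -- Bilinear forms

  form : ∀ {n} → Mat n → Vector Carrier n → Vector Carrier n → Carrier
  form A y z = y ∙ (λ i → A i ∙ z)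

  form-linearʳ : ∀ {n} (A : Mat n) y a z b z′ →
    form A y (λ i → a * z i + b * z′ i) ≈ a * form A y z + b * form A y z′
  form-linearʳ A y a z b z′ = trans
    (∙-congˡ y (λ i → A i ∙ (λ i → a * z i + b * z′ i)) (λ i → a * (A i ∙ z) + b * (A i ∙ z′))
      λ i → ∙-linearʳ (A i) a z b z′)
    (∙-linearʳ y a (λ i → A i ∙ z) b (λ i → A i ∙ z′))

  form-linearˡ : ∀ {n} (A : Mat n) a y b y′ z →
    form A (λ i → a * y i + b * y′ i) z ≈ a * form A y z + b * form A y′ z
  form-linearˡ A a y b y′ z = ∙-linearˡ a y b y′ (λ i → A i ∙ z)

  IsSymmetric : ∀ {n} → Mat n → Set _
  IsSymmetric A = ∀ i j → A i j ≈ A j i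

  form-sym : ∀ {n} {A : Mat n} → IsSymmetric A → ∀ y z → form A y z ≈ form A z y
  form-sym {A = A} symmetric y z = begin
    y ∙ (λ i → A i ∙ z)              ≈⟨ ∙-exchange y A z ⟩
    (λ j → y ∙ (λ i → A i j)) ∙ z    ≈⟨ ∙-comm (λ j → y ∙ (λ i → A i j)) z ⟩
    z ∙ (λ j → y ∙ (λ i → A i j))    ≈⟨ ∙-congˡ z (λ j → y ∙ (λ i → A i j)) (λ j → A j ∙ y) (λ j →
      trans (∙-comm y (λ i → A i j)) (∙-congʳ (λ i → A i j) (A j) y λ i → symmetric i j)) ⟩
    z ∙ (λ j → A j ∙ y)              ∎

  combination : ∀ {m n} → Vector Carrier m → (Fin m → Vector Carrier n) → Vector Carrier n
  combination y w a = y ∙ (λ i → w i a)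

  combination-∙ : ∀ {m n} (y : Vector Carrier m) (w : Fin m → Vector Carrier n) z →
    combination y w ∙ z ≈ y ∙ (λ i → w i ∙ z)
  combination-∙ y w z = sym (∙-exchange y w z)

  gram : ∀ {m n} → Mat n → (Fin m → Vector Carrier n) → Mat m
  gram A w i j = form A (w i) (w j)

  gram-symmetric : ∀ {m n} {A : Mat n} (w : Fin m → Vector Carrier n) →
    IsSymmetric A → IsSymmetric (gram A w)
  gram-symmetric w symmetric i j = form-sym symmetric (w i) (w j)

  form-combinationʳ : ∀ {m n} (A : Mat n) u (w : Fin m → Vector Carrier n) z →
    form A u (combination z w) ≈ (λ j → form A u (w j)) ∙ z
  form-combinationʳ A u w z = begin
    u ∙ (λ k → A k ∙ combination z w)
      ≈⟨ ∙-congˡ u (λ k → A k ∙ combination z w) (λ k → (λ j → A k ∙ w j) ∙ z) (λ k → begin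
           A k ∙ combination z w      ≈⟨ ∙-comm (A k) (combination z w) ⟩
           combination z w ∙ A k      ≈⟨ combination-∙ z w (A k) ⟩
           z ∙ (λ j → w j ∙ A k)      ≈⟨ ∙-comm z (λ j → w j ∙ A k) ⟩
           (λ j → w j ∙ A k) ∙ z      ≈⟨ ∙-congʳ (λ j → w j ∙ A k) (λ j → A k ∙ w j) z
                                          (λ j → ∙-comm (w j) (A k)) ⟩
           (λ j → A k ∙ w j) ∙ z      ∎) ⟩
    u ∙ (λ k → (λ j → A k ∙ w j) ∙ z)
      ≈⟨ ∙-exchange u (λ k j → A k ∙ w j) z ⟩
    (λ j → form A u (w j)) ∙ z ∎

  form-combination : ∀ {m n} (A : Mat n) (w : Fin m → Vector Carrier n) y z →
    form A (combination y w) (combination z w) ≈ form (gram A w) y z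
  form-combination A w y z = begin
    combination y w ∙ (λ k → A k ∙ combination z w)
      ≈⟨ combination-∙ y w (λ k → A k ∙ combination z w) ⟩
    y ∙ (λ i → form A (w i) (combination z w))
      ≈⟨ ∙-congˡ y (λ i → form A (w i) (combination z w)) (λ i → gram A w i ∙ z)
           (λ i → form-combinationʳ A (w i) w z) ⟩
    form (gram A w) y z ∎

  pencil : ∀ {n} → Carrier → Mat n → Mat n → Mat n
  pencil x B M i j = x * B i j - M i j

  form-pencil : ∀ {n} x (B M : Mat n) y z → form (pencil x B M) y z ≈ x * form B y z - form M y z
  form-pencil x B M y z = begin
    y ∙ (λ i → pencil x B M i ∙ z)
      ≈⟨ ∙-congˡ y (λ i → pencil x B M i ∙ z) (λ i → x * (B i ∙ z) + - 1# * (M i ∙ z)) (λ i → trans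
           (∙-congʳ (pencil x B M i) (λ j → x * B i j + - 1# * M i j) z λ j →
             solve 3 (λ x b m → x :* b :- m := x :* b :+ :- :1 :* m) refl x (B i j) (M i j))
           (∙-linearˡ x (B i) (- 1#) (M i) z)) ⟩
    y ∙ (λ i → x * (B i ∙ z) + - 1# * (M i ∙ z))
      ≈⟨ ∙-linearʳ y x (λ i → B i ∙ z) (- 1#) (λ i → M i ∙ z) ⟩
    x * form B y z + - 1# * form M y z
      ≈⟨ solve 2 (λ u v → u :+ :- :1 :* v := u :- v) refl (x * form B y z) (form M y z) ⟩
    x * form B y z - form M y z ∎

  -- By definition `gram A Q` is the product of `Q`, `A` and the transpose of `Q`, whose rows and
  -- columns are the given vectors.
  det-gram : ∀ {n} (A Q : Mat n) → Δ (gram A Q) ≈ Δ Q * (Δ A * Δ (λ i j → Q j i))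
  det-gram A Q = trans (det-⊗ Q (A ⊗ (λ i j → Q j i))) (*-congˡ (det-⊗ A (λ i j → Q j i)))

  I-row : ∀ {n} i (y : Vector Carrier n) → I i ∙ y ≈ y i
  I-row i y = begin
    I i ∙ y        ≈⟨ sum-single {f = λ k → I i k * y k} i (λ k k≢i →
                        trans (*-congʳ {y k} (I-off (k≢i ∘ ≡.sym))) (zeroˡ (y k))) ⟩
    I i i * y i    ≈⟨ *-congʳ (I-on i) ⟩
    1# * y i       ≈⟨ *-identityˡ (y i) ⟩
    y i            ∎

  -- Splitting off an eigenvector

  PositiveDefinite : ∀ {n} → Mat n → Set _
  PositiveDefinite B = ∀ y → form B y y ≤ 0# → ∀ i → y i ≈ 0#

  -- The vectors w i span the B-orthogonal complement of the eigenvector v.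
  module Deflation {n} (B M : Mat (suc n)) (B-sym : IsSymmetric B) (M-sym : IsSymmetric M)
    (a : Carrier) (v : Vector Carrier (suc n)) (p : Fin (suc n)) (vₚ≉0 : v p ≉ 0#)
    (β≉0 : form B v v ≉ 0#) (eigen : ∀ r → pencil a B M r ∙ v ≈ 0#) where

    β : Carrier
    β = form B v v

    -- Gram-Schmidt: the unit vectors other than the one at `p` are projected along `v`. As `v p` is
    -- nonzero, they form a basis together with `v`, before and after the projection.
    coefficient : Vector Carrier n
    coefficient i = form B v (I (punchIn p i)) * β ⁻¹[ β≉0 ]

    w : Fin n → Vector Carrier (suc n)
    w i k = 1# * I (punchIn p i) k + - coefficient i * v k

    Bvw≈0 : ∀ i → form B v (w i) ≈ 0#
    Bvw≈0 i = begin
      form B v (w i)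
        ≈⟨ form-linearʳ B v 1# (I (punchIn p i)) (- coefficient i) v ⟩
      1# * x + - (x * β ⁻¹[ β≉0 ]) * β
        ≈⟨ solve 3 (λ x b c → :1 :* x :+ :- (x :* c) :* b := x :- x :* (b :* c)) refl x β (β ⁻¹[ β≉0 ]) ⟩
      x - x * (β * β ⁻¹[ β≉0 ])
        ≈⟨ +-congˡ (-‿cong (trans (*-congˡ (⁻¹-inverse β≉0)) (*-identityʳ x))) ⟩
      x - x
        ≈⟨ -‿inverseʳ x ⟩
      0# ∎
      where x = form B v (I (punchIn p i))

    -- Against the eigenvector `M` is `a` times `B`; therefore being orthogonal to `v` for `B`
    -- implies the same for `M`.
    Myv≈ : ∀ y → form M y v ≈ a * form B y v
    Myv≈ y = sym (x-y≈0⇒x≈y (begin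
      a * form B y v - form M y v      ≈⟨ form-pencil a B M y v ⟨
      form (pencil a B M) y v          ≈⟨ ∙-congˡ y (λ i → pencil a B M i ∙ v) (λ _ → 0#) eigen ⟩
      y ∙ (λ _ → 0#)                   ≈⟨ sum-zero {f = λ i → y i * 0#} (λ i → zeroʳ (y i)) ⟩
      0#                               ∎))

    orthogonal : ∀ z → form B v (combination z w) ≈ 0#
    orthogonal z = trans (form-combinationʳ B v w z) (∙-zeroˡ (λ j → form B v (w j)) z Bvw≈0)

    combination-w : ∀ z k →
      combination z w k ≈ z ∙ (λ i → I (punchIn p i) k) - (z ∙ coefficient) * v k
    combination-w z k = begin
      z ∙ (λ i → 1# * I (punchIn p i) k + - coefficient i * v k)
        ≈⟨ ∙-congˡ z (λ i → w i k) (λ i → 1# * I (punchIn p i) k + - v k * coefficient i)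
             (λ i → solve 3 (λ x c y → :1 :* x :+ :- c :* y := :1 :* x :+ :- y :* c) refl
               (I (punchIn p i) k) (coefficient i) (v k)) ⟩
      z ∙ (λ i → 1# * I (punchIn p i) k + - v k * coefficient i)
        ≈⟨ ∙-linearʳ z 1# (λ i → I (punchIn p i) k) (- v k) coefficient ⟩
      1# * (z ∙ (λ i → I (punchIn p i) k)) + - v k * (z ∙ coefficient)
        ≈⟨ solve 3 (λ x y c → :1 :* x :+ :- y :* c := x :- c :* y) refl
             (z ∙ (λ i → I (punchIn p i) k)) (v k) (z ∙ coefficient) ⟩
      z ∙ (λ i → I (punchIn p i) k) - (z ∙ coefficient) * v k ∎

    combination-w-pivot : ∀ z → combination z w p ≈ - (z ∙ coefficient) * v p
    combination-w-pivot z = begin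
      combination z w p
        ≈⟨ combination-w z p ⟩
      z ∙ (λ i → I (punchIn p i) p) - (z ∙ coefficient) * v p
        ≈⟨ +-congʳ (sum-zero {f = λ i → z i * I (punchIn p i) p} λ i →
             trans (*-congˡ (I-off (Fin.punchInᵢ≢i p i))) (zeroʳ (z i))) ⟩
      0# - (z ∙ coefficient) * v p
        ≈⟨ solve 2 (λ c y → :0 :- c :* y := :- c :* y) refl (z ∙ coefficient) (v p) ⟩
      - (z ∙ coefficient) * v p ∎

    combination-w-off : ∀ z k →
      combination z w (punchIn p k) ≈ z k - (z ∙ coefficient) * v (punchIn p k)
    combination-w-off z k = trans (combination-w z (punchIn p k)) (+-congʳ (begin
      z ∙ (λ i → I (punchIn p i) (punchIn p k))
        ≈⟨ sum-single {f = λ i → z i * I (punchIn p i) (punchIn p k)} k (λ i i≢k →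
             trans (*-congˡ (I-off (i≢k ∘ Fin.punchIn-injective p i k))) (zeroʳ (z i))) ⟩
      z k * I (punchIn p k) (punchIn p k)
        ≈⟨ *-congˡ (I-on (punchIn p k)) ⟩
      z k * 1#
        ≈⟨ *-identityʳ (z k) ⟩
      z k ∎))

    -- The coordinate at `p` shows that `t` equals `z ∙ coefficient`. With this the terms in `v`
    -- cancel at all other coordinates, which leaves `z`; once `z` is zero, so is `t`.
    independent : ∀ t z → (∀ k → t * v k + combination z w k ≈ 0#) → t ≈ 0# × (∀ k → z k ≈ 0#)
    independent t z eq = t≈0 , z≈0
      where
      s = z ∙ coefficient
      t-s≈0 : t - s ≈ 0#
      t-s≈0 = xy≈0⇒y≈0 vₚ≉0 (begin
        v p * (t - s)               ≈⟨ solve 3 (λ t s y → y :* (t :- s) := t :* y :+ :- s :* y) refl t s (v p) ⟩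
        t * v p + - s * v p         ≈⟨ +-congˡ (combination-w-pivot z) ⟨
        t * v p + combination z w p ≈⟨ eq p ⟩
        0#                          ∎)
      z≈0 : ∀ k → z k ≈ 0#
      z≈0 k = begin
        z k
          ≈⟨ solve 4 (λ t s y z → z := t :* y :+ (z :- s :* y) :- (t :- s) :* y) refl
               t s (v (punchIn p k)) (z k) ⟩
        t * v (punchIn p k) + (z k - s * v (punchIn p k)) - (t - s) * v (punchIn p k)
          ≈⟨ +-cong (+-congˡ (sym (combination-w-off z k))) (-‿cong (*-congʳ t-s≈0)) ⟩
        t * v (punchIn p k) + combination z w (punchIn p k) - 0# * v (punchIn p k)
          ≈⟨ +-congʳ (eq (punchIn p k)) ⟩
        0# - 0# * v (punchIn p k)
          ≈⟨ solve 1 (λ y → :0 :- :0 :* y := :0) refl (v (punchIn p k)) ⟩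
        0# ∎
      t≈0 : t ≈ 0#
      t≈0 = trans (x-y≈0⇒x≈y t-s≈0) (∙-zeroˡ z coefficient z≈0)

    gram-positiveDefinite : PositiveDefinite B → PositiveDefinite (gram B w)
    gram-positiveDefinite posdef z z≤0 = proj₂ (independent 0# z λ k → begin
      0# * v k + combination z w k  ≈⟨ solve 2 (λ y z → :0 :* y :+ z := z) refl (v k) (combination z w k) ⟩
      combination z w k             ≈⟨ posdef (combination z w) (≤-respˡ (sym (form-combination B w z z)) z≤0) k ⟩
      0#                            ∎)

    Q : Mat (suc n)
    Q zero    = v
    Q (suc i) = w i

    -- A kernel vector `y` has dot product zero with `v`, so each `w i` reduces on it to the
    -- coordinate at `punchIn p i`; these vanish, and `v` then takes care of the coordinate at `p`.
    detQ≉0 : Δ Q ≉ 0#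
    detQ≉0 detQ≈0 with singular⇒kernel Q detQ≈0
    ... | y , q , y≉0 , Qy≈0 = y≉0 (y≈0 q)
      where
      off≈0 : ∀ i → y (punchIn p i) ≈ 0#
      off≈0 i = begin
        y (punchIn p i)
          ≈⟨ I-row (punchIn p i) y ⟨
        I (punchIn p i) ∙ y
          ≈⟨ solve 2 (λ x s → x := (:1 :* x :+ s :* :0)) refl (I (punchIn p i) ∙ y) (- coefficient i) ⟩
        1# * (I (punchIn p i) ∙ y) + - coefficient i * 0#
          ≈⟨ +-congˡ (*-congˡ (Qy≈0 zero)) ⟨
        1# * (I (punchIn p i) ∙ y) + - coefficient i * (v ∙ y)
          ≈⟨ ∙-linearˡ 1# (I (punchIn p i)) (- coefficient i) v y ⟨
        w i ∙ y
          ≈⟨ Qy≈0 (suc i) ⟩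
        0# ∎

      off≈0′ : ∀ q → q ≢ p → y q ≈ 0#
      off≈0′ q q≢p = trans (reflexive (≡.cong y (≡.sym (Fin.punchIn-punchOut (q≢p ∘ ≡.sym)))))
                           (off≈0 (punchOut (q≢p ∘ ≡.sym)))

      y≈0 : ∀ q → y q ≈ 0#
      y≈0 q with q Fin.≟ p
      ... | no q≢p     = off≈0′ q q≢p
      ... | yes ≡.refl = xy≈0⇒y≈0 vₚ≉0 (trans
        (sym (sum-single {f = λ k → v k * y k} q (λ k k≢q →
          trans (*-congˡ (off≈0′ k k≢q)) (zeroʳ (v k))))) (Qy≈0 zero))

    -- For the transpose a kernel vector is a linear relation between `v` and the `w i`, which
    -- `independent` excludes.
    detQᵀ≉0 : Δ (λ i j → Q j i) ≉ 0#
    detQᵀ≉0 detQᵀ≈0 with singular⇒kernel (λ i j → Q j i) detQᵀ≈0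
    ... | y , q , y≉0 , Qᵀy≈0 = y≉0 (y≈0 q)
      where
      y≈0′ = independent (y zero) (y ∘ suc) λ k → trans
        (+-cong (*-comm (y zero) (v k)) (∙-comm (y ∘ suc) (λ i → w i k))) (Qᵀy≈0 k)
      y≈0 : ∀ q → y q ≈ 0#
      y≈0 zero    = proj₁ y≈0′
      y≈0 (suc i) = proj₂ y≈0′ i

    κ : Carrier
    κ = Δ Q * Δ (λ i j → Q j i)

    κ≉0 : κ ≉ 0#
    κ≉0 = *-nonzero detQ≉0 detQᵀ≉0

    -- In the basis `Q` the first row of the pencil is zero outside the corner `(x - a) * β`,
    -- because every `w j` is orthogonal to `v` for both forms. The determinants of the base change
    -- make up `κ`.
    deflate : ∀ x → κ * Δ (pencil x B M) ≈ (x - a) * (β * Δ (pencil x (gram B w) (gram M w)))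
    deflate x = begin
      Δ Q * Δ Qᵀ * Δ A
        ≈⟨ solve 3 (λ q r d → q :* r :* d := q :* (d :* r)) refl (Δ Q) (Δ Qᵀ) (Δ A) ⟩
      Δ Q * (Δ A * Δ Qᵀ)
        ≈⟨ det-gram A Q ⟨
      Δ (gram A Q)
        ≈⟨ det-pivot (gram A Q) zero (λ where
             zero    0≢0 → contradiction ≡.refl 0≢0
             (suc j) _   → row j) ⟩
      1# * form A v v * Δ (minor (gram A Q) zero)
        ≈⟨ *-cong (trans (*-identityˡ _) corner)
             (det-cong (minor (gram A Q) zero) (pencil x (gram B w) (gram M w))
               λ i j → form-pencil x B M (w i) (w j)) ⟩
      (x - a) * β * Δ (pencil x (gram B w) (gram M w))
        ≈⟨ *-assoc _ _ _ ⟩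
      (x - a) * (β * Δ (pencil x (gram B w) (gram M w))) ∎
      where
      A = pencil x B M
      Qᵀ : Mat (suc n)
      Qᵀ i j = Q j i

      corner : form A v v ≈ (x - a) * β
      corner = begin
        form A v v             ≈⟨ form-pencil x B M v v ⟩
        x * β - form M v v     ≈⟨ +-congˡ (-‿cong (Myv≈ v)) ⟩
        x * β - a * β          ≈⟨ solve 3 (λ x a b → x :* b :- a :* b := (x :- a) :* b) refl x a β ⟩
        (x - a) * β            ∎

      row : ∀ j → form A v (w j) ≈ 0#
      row j = begin
        form A v (w j)                       ≈⟨ form-pencil x B M v (w j) ⟩
        x * form B v (w j) - form M v (w j)  ≈⟨ +-cong (*-congˡ (Bvw≈0 j)) (-‿cong (begin
          form M v (w j)       ≈⟨ form-sym M-sym v (w j) ⟩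
          form M (w j) v       ≈⟨ Myv≈ (w j) ⟩
          a * form B (w j) v   ≈⟨ *-congˡ (trans (form-sym B-sym (w j) v) (Bvw≈0 j)) ⟩
          a * 0#               ∎)) ⟩
        x * 0# - a * 0#                      ≈⟨ solve 2 (λ x a → x :* :0 :- a :* :0 := :0) refl x a ⟩
        0#                                   ∎

  -- Counting roots below a bound

  count-accept : ∀ {p} {P : Carrier → Set p} (P? : Decidable P) {n} x (xs : Vec Carrier n) →
    P x → count P? (x ∷ xs) ≡ suc (count P? xs)
  count-accept P? x xs px with P? x
  ... | yes _  = ≡.refl
  ... | no ¬px = contradiction px ¬px

  count-reject : ∀ {p} {P : Carrier → Set p} (P? : Decidable P) {n} x (xs : Vec Carrier n) →
    ¬ P x → count P? (x ∷ xs) ≡ count P? xs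
  count-reject P? x xs ¬px with P? x
  ... | yes px = contradiction px ¬px
  ... | no _   = ≡.refl

  infix 4 _<?_
  _<?_ : ∀ x y → Dec (x < y)
  _<?_ = <-decidable _≟_ _≤?_

  -- Eigenvectors are split off one at a time; if the eigenvalue is below b, then
  -- some functional does not vanish on the eigenvector and can be discarded.
  count-roots≤functionals : ∀ {n} (B M : Mat n) → IsSymmetric B → IsSymmetric M →
    PositiveDefinite B → ∀ κ → κ ≉ 0# → (λs : Vec Carrier n) →
    (∀ x → Δ (pencil x B M) ≈ κ * rootProduct λs x) →
    ∀ b k (f : Fin k → Vector Carrier n) →
    (∀ y → (∀ j → f j ∙ y ≈ 0#) → b * form B y y ≤ form M y y) →
    count (_<? b) λs ℕ.≤ k
  count-roots≤functionals B M B-sym M-sym posdef κ κ≉0 [] charPoly b k f semidef = z≤n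
  count-roots≤functionals {suc n} B M B-sym M-sym posdef κ κ≉0 (a ∷ λs) charPoly b k f semidef
    -- `a` is a root of the product, so the pencil at `a` is singular, and a kernel vector is the
    -- eigenvector to be split off.
    with singular⇒kernel (pencil a B M)
           (trans (charPoly a) (solve 3 (λ k a r → k :* ((a :- a) :* r) := :0) refl κ a (rootProduct λs a)))
  ... | v , p , vₚ≉0 , eigen = conclusion (a <? b) k f semidef
    where
    0<β : 0# < form B v v
    0<β = ≰⇒< λ β≤0 → vₚ≉0 (posdef v β≤0 p)
    β≉0 : form B v v ≉ 0#
    β≉0 β≈0 = proj₂ 0<β (sym β≈0)
    module D = Deflation B M B-sym M-sym a v p vₚ≉0 β≉0 eigen
    open D using (β; w)
    B′ = gram B w
    M′ = gram M w
    β⁻¹ = β ⁻¹[ β≉0 ]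

    -- By `deflate` both sides agree after multiplication with `x - a`; since they are polynomial in
    -- `x`, the factor can be removed at `x = a` as well. This is how a repeated root stays in the
    -- list.
    charPoly′ : ∀ x → Δ (pencil x B′ M′) ≈ β⁻¹ * (D.κ * κ) * rootProduct λs x
    charPoly′ x = x-y≈0⇒x≈y (trans
      (solve 2 (λ d r → d :- r := d :+ :- :1 :* r) refl
        (Δ (pencil x B′ M′)) (β⁻¹ * (D.κ * κ) * rootProduct λs x))
      (cancel-root poly a (λ x → begin
      (x - a) * (Δ (pencil x B′ M′) + - 1# * (β⁻¹ * (D.κ * κ) * rootProduct λs x))
        ≈⟨ solve 6 (λ y d b l k r → y :* (d :+ :- :1 :* (b :* (l :* k) :* r))
             := :1 :* (y :* d) :- b :* (l :* (k :* (y :* r)))) refl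
             (x - a) (Δ (pencil x B′ M′)) β⁻¹ D.κ κ (rootProduct λs x) ⟩
      1# * ((x - a) * Δ (pencil x B′ M′)) - β⁻¹ * (D.κ * (κ * ((x - a) * rootProduct λs x)))
        ≈⟨ +-cong (*-congʳ (sym (trans (*-comm β⁻¹ β) (⁻¹-inverse β≉0))))
             (-‿cong (*-congˡ (trans (*-congˡ (sym (charPoly x))) (D.deflate x)))) ⟩
      β⁻¹ * β * ((x - a) * Δ (pencil x B′ M′)) - β⁻¹ * ((x - a) * (β * Δ (pencil x B′ M′)))
        ≈⟨ solve 4 (λ c b y d → c :* b :* (y :* d) :- c :* (y :* (b :* d)) := :0) refl
             β⁻¹ β (x - a) (Δ (pencil x B′ M′)) ⟩
      0# ∎) x))
      where
      poly : IsPolynomial (λ x → Δ (pencil x B′ M′) + - 1# * (β⁻¹ * (D.κ * κ) * rootProduct λs x))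
      poly = isPolynomial-+
        (isPolynomial-det (λ x → pencil x B′ M′) (λ i j → isPolynomial-linear (B′ i j) (M′ i j)))
        (isPolynomial-* (isPolynomial-const (- 1#))
          (isPolynomial-* (isPolynomial-const (β⁻¹ * (D.κ * κ))) (isPolynomial-rootProduct λs)))

    κ′≉0 : β⁻¹ * (D.κ * κ) ≉ 0#
    κ′≉0 = *-nonzero
      (λ β⁻¹≈0 → 0≉1 (trans (sym (trans (*-congˡ β⁻¹≈0) (zeroʳ β))) (⁻¹-inverse β≉0)))
      (*-nonzero D.κ≉0 κ≉0)

    recurse : ∀ k (f : Fin k → Vector Carrier (suc n)) →
      (∀ z → (∀ j → f j ∙ combination z w ≈ 0#) → b * form B′ z z ≤ form M′ z z) →
      count (_<? b) λs ℕ.≤ k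
    recurse k f semidef = count-roots≤functionals B′ M′
      (gram-symmetric w B-sym) (gram-symmetric w M-sym) (D.gram-positiveDefinite posdef)
      (β⁻¹ * (D.κ * κ)) κ′≉0 λs charPoly′ b k (λ j l → f j ∙ w l) λ z f≈0 → semidef z λ j → begin
        f j ∙ combination z w     ≈⟨ ∙-comm (f j) (combination z w) ⟩
        combination z w ∙ f j     ≈⟨ combination-∙ z w (f j) ⟩
        z ∙ (λ l → w l ∙ f j)     ≈⟨ ∙-comm z (λ l → w l ∙ f j) ⟩
        (λ l → w l ∙ f j) ∙ z     ≈⟨ ∙-congʳ (λ l → w l ∙ f j) (λ l → f j ∙ w l) z (λ l → ∙-comm (w l) (f j)) ⟩
        (λ l → f j ∙ w l) ∙ z     ≈⟨ f≈0 j ⟩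
        0#                        ∎

    -- Pythagoras, applied below to `B` and to `M`: the complement is orthogonal to the eigenvector
    -- for both.
    square : ∀ (A : Mat (suc n)) u s → form A u v ≈ 0# → form A v u ≈ 0# →
      let y = λ i → 1# * u i + s * v i in form A y y ≈ form A u u + s * s * form A v v
    square A u s uv≈0 vu≈0 = begin
      form A y y
        ≈⟨ form-linearˡ A 1# u s v y ⟩
      1# * form A u y + s * form A v y
        ≈⟨ +-cong (*-congˡ (form-linearʳ A u 1# u s v)) (*-congˡ (form-linearʳ A v 1# u s v)) ⟩
      1# * (1# * form A u u + s * form A u v) + s * (1# * form A v u + s * form A v v)
        ≈⟨ +-cong (*-congˡ (+-congˡ (*-congˡ uv≈0))) (*-congˡ (+-congʳ (*-congˡ vu≈0))) ⟩
      1# * (1# * form A u u + s * 0#) + s * (1# * 0# + s * form A v v)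
        ≈⟨ solve 3 (λ x s y → :1 :* (:1 :* x :+ s :* :0) :+ s :* (:1 :* :0 :+ s :* y) := x :+ s :* s :* y)
             refl (form A u u) s (form A v v) ⟩
      form A u u + s * s * form A v v ∎
      where
      y : Vector Carrier (suc n)
      y i = 1# * u i + s * v i

    conclusion : Dec (a < b) → ∀ k (f : Fin k → Vector Carrier (suc n)) →
      (∀ y → (∀ j → f j ∙ y ≈ 0#) → b * form B y y ≤ form M y y) →
      count (_<? b) (a ∷ λs) ℕ.≤ k
    -- This root is not counted, so all `k` functionals are kept and only restricted to the
    -- orthogonal complement.
    conclusion (no a≮b) k f semidef rewrite count-reject (_<? b) a λs a≮b = recurse k f λ z f≈0 →
      ≤-respˡ (*-congˡ (form-combination B w z z))
        (≤-respʳ (form-combination M w z z) (semidef (combination z w) f≈0))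
    conclusion (yes a<b) k f semidef with firstNonzero (λ j → f j ∙ v)
    -- If every functional vanished at `v`, the hypothesis would give `b * β ≤ a * β`, against
    -- `a < b` and `0 < β`.
    ... | inj₂ fv≈0 = contradiction a<b
      (≤-<-contradiction (*-cancelʳ-≤ 0<β (≤-respʳ (D.Myv≈ v) (semidef v fv≈0))))
    conclusion (yes a<b) (suc k) f semidef | inj₁ (j , φ≉0)
      rewrite count-accept (_<? b) a λs a<b = s≤s (recurse k g semidef′)
      where
      φ = f j ∙ v
      φ⁻¹ = φ ⁻¹[ φ≉0 ]
      -- The multiple of `f j` is chosen to make `g i` vanish at `v`, so that the `g i` do not
      -- notice a correction of their argument along `v`.
      g : Fin k → Vector Carrier (suc n)
      g i l = 1# * f (punchIn j i) l + - (f (punchIn j i) ∙ v * φ⁻¹) * f j l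

      semidef′ : ∀ z → (∀ i → g i ∙ combination z w ≈ 0#) → b * form B′ z z ≤ form M′ z z
      semidef′ z g≈0 = ≤-respˡ (*-congˡ (form-combination B w z z))
        (≤-respʳ (form-combination M w z z) (≤-trans below-y above-y))
        where
        u = combination z w
        -- Chosen so that `f j` vanishes at u + s v; the other functionals then vanish there because
        -- `g` vanishes at `u`.
        s = - (φ⁻¹ * (f j ∙ u))
        y : Vector Carrier (suc n)
        y i = 1# * u i + s * v i

        fⱼy≈0 : f j ∙ y ≈ 0#
        fⱼy≈0 = begin
          f j ∙ y
            ≈⟨ ∙-linearʳ (f j) 1# u s v ⟩
          1# * (f j ∙ u) + - (φ⁻¹ * (f j ∙ u)) * φ
            ≈⟨ solve 3 (λ x c p → :1 :* x :+ :- (c :* x) :* p := x :- (p :* c) :* x) refl (f j ∙ u) φ⁻¹ φ ⟩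
          f j ∙ u - (φ * φ⁻¹) * (f j ∙ u)
            ≈⟨ +-congˡ (-‿cong (trans (*-congʳ (⁻¹-inverse φ≉0)) (*-identityˡ _))) ⟩
          f j ∙ u - f j ∙ u
            ≈⟨ -‿inverseʳ _ ⟩
          0# ∎

        fᵢy≈0 : ∀ i → f (punchIn j i) ∙ y ≈ 0#
        fᵢy≈0 i = begin
          fᵢ ∙ y
            ≈⟨ ∙-linearʳ fᵢ 1# u s v ⟩
          1# * (fᵢ ∙ u) + - (φ⁻¹ * (f j ∙ u)) * (fᵢ ∙ v)
            ≈⟨ solve 4 (λ x c y q → :1 :* x :+ :- (c :* y) :* q := :1 :* x :+ :- (q :* c) :* y) refl
                 (fᵢ ∙ u) φ⁻¹ (f j ∙ u) (fᵢ ∙ v) ⟩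
          1# * (fᵢ ∙ u) + - (fᵢ ∙ v * φ⁻¹) * (f j ∙ u)
            ≈⟨ ∙-linearˡ 1# fᵢ (- (fᵢ ∙ v * φ⁻¹)) (f j) u ⟨
          g i ∙ u
            ≈⟨ g≈0 i ⟩
          0# ∎
          where fᵢ = f (punchIn j i)

        f≈0 : ∀ i → f i ∙ y ≈ 0#
        f≈0 i with i Fin.≟ j
        ... | yes ≡.refl = fⱼy≈0
        ... | no i≢j = trans (reflexive (≡.cong (λ i → f i ∙ y) (≡.sym (Fin.punchIn-punchOut (i≢j ∘ ≡.sym)))))
                             (fᵢy≈0 (punchOut (i≢j ∘ ≡.sym)))

        Bvu≈0 : form B v u ≈ 0#
        Bvu≈0 = D.orthogonal z
        Buv≈0 : form B u v ≈ 0#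
        Buv≈0 = trans (form-sym B-sym u v) Bvu≈0
        Muv≈0 : form M u v ≈ 0#
        Muv≈0 = trans (D.Myv≈ u) (trans (*-congˡ Buv≈0) (zeroʳ a))
        Mvu≈0 : form M v u ≈ 0#
        Mvu≈0 = trans (form-sym M-sym v u) Muv≈0

        -- The chain is b B(u,u) = b B(y,y) - s² b β ≤ b B(y,y) - s² a β ≤ M(y,y) - s² a β = M(u,u).
        -- Its first inequality is where the eigenvalue being below `b` pays for the discarded
        -- functional.
        below-y : b * form B u u ≤ b * form B y y - s * s * (a * β)
        below-y = 0≤y-x⇒x≤y (≤-respʳ
          (trans (solve 5 (λ s a b e x → s :* s :* ((b :- a) :* e)
                    := b :* (x :+ s :* s :* e) :- s :* s :* (a :* e) :- b :* x) refl s a b β (form B u u))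
                 (+-congʳ (+-congʳ (*-congˡ (sym (square B u s Buv≈0 Bvu≈0))))))
          (*-nonNegative (x*x-nonNegative s)
            (*-nonNegative (x≤y⇒0≤y-x (proj₁ a<b)) (proj₁ 0<β))))

        above-y : b * form B y y - s * s * (a * β) ≤ form M u u
        above-y = ≤-respʳ (begin
          form M y y - s * s * (a * β)
            ≈⟨ +-cong (square M u s Muv≈0 Mvu≈0) (-‿cong (*-congˡ (sym (D.Myv≈ v)))) ⟩
          form M u u + s * s * form M v v - s * s * form M v v
            ≈⟨ solve 2 (λ x y → x :+ y :- y := x) refl (form M u u) (s * s * form M v v) ⟩
          form M u u ∎)
          (+-monoˡ-≤ (- (s * s * (a * β))) (semidef y f≈0))

  -- Weighted Laplacians

  -- For `g` the distance matrix this is `distanceLaplacian` by definition; the generality allows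
  -- distances to be compared with simpler weights.
  laplacian : ∀ {n} → Mat n → Mat n
  laplacian g u v = diag ℝ (λ v → sum λ u → g u v) u v - g u v

  diag≈ : ∀ {n} (t : Vector Carrier n) i j → diag ℝ t i j ≈ t i * I i j
  diag≈ t i j with i Fin.≟ j
  ... | yes ≡.refl = sym (trans (*-congˡ (I-on i)) (*-identityʳ (t i)))
  ... | no  i≢j    = sym (trans (*-congˡ (I-off i≢j)) (zeroʳ (t i)))

  I-symmetric : ∀ {n} → IsSymmetric (I {n})
  I-symmetric zero    zero    = refl
  I-symmetric zero    (suc j) = refl
  I-symmetric (suc i) zero    = refl
  I-symmetric (suc i) (suc j) = I-symmetric i j

  laplacian-∙ : ∀ {n} (g : Mat n) u z → laplacian g u ∙ z ≈ sum (λ w → g w u) * z u - g u ∙ z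
  laplacian-∙ g u z = begin
    laplacian g u ∙ z
      ≈⟨ ∙-congʳ (laplacian g u) (λ v → t * I u v + - 1# * g u v) z (λ v → trans
           (+-congʳ (diag≈ (λ v → sum λ w → g w v) u v))
           (solve 2 (λ x y → x :- y := x :+ :- :1 :* y) refl (t * I u v) (g u v))) ⟩
    (λ v → t * I u v + - 1# * g u v) ∙ z
      ≈⟨ ∙-linearˡ t (I u) (- 1#) (g u) z ⟩
    t * (I u ∙ z) + - 1# * (g u ∙ z)
      ≈⟨ +-congʳ (*-congˡ (I-row u z)) ⟩
    t * z u + - 1# * (g u ∙ z)
      ≈⟨ solve 2 (λ x y → x :+ :- :1 :* y := x :- y) refl (t * z u) (g u ∙ z) ⟩
    t * z u - g u ∙ z ∎
    where t = sum λ w → g w u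

  -- The diagonal entries of g cancel.
  laplacian-cong : ∀ {n} {g h : Mat n} → (∀ {u v} → u ≢ v → g u v ≈ h u v) →
    ∀ u v → laplacian g u v ≈ laplacian h u v
  laplacian-cong {suc n} {g} {h} g≈h u v with u Fin.≟ v
  ... | no  u≢v    = +-congˡ (-‿cong (g≈h u≢v))
  ... | yes ≡.refl = trans (diagonal g) (trans
    (sum-cong-≋ λ w → g≈h (Fin.punchInᵢ≢i u w)) (sym (diagonal h)))
    where
    diagonal : ∀ (g : Mat (suc n)) → sum (λ w → g w u) - g u u ≈ sum (λ w → g (punchIn u w) u)
    diagonal g = trans (+-congʳ (sum-remove {i = u} (λ w → g w u)))
      (solve 2 (λ x y → (x :+ y) :- x := y) refl (g u u) (sum λ w → g (punchIn u w) u))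

  laplacian-symmetric : ∀ {n} {g : Mat n} → IsSymmetric g → IsSymmetric (laplacian g)
  laplacian-symmetric {g = g} g-sym u v = +-cong (diag-symmetric u v) (-‿cong (g-sym u v))
    where
    t = λ v → sum λ u → g u v
    diag-symmetric : IsSymmetric (diag ℝ t)
    diag-symmetric u v with u Fin.≟ v | v Fin.≟ u
    ... | yes ≡.refl | yes _   = refl
    ... | no  _      | no  _   = refl
    ... | yes u≡v    | no v≢u  = contradiction (≡.sym u≡v) v≢u
    ... | no  u≢v    | yes v≡u = contradiction (≡.sym v≡u) u≢v

  laplacian-ones : ∀ {n} {g : Mat n} → IsSymmetric g → ∀ u → laplacian g u ∙ (λ _ → 1#) ≈ 0#
  laplacian-ones {g = g} g-sym u = begin
    laplacian g u ∙ (λ _ → 1#)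
      ≈⟨ laplacian-∙ g u (λ _ → 1#) ⟩
    sum (λ w → g w u) * 1# - g u ∙ (λ _ → 1#)
      ≈⟨ +-cong (*-identityʳ _) (-‿cong (sum-cong-≋ λ w → trans (*-identityʳ (g u w)) (g-sym u w))) ⟩
    sum (λ w → g w u) - sum (λ w → g w u)
      ≈⟨ -‿inverseʳ _ ⟩
    0# ∎

  energy : ∀ {n} → Mat n → Vector Carrier n → Carrier
  energy g y = sum λ u → sum λ v → g u v * ((y u - y v) * (y u - y v))

  -- Expanding the square gives the diagonal part twice and the mixed part with coefficient -2. The
  -- factor 2 arises because the sum runs over ordered pairs.
  energy≈form : ∀ {n} {g : Mat n} → IsSymmetric g → ∀ y →
    energy g y ≈ (1# + 1#) * form (laplacian g) y y
  energy≈form {n} {g} g-sym y = begin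
    energy g y
      ≈⟨ sum-cong-≋ row ⟩
    sum (λ u → A u + (B u + C u))
      ≈⟨ ∑-distrib-+ A (λ u → B u + C u) ⟩
    sum A + sum (λ u → B u + C u)
      ≈⟨ +-congˡ (∑-distrib-+ B C) ⟩
    sum A + (sum B + sum C)
      ≈⟨ +-congˡ (+-cong sumB sumC) ⟩
    sum A + (sum A + - (1# + 1#) * form g y y)
      ≈⟨ solve 2 (λ a f → a :+ (a :+ :- (:1 :+ :1) :* f) := (:1 :+ :1) :* (:1 :* a :+ :- :1 :* f))
           refl (sum A) (form g y y) ⟩
    (1# + 1#) * (1# * sum A + - 1# * form g y y)
      ≈⟨ *-congˡ (∙-linearʳ y 1# (λ u → t u * y u) (- 1#) (λ u → g u ∙ y)) ⟨
    (1# + 1#) * (y ∙ (λ u → 1# * (t u * y u) + - 1# * (g u ∙ y)))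
      ≈⟨ *-congˡ (∙-congˡ y (λ u → 1# * (t u * y u) + - 1# * (g u ∙ y)) (λ u → laplacian g u ∙ y)
           (λ u → trans (solve 2 (λ a b → :1 :* a :+ :- :1 :* b := a :- b) refl (t u * y u) (g u ∙ y))
                        (sym (laplacian-∙ g u y)))) ⟩
    (1# + 1#) * form (laplacian g) y y ∎
    where
    t A B C : Vector Carrier n
    t u = sum λ w → g w u
    A u = y u * (t u * y u)
    B u = g u ∙ (λ v → y v * y v)
    C u = - (1# + 1#) * (y u * (g u ∙ y))

    row : ∀ u → sum (λ v → g u v * ((y u - y v) * (y u - y v))) ≈ A u + (B u + C u)
    row u = begin
      g u ∙ (λ v → (y u - y v) * (y u - y v))
        ≈⟨ ∙-congˡ (g u) (λ v → (y u - y v) * (y u - y v))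
             (λ v → y u * y u * 1# + 1# * (1# * (y v * y v) + - (1# + 1#) * y u * y v))
             (λ v → solve 2 (λ a b → (a :- b) :* (a :- b) :=
                a :* a :* :1 :+ :1 :* (:1 :* (b :* b) :+ :- (:1 :+ :1) :* a :* b)) refl (y u) (y v)) ⟩
      g u ∙ (λ v → y u * y u * 1# + 1# * (1# * (y v * y v) + - (1# + 1#) * y u * y v))
        ≈⟨ ∙-linearʳ (g u) (y u * y u) (λ _ → 1#) 1# (λ v → 1# * (y v * y v) + - (1# + 1#) * y u * y v) ⟩
      y u * y u * (g u ∙ (λ _ → 1#)) + 1# * (g u ∙ (λ v → 1# * (y v * y v) + - (1# + 1#) * y u * y v))
        ≈⟨ +-cong
             (*-congˡ (sum-cong-≋ λ w → trans (*-identityʳ (g u w)) (g-sym u w)))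
             (*-congˡ (∙-linearʳ (g u) 1# (λ v → y v * y v) (- (1# + 1#) * y u) y)) ⟩
      y u * y u * t u + 1# * (1# * B u + - (1# + 1#) * y u * (g u ∙ y))
        ≈⟨ solve 4 (λ a t b c → a :* a :* t :+ :1 :* (:1 :* b :+ :- (:1 :+ :1) :* a :* c)
             := a :* (t :* a) :+ (b :+ :- (:1 :+ :1) :* (a :* c))) refl (y u) (t u) (B u) (g u ∙ y) ⟩
      A u + (B u + C u) ∎

    sumB : sum B ≈ sum A
    sumB = begin
      sum B
        ≈⟨ ∑-comm (λ u v → g u v * (y v * y v)) ⟩
      sum (λ v → sum λ u → g u v * (y v * y v))
        ≈⟨ sum-cong-≋ (λ v → *-distribʳ-sum (y v * y v) (λ u → g u v)) ⟨
      sum (λ v → t v * (y v * y v))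
        ≈⟨ sum-cong-≋ (λ v → solve 2 (λ t y → t :* (y :* y) := y :* (t :* y)) refl (t v) (y v)) ⟩
      sum A ∎

    sumC : sum C ≈ - (1# + 1#) * form g y y
    sumC = sym (*-distribˡ-sum (- (1# + 1#)) (λ u → y u * (g u ∙ y)))

  energy-mono : ∀ {n} {g h : Mat n} → (∀ {u v} → u ≢ v → g u v ≤ h u v) → ∀ y → energy g y ≤ energy h y
  energy-mono {g = g} {h} g≤h y = sum-mono λ u → sum-mono λ v → term u v
    where
    vanish : ∀ g u → g * ((y u - y u) * (y u - y u)) ≈ 0#
    vanish g u = solve 2 (λ g y → g :* ((y :- y) :* (y :- y)) := :0) refl g (y u)
    term : ∀ u v → g u v * ((y u - y v) * (y u - y v)) ≤ h u v * ((y u - y v) * (y u - y v))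
    term u v with u Fin.≟ v
    ... | yes ≡.refl = ≤-reflexive (trans (vanish (g u u) u) (sym (vanish (h u u) u)))
    ... | no  u≢v    = *-monoʳ-≤ (x*x-nonNegative (y u - y v)) (g≤h u≢v)

  -- Entry by entry the Laplacians do not compare, since larger weights lower the entries off the
  -- diagonal. In `energy`, however, the weights multiply squares.
  laplacian-mono : ∀ {n} {g h : Mat n} → IsSymmetric g → IsSymmetric h →
    (∀ {u v} → u ≢ v → g u v ≤ h u v) → ∀ y → form (laplacian g) y y ≤ form (laplacian h) y y
  laplacian-mono g-sym h-sym g≤h y = *-cancelʳ-≤ 0<2
    (≤-respˡ (trans (energy≈form g-sym y) (*-comm _ _))
      (≤-respʳ (trans (energy≈form h-sym y) (*-comm _ _)) (energy-mono g≤h y)))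
    where
    0<2 : 0# < 1# + 1#
    0<2 = +-nonNegative 0≤1 0≤1 ,
      λ 0≈2 → fromℕ-suc≉0 1 (trans (+-congˡ (+-identityʳ 1#)) (sym 0≈2))

  -- The weights of complete split graphs

  indicator : ∀ {n} → Subset n → Vector Carrier n
  indicator T v = if lookup T v then 1# else 0#

  indicator-∈ : ∀ {n} {T : Subset n} {v} → v ∈ T → indicator T v ≈ 1#
  indicator-∈ v∈T rewrite []=⇒lookup v∈T = refl

  indicator-∉ : ∀ {n} {T : Subset n} {v} → v ∉ T → indicator T v ≈ 0#
  indicator-∉ {T = inside ∷ T}  {zero}  v∉T = contradiction here v∉T
  indicator-∉ {T = outside ∷ T} {zero}  v∉T = refl
  indicator-∉ {T = _ ∷ T}       {suc v} v∉T = indicator-∉ {T = T} (v∉T ∘ there)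

  sum-indicator : ∀ {n} (T : Subset n) → sum (indicator T) ≈ fromℕ ∣ T ∣
  sum-indicator []            = refl
  sum-indicator (inside ∷ T)  = +-congˡ (sum-indicator T)
  sum-indicator (outside ∷ T) = trans (+-identityˡ _) (sum-indicator T)

  -- The distances in a complete split graph with independent set T; the diagonal
  -- entries differ, but they do not influence the Laplacian.
  splitWeight : ∀ {n} → Subset n → Mat n
  splitWeight T u v = 1# + indicator T u * indicator T v

  splitWeight-symmetric : ∀ {n} (T : Subset n) → IsSymmetric (splitWeight T)
  splitWeight-symmetric T u v = +-congˡ (*-comm _ _)

  splitWeight-∙ : ∀ {n} (T : Subset n) u z →
    splitWeight T u ∙ z ≈ sum z + indicator T u * (indicator T ∙ z)
  splitWeight-∙ T u z = begin
    splitWeight T u ∙ z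
      ≈⟨ ∙-congʳ (splitWeight T u) (λ v → 1# * 1# + indicator T u * indicator T v) z
           (λ v → +-congʳ (sym (*-identityˡ 1#))) ⟩
    (λ v → 1# * 1# + indicator T u * indicator T v) ∙ z
      ≈⟨ ∙-linearˡ 1# (λ _ → 1#) (indicator T u) (indicator T) z ⟩
    1# * ((λ _ → 1#) ∙ z) + indicator T u * (indicator T ∙ z)
      ≈⟨ +-congʳ (trans (*-identityˡ _) (sum-cong-≋ λ v → *-identityˡ (z v))) ⟩
    sum z + indicator T u * (indicator T ∙ z) ∎

  sum-ones : ∀ n → sum {n} (λ _ → 1#) ≈ fromℕ n
  sum-ones n = sum-replicate n

  laplacian-splitWeight-∙ : ∀ {n} (T : Subset n) u z →
    laplacian (splitWeight T) u ∙ z ≈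
    (fromℕ n + indicator T u * fromℕ ∣ T ∣) * z u - (sum z + indicator T u * (indicator T ∙ z))
  laplacian-splitWeight-∙ {n} T u z = begin
    laplacian (splitWeight T) u ∙ z
      ≈⟨ laplacian-∙ (splitWeight T) u z ⟩
    sum (λ w → splitWeight T w u) * z u - splitWeight T u ∙ z
      ≈⟨ +-cong (*-congʳ column) (-‿cong (splitWeight-∙ T u z)) ⟩
    (fromℕ n + indicator T u * fromℕ ∣ T ∣) * z u - (sum z + indicator T u * (indicator T ∙ z)) ∎
    where
    column : sum (λ w → splitWeight T w u) ≈ fromℕ n + indicator T u * fromℕ ∣ T ∣
    column = begin
      sum (λ w → splitWeight T w u)
        ≈⟨ ∑-distrib-+ (λ _ → 1#) (λ w → indicator T w * indicator T u) ⟩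
      sum {n} (λ _ → 1#) + sum (λ w → indicator T w * indicator T u)
        ≈⟨ +-cong (sum-ones n) (sym (*-distribʳ-sum (indicator T u) (indicator T))) ⟩
      fromℕ n + sum (indicator T) * indicator T u
        ≈⟨ +-congˡ (trans (*-congʳ (sum-indicator T)) (*-comm _ _)) ⟩
      fromℕ n + indicator T u * fromℕ ∣ T ∣ ∎

  -- Under the two conditions both `sum y` and `indicator T ∙ y` vanish, which leaves the diagonal;
  -- on the support of `y` it is `n + ∣ T ∣`.
  splitWeight-form : ∀ {n} (T : Subset n) y → (∀ v → v ∉ T → y v ≈ 0#) → sum y ≈ 0# →
    form (laplacian (splitWeight T)) y y ≈ fromℕ (n ℕ.+ ∣ T ∣) * (y ∙ y)
  splitWeight-form {n} T y supported sum≈0 = begin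
    y ∙ (λ u → laplacian (splitWeight T) u ∙ y)
      ≈⟨ sum-cong-≋ term ⟩
    sum (λ u → fromℕ (n ℕ.+ ∣ T ∣) * (y u * y u))
      ≈⟨ *-distribˡ-sum (fromℕ (n ℕ.+ ∣ T ∣)) (λ u → y u * y u) ⟨
    fromℕ (n ℕ.+ ∣ T ∣) * (y ∙ y) ∎
    where
    s = indicator T
    sy≈y : ∀ u → s u * y u ≈ y u
    sy≈y u with u ∈? T
    ... | yes u∈T = trans (*-congʳ (indicator-∈ u∈T)) (*-identityˡ (y u))
    ... | no  u∉T = trans (*-congˡ (supported u u∉T)) (trans (zeroʳ (s u)) (sym (supported u u∉T)))

    term : ∀ u → y u * (laplacian (splitWeight T) u ∙ y) ≈ fromℕ (n ℕ.+ ∣ T ∣) * (y u * y u)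
    term u = begin
      y u * (laplacian (splitWeight T) u ∙ y)
        ≈⟨ *-congˡ (laplacian-splitWeight-∙ T u y) ⟩
      y u * ((fromℕ n + s u * fromℕ ∣ T ∣) * y u - (sum y + s u * (s ∙ y)))
        ≈⟨ *-congˡ (+-congˡ (-‿cong (+-cong sum≈0 (*-congˡ (trans (sum-cong-≋ sy≈y) sum≈0))))) ⟩
      y u * ((fromℕ n + s u * fromℕ ∣ T ∣) * y u - (0# + s u * 0#))
        ≈⟨ solve 4 (λ y n s a → y :* ((n :+ s :* a) :* y :- (:0 :+ s :* :0))
             := n :* (y :* y) :+ a :* ((s :* y) :* y)) refl (y u) (fromℕ n) (s u) (fromℕ ∣ T ∣) ⟩
      fromℕ n * (y u * y u) + fromℕ ∣ T ∣ * (s u * y u * y u)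
        ≈⟨ +-congˡ (*-congˡ (*-congʳ (sy≈y u))) ⟩
      fromℕ n * (y u * y u) + fromℕ ∣ T ∣ * (y u * y u)
        ≈⟨ distribʳ _ _ _ ⟨
      (fromℕ n + fromℕ ∣ T ∣) * (y u * y u)
        ≈⟨ *-congʳ (×-homo-+ 1# n ∣ T ∣) ⟨
      fromℕ (n ℕ.+ ∣ T ∣) * (y u * y u) ∎

  -- Eigenvalues of distance Laplacians

  I-positiveDefinite : ∀ {n} → PositiveDefinite (I {n})
  I-positiveDefinite {n} y Iy≤0 i = decidable-stable (y i ≟ 0#) λ yᵢ≉0 →
    yᵢ≉0 (xy≈0⇒y≈0 yᵢ≉0 (sum-zero⇒zero {f = λ i → y i * y i} (λ i → x*x-nonNegative (y i))
      (≤-respˡ (form-I y) Iy≤0) i))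
    where
    form-I : ∀ y → form (I {n}) y y ≈ y ∙ y
    form-I y = ∙-congˡ y (λ i → I i ∙ y) y (λ i → I-row i y)

  charPoly≈det-pencil : ∀ {n} (M : Mat n) x → charPoly ℝ M x ≈ Δ (pencil x I M)
  charPoly≈det-pencil M x = det-cong (λ i j → diag ℝ (λ _ → x) i j - M i j) (pencil x I M)
    λ i j → +-congʳ (diag≈ (λ _ → x) i j)

  rootProduct-zero : ∀ {n} (λs : Vec Carrier n) x → rootProduct λs x ≈ 0# → ∃ λ i → lookup λs i ≈ x
  rootProduct-zero []       x 1≈0 = contradiction (sym 1≈0) 0≉1
  rootProduct-zero (a ∷ λs) x eq  = split-head (a ≟ x)
    where
    split-head : Dec (a ≈ x) → ∃ λ i → lookup (a ∷ λs) i ≈ x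
    split-head (yes a≈x) = zero , a≈x
    split-head (no  a≉x) =
      let i , λᵢ≈x = rootProduct-zero λs x (xy≈0⇒y≈0 (λ x-a≈0 → a≉x (sym (x-y≈0⇒x≈y x-a≈0))) eq)
      in suc i , λᵢ≈x

  count-mono : ∀ {p q} {P : Carrier → Set p} {Q : Carrier → Set q} (P? : Decidable P) (Q? : Decidable Q) →
    (∀ {x} → P x → Q x) → ∀ {n} (xs : Vec Carrier n) → count P? xs ℕ.≤ count Q? xs
  count-mono P? Q? P⊆Q []       = z≤n
  count-mono P? Q? P⊆Q (x ∷ xs) with P? x | Q? x
  ... | yes px | yes _  = s≤s (count-mono P? Q? P⊆Q xs)
  ... | yes px | no ¬qx = contradiction (P⊆Q px) ¬qx
  ... | no _   | yes _  = ℕ.m≤n⇒m≤1+n (count-mono P? Q? P⊆Q xs)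
  ... | no _   | no _   = count-mono P? Q? P⊆Q xs

  count-strict : ∀ {p q} {P : Carrier → Set p} {Q : Carrier → Set q} (P? : Decidable P) (Q? : Decidable Q) →
    (∀ {x} → P x → Q x) → ∀ {n} (xs : Vec Carrier n) i → Q (lookup xs i) → ¬ P (lookup xs i) →
    count P? xs ℕ.< count Q? xs
  count-strict P? Q? P⊆Q (x ∷ xs) zero qx ¬px
    rewrite count-reject P? x xs ¬px | count-accept Q? x xs qx = s≤s (count-mono P? Q? P⊆Q xs)
  count-strict P? Q? P⊆Q (x ∷ xs) (suc i) qxᵢ ¬pxᵢ with P? x | Q? x
  ... | yes px | yes _  = s≤s (count-strict P? Q? P⊆Q xs i qxᵢ ¬pxᵢ)
  ... | yes px | no ¬qx = contradiction (P⊆Q px) ¬qx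
  ... | no _   | yes _  = ℕ.m≤n⇒m≤1+n (count-strict P? Q? P⊆Q xs i qxᵢ ¬pxᵢ)
  ... | no _   | no _   = count-strict P? Q? P⊆Q xs i qxᵢ ¬pxᵢ

  module _ {n} (G : Graph n) (conn : Connected G) where

    private
      D = distanceMatrix ℝ G conn
      L = distanceLaplacian ℝ G conn

    distanceMatrix-symmetric : IsSymmetric D
    distanceMatrix-symmetric u v = reflexive (≡.cong fromℕ (dist-sym G conn u v))

    distanceLaplacian-symmetric : IsSymmetric L
    distanceLaplacian-symmetric = laplacian-symmetric {g = D} distanceMatrix-symmetric

    splitWeight≤distance : ∀ {T} → Independent G T → ∀ {u v} → u ≢ v → splitWeight T u v ≤ D u v
    splitWeight≤distance {T} indep {u} {v} u≢v with u ∈? T | v ∈? T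
    ... | yes u∈T | yes v∈T = ≤-respˡ
      (sym (+-congˡ (trans (*-cong (indicator-∈ u∈T) (indicator-∈ v∈T)) (solve 0 (:1 :* :1 := :1 :+ :0) refl))))
      (fromℕ-mono (dist≥2 G conn u≢v (indep u∈T v∈T)))
    ... | no u∉T | _ = ≤-respˡ
      (sym (+-congˡ (trans (*-congʳ (indicator-∉ u∉T)) (zeroˡ _))))
      (fromℕ-mono (dist≥1 G conn u≢v))
    ... | yes _ | no v∉T = ≤-respˡ
      (sym (+-congˡ (trans (*-congˡ (indicator-∉ v∉T)) (zeroʳ _))))
      (fromℕ-mono (dist≥1 G conn u≢v))

    module _ (λs : Vec Carrier n) (eigenvalues : Eigenvalues ℝ L λs) where

      private
        charPoly≈ : ∀ x → Δ (pencil x I L) ≈ rootProduct λs x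
        charPoly≈ x = trans (sym (charPoly≈det-pencil L x)) (eigenvalues x)

      -- The all-ones vector lies in the kernel of `L`, so the characteristic polynomial vanishes at
      -- 0 and so does some factor of `rootProduct`. The argument names a nonzero coordinate of that
      -- vector.
      zero-eigenvalue : Fin n → ∃ λ i → lookup λs i ≈ 0#
      zero-eigenvalue p = rootProduct-zero λs 0# (trans (sym (charPoly≈ 0#))
        (kernel⇒0 det-isAlternating (pencil 0# I L) (λ _ → 1#) p (0≉1 ∘ sym) λ r → begin
          pencil 0# I L r ∙ (λ _ → 1#)
            ≈⟨ ∙-congʳ (pencil 0# I L r) (λ j → 0# * I r j + - 1# * L r j) (λ _ → 1#)
                 (λ j → solve 2 (λ x y → :0 :* x :- y := :0 :* x :+ :- :1 :* y) refl (I r j) (L r j)) ⟩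
          (λ j → 0# * I r j + - 1# * L r j) ∙ (λ _ → 1#)
            ≈⟨ ∙-linearˡ 0# (I r) (- 1#) (L r) (λ _ → 1#) ⟩
          0# * (I r ∙ (λ _ → 1#)) + - 1# * (L r ∙ (λ _ → 1#))
            ≈⟨ +-congˡ (*-congˡ (laplacian-ones {g = D} distanceMatrix-symmetric r)) ⟩
          0# * (I r ∙ (λ _ → 1#)) + - 1# * 0#
            ≈⟨ solve 1 (λ x → :0 :* x :+ :- :1 :* :0 := :0) refl (I r ∙ (λ _ → 1#)) ⟩
          0# ∎))

      -- The Laplacian is at least n + ∣ T ∣ on the vectors with support in T and sum 0.
      count-below : ∀ T → Independent G T → count (_<? fromℕ (n ℕ.+ ∣ T ∣)) λs ℕ.≤ suc (n ℕ.∸ ∣ T ∣)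
      count-below T indep = ≡.subst (λ k → count (_<? b) λs ℕ.≤ suc k) (Sub.∣∁p∣≡n∸∣p∣ T)
        (count-roots≤functionals I L I-symmetric distanceLaplacian-symmetric I-positiveDefinite
          1# (0≉1 ∘ sym) λs (λ x → trans (charPoly≈ x) (sym (*-identityˡ _))) b (suc ∣ ∁ T ∣) f semidef)
        where
        b = fromℕ (n ℕ.+ ∣ T ∣)
        e = proj₁ (enumerate (∁ T))
        f : Fin (suc ∣ ∁ T ∣) → Vector Carrier n
        f zero    = λ _ → 1#
        f (suc j) = I (e j)

        semidef : ∀ y → (∀ j → f j ∙ y ≈ 0#) → b * form I y y ≤ form L y y
        semidef y f≈0 = ≤-respˡ
          (trans (splitWeight-form T y supported sum≈0)
            (*-congˡ (sym (∙-congˡ y (λ i → I i ∙ y) y (λ i → I-row i y)))))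
          (laplacian-mono (splitWeight-symmetric T) distanceMatrix-symmetric
            (splitWeight≤distance indep) y)
          where
          sum≈0 : sum y ≈ 0#
          sum≈0 = trans (sum-cong-≋ (λ v → sym (*-identityˡ (y v)))) (f≈0 zero)
          supported : ∀ v → v ∉ T → y v ≈ 0#
          supported v v∉T with proj₂ (enumerate (∁ T)) (Sub.x∉p⇒x∈∁p v∉T)
          ... | j , eⱼ≡v = trans (sym (I-row v y))
            (trans (reflexive (≡.cong (λ v → I v ∙ y) (≡.sym eⱼ≡v))) (f≈0 (suc j)))

    count≤n∸∣T∣ : ∀ T → Independent G T → ∀ k →
      DLEigenvalueCount ℝ G conn (fromℕ n) (fromℕ (n ℕ.+ ∣ T ∣)) k → k ℕ.≤ n ℕ.∸ ∣ T ∣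
    count≤n∸∣T∣ T indep k (λs , eigenvalues , count≡k) =
      ≡.subst (ℕ._≤ n ℕ.∸ ∣ T ∣) count≡k (bound (0 ℕ.<? n))
      where
      a = fromℕ n
      b = fromℕ (n ℕ.+ ∣ T ∣)
      inInterval? : Decidable (λ x → a ≤ x × x < b)
      inInterval? x = _∈?[_,_⟩ ℝ x a b
      bound : Dec (0 ℕ.< n) → count inInterval? λs ℕ.≤ n ℕ.∸ ∣ T ∣
      -- Without vertices there is no eigenvalue 0 to discount, but the list of eigenvalues is empty
      -- too.
      bound (no  0≮n) = ℕ.≤-trans (count≤n inInterval? λs) (ℕ.≤-trans (ℕ.≮⇒≥ 0≮n) z≤n)
      bound (yes 0<n) = ℕ.≤-pred (ℕ.≤-trans
        (count-strict inInterval? (_<? b) proj₂ λs i λᵢ<b λᵢ∉[a,b⟩)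
        (count-below λs eigenvalues T indep))
        where
        zeroEigenvalue = zero-eigenvalue λs eigenvalues (fromℕ< 0<n)
        i = proj₁ zeroEigenvalue
        λᵢ≈0 = proj₂ zeroEigenvalue
        0<b : 0# < b
        0<b = fromℕ-mono-< {0} {n ℕ.+ ∣ T ∣} (ℕ.<-≤-trans 0<n (ℕ.m≤m+n n ∣ T ∣))
        λᵢ<b : lookup λs i < b
        λᵢ<b = ≤-respˡ (sym λᵢ≈0) (proj₁ 0<b) , λ λᵢ≈b → proj₂ 0<b (trans (sym λᵢ≈0) λᵢ≈b)
        λᵢ∉[a,b⟩ : ¬ (a ≤ lookup λs i × lookup λs i < b)
        λᵢ∉[a,b⟩ (a≤λᵢ , _) = ≤-<-contradiction (≤-respʳ λᵢ≈0 a≤λᵢ) (fromℕ-mono-< {0} {n} 0<n)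

  -- Spectra of complete split graphs

  det-diagonal : ∀ {n} (t : Vector Carrier n) → Δ (λ i j → t i * I i j) ≈ product t
  det-diagonal {zero}  t = refl
  det-diagonal {suc n} t = begin
    Δ (λ i j → t i * I i j)
      ≈⟨ det-pivot (λ i j → t i * I i j) zero (λ where
           zero    0≢0 → contradiction ≡.refl 0≢0
           (suc j) _   → zeroʳ (t zero)) ⟩
    1# * (t zero * 1#) * Δ (λ i j → t (suc i) * I i j)
      ≈⟨ *-cong (trans (*-identityˡ _) (*-identityʳ _)) (det-diagonal (t ∘ suc)) ⟩
    product t ∎

  -- With the eigenvectors as rows, `P ⊗ X` equals `E ⊗ P` for a diagonal `E`; in the determinants
  -- `Δ P` cancels. So multiplicities can be read off from any eigenbasis, orthogonal or not.
  eigenbasis⇒det : ∀ {n} {M P : Mat n} {Λ : Vector Carrier n} → IsSymmetric M →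
    (∀ v u → M u ∙ P v ≈ Λ v * P v u) → Δ P ≉ 0# →
    ∀ x → Δ (pencil x I M) ≈ product λ v → x - Λ v
  eigenbasis⇒det {n} {M} {P} {Λ} M-sym eigen detP≉0 x = *-cancelˡ detP≉0 (begin
    Δ P * Δ X                 ≈⟨ det-⊗ P X ⟨
    Δ (P ⊗ X)                 ≈⟨ det-cong (P ⊗ X) (E ⊗ P) entry ⟩
    Δ (E ⊗ P)                 ≈⟨ det-⊗ E P ⟩
    Δ E * Δ P                 ≈⟨ *-congʳ (det-diagonal t) ⟩
    product t * Δ P           ≈⟨ *-comm _ _ ⟩
    Δ P * product t           ∎)
    where
    t : Vector Carrier n
    t v = x - Λ v
    X E : Mat n
    X = pencil x I M
    E i j = t i * I i j

    entry : ∀ i j → (P ⊗ X) i j ≈ (E ⊗ P) i j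
    entry i j = begin
      P i ∙ (λ k → X k j)
        ≈⟨ ∙-comm (P i) (λ k → X k j) ⟩
      (λ k → X k j) ∙ P i
        ≈⟨ ∙-congʳ (λ k → X k j) (λ k → x * I j k + - 1# * M j k) (P i) (λ k → trans
             (+-cong (*-congˡ (I-symmetric k j)) (-‿cong (M-sym k j)))
             (solve 2 (λ a m → a :- m := a :+ :- :1 :* m) refl (x * I j k) (M j k))) ⟩
      (λ k → x * I j k + - 1# * M j k) ∙ P i
        ≈⟨ ∙-linearˡ x (I j) (- 1#) (M j) (P i) ⟩
      x * (I j ∙ P i) + - 1# * (M j ∙ P i)
        ≈⟨ +-cong (*-congˡ (I-row j (P i))) (*-congˡ (eigen i j)) ⟩
      x * P i j + - 1# * (Λ i * P i j)
        ≈⟨ solve 3 (λ x p l → x :* p :+ :- :1 :* (l :* p) := (x :- l) :* p) refl x (P i j) (Λ i) ⟩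
      t i * P i j
        ≈⟨ *-congˡ (I-row i (λ k → P k j)) ⟨
      t i * (I i ∙ (λ k → P k j))
        ≈⟨ *-distribˡ-sum (t i) (λ k → I i k * P k j) ⟩
      sum (λ k → t i * (I i k * P k j))
        ≈⟨ sum-cong-≋ (λ k → sym (*-assoc (t i) (I i k) (P k j))) ⟩
      E i ∙ (λ k → P k j) ∎

  rootProduct-tabulate : ∀ {n} (Λ : Vector Carrier n) x →
    rootProduct (tabulate Λ) x ≈ product λ v → x - Λ v
  rootProduct-tabulate {zero}  Λ x = refl
  rootProduct-tabulate {suc n} Λ x = *-congˡ (rootProduct-tabulate (Λ ∘ suc) x)

  count-tabulate : ∀ {p} {P : Carrier → Set p} (P? : Decidable P) {n} (Λ : Vector Carrier n) T →
    (∀ {v} → v ∈ T → ¬ P (Λ v)) → (∀ {v} → v ∉ T → P (Λ v)) →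
    count P? (tabulate Λ) ≡ ∣ ∁ T ∣
  count-tabulate P? Λ []            ∈⇒¬P ∉⇒P = ≡.refl
  count-tabulate P? Λ (inside ∷ T)  ∈⇒¬P ∉⇒P = ≡.trans
    (count-reject P? (Λ zero) (tabulate (Λ ∘ suc)) (∈⇒¬P here))
    (count-tabulate P? (Λ ∘ suc) T (∈⇒¬P ∘ there) (λ v∉T → ∉⇒P λ { (there v∈T) → v∉T v∈T }))
  count-tabulate P? Λ (outside ∷ T) ∈⇒¬P ∉⇒P = ≡.trans
    (count-accept P? (Λ zero) (tabulate (Λ ∘ suc)) (∉⇒P λ ()))
    (≡.cong suc (count-tabulate P? (Λ ∘ suc) T (∈⇒¬P ∘ there) (λ v∉T → ∉⇒P λ { (there v∈T) → v∉T v∈T })))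

  -- An eigenbasis: the all-ones vector for the eigenvalue 0, the vectors
  -- e_v - e_v₀ with v ∈ T for n + ∣ T ∣, and n e_v - (1 , … , 1) with v ∉ T for n.
  module SplitSpectrum {n} (T : Subset n) (v₀ : Fin n) (v₀∈T : v₀ ∈ T) where

    private
      s = indicator T
      M = laplacian (splitWeight T)
      ones : Vector Carrier n
      ones _ = 1#

    1≤∣T∣ : 1 ℕ.≤ ∣ T ∣
    1≤∣T∣ = ≡.subst (ℕ._≤ ∣ T ∣) (Sub.∣⁅x⁆∣≡1 v₀) (Sub.p⊆q⇒∣p∣≤∣q∣ λ v∈ →
      ≡.subst (_∈ T) (≡.sym (Sub.x∈⁅y⁆⇒x≡y v₀ v∈)) v₀∈T)

    0<n : 0 ℕ.< n
    0<n = ℕ.≤-trans 1≤∣T∣ (Sub.∣p∣≤n T)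

    fromℕ≉0 : ∀ {k} → 0 ℕ.< k → fromℕ k ≉ 0#
    fromℕ≉0 {suc k} _ = fromℕ-suc≉0 k

    -- The decisions are arguments, so that proofs can match on them instead of on comparisons
    -- buried in `eigenvector`. The coefficients are written out to fit the linearity lemmas for
    -- `_∙_`.
    vectorFor : ∀ v → Dec (v ≡ v₀) → Dec (v ∈ T) → Vector Carrier n
    vectorFor v (yes _) _       k = 1#
    vectorFor v (no _)  (yes _) k = 1# * I v k + - 1# * I v₀ k
    vectorFor v (no _)  (no _)  k = fromℕ n * I v k + - 1# * ones k

    valueFor : ∀ {v} → Dec (v ≡ v₀) → Dec (v ∈ T) → Carrier
    valueFor (yes _) _       = 0#
    valueFor (no _)  (yes _) = fromℕ (n ℕ.+ ∣ T ∣)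
    valueFor (no _)  (no _)  = fromℕ n

    eigenvector : Mat n
    eigenvector v = vectorFor v (v Fin.≟ v₀) (v ∈? T)

    eigenvalue : Vector Carrier n
    eigenvalue v = valueFor {v} (v Fin.≟ v₀) (v ∈? T)

    private
      ones∙ : ∀ (z : Vector Carrier n) → sum z ≈ ones ∙ z
      ones∙ z = sum-cong-≋ λ v → sym (*-identityˡ (z v))

      ∙-I : ∀ (y : Vector Carrier n) v → y ∙ I v ≈ y v
      ∙-I y v = trans (∙-comm y (I v)) (I-row v y)

      s*I : ∀ v u → s u * I v u ≈ s v * I v u
      s*I v u with v Fin.≟ u
      ... | yes ≡.refl = refl
      ... | no  v≢u    = trans (trans (*-congˡ (I-off v≢u)) (zeroʳ (s u)))
                               (sym (trans (*-congˡ (I-off v≢u)) (zeroʳ (s v))))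

      s*I-∈ : ∀ {v} → v ∈ T → ∀ u → s u * I v u ≈ I v u
      s*I-∈ v∈T u = trans (s*I _ u) (trans (*-congʳ (indicator-∈ v∈T)) (*-identityˡ _))

      s*I-∉ : ∀ {v} → v ∉ T → ∀ u → s u * I v u ≈ 0#
      s*I-∉ v∉T u = trans (s*I _ u) (trans (*-congʳ (indicator-∉ v∉T)) (zeroˡ _))

    -- All vectors but the first have sum 0. For `v` in `T` also `s ∙ z` is 0, and multiplication by
    -- `s` fixes `z`; for `v` outside `T` it is `- ∣ T ∣`, which cancels the excess `∣ T ∣` of the
    -- diagonal on `T`, where `z` is -1.
    eigen-equation : ∀ v d d′ u → M u ∙ vectorFor v d d′ ≈ valueFor {v} d d′ * vectorFor v d d′ u
    eigen-equation v (yes _) _ u =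
      trans (laplacian-ones {g = splitWeight T} (splitWeight-symmetric T) u) (sym (zeroˡ 1#))
    eigen-equation v (no _) (yes v∈T) u = begin
      M u ∙ z
        ≈⟨ laplacian-splitWeight-∙ T u z ⟩
      (fromℕ n + s u * fromℕ ∣ T ∣) * z u - (sum z + s u * (s ∙ z))
        ≈⟨ +-congˡ (-‿cong (+-cong
             (trans (ones∙ z) (trans (∙-linearʳ ones 1# (I v) (- 1#) (I v₀))
               (+-cong (*-congˡ (∙-I ones v)) (*-congˡ (∙-I ones v₀)))))
             (*-congˡ (trans (∙-linearʳ s 1# (I v) (- 1#) (I v₀))
               (+-cong (*-congˡ (trans (∙-I s v) (indicator-∈ v∈T)))
                       (*-congˡ (trans (∙-I s v₀) (indicator-∈ v₀∈T)))))))) ⟩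
      (fromℕ n + s u * fromℕ ∣ T ∣) * (1# * I v u + - 1# * I v₀ u) -
      (1# * 1# + - 1# * 1# + s u * (1# * 1# + - 1# * 1#))
        ≈⟨ solve 5 (λ n s a x y →
             (n :+ s :* a) :* (:1 :* x :+ :- :1 :* y) :-
             (:1 :* :1 :+ :- :1 :* :1 :+ s :* (:1 :* :1 :+ :- :1 :* :1))
             := n :* (:1 :* x :+ :- :1 :* y) :+ a :* (:1 :* (s :* x) :+ :- :1 :* (s :* y)))
             refl (fromℕ n) (s u) (fromℕ ∣ T ∣) (I v u) (I v₀ u) ⟩
      fromℕ n * z u + fromℕ ∣ T ∣ * (1# * (s u * I v u) + - 1# * (s u * I v₀ u))
        ≈⟨ +-congˡ (*-congˡ (+-cong (*-congˡ (s*I-∈ v∈T u)) (*-congˡ (s*I-∈ v₀∈T u)))) ⟩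
      fromℕ n * z u + fromℕ ∣ T ∣ * z u
        ≈⟨ distribʳ _ _ _ ⟨
      (fromℕ n + fromℕ ∣ T ∣) * z u
        ≈⟨ *-congʳ (×-homo-+ 1# n ∣ T ∣) ⟨
      fromℕ (n ℕ.+ ∣ T ∣) * z u ∎
      where
      z : Vector Carrier n
      z k = 1# * I v k + - 1# * I v₀ k
    eigen-equation v (no _) (no v∉T) u = begin
      M u ∙ z
        ≈⟨ laplacian-splitWeight-∙ T u z ⟩
      (fromℕ n + s u * fromℕ ∣ T ∣) * z u - (sum z + s u * (s ∙ z))
        ≈⟨ +-congˡ (-‿cong (+-cong
             (trans (ones∙ z) (trans (∙-linearʳ ones (fromℕ n) (I v) (- 1#) ones)
               (+-cong (*-congˡ (∙-I ones v)) (*-congˡ (trans (sym (ones∙ ones)) (sum-ones n))))))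
             (*-congˡ (trans (∙-linearʳ s (fromℕ n) (I v) (- 1#) ones)
               (+-cong (*-congˡ (trans (∙-I s v) (indicator-∉ v∉T)))
                       (*-congˡ (trans (∙-comm s ones) (trans (sym (ones∙ s)) (sum-indicator T))))))))) ⟩
      (fromℕ n + s u * fromℕ ∣ T ∣) * (fromℕ n * I v u + - 1# * 1#) -
      (fromℕ n * 1# + - 1# * fromℕ n + s u * (fromℕ n * 0# + - 1# * fromℕ ∣ T ∣))
        ≈⟨ solve 4 (λ n s a x →
             (n :+ s :* a) :* (n :* x :+ :- :1 :* :1) :-
             (n :* :1 :+ :- :1 :* n :+ s :* (n :* :0 :+ :- :1 :* a))
             := n :* (n :* x :+ :- :1 :* :1) :+ a :* n :* (s :* x))
             refl (fromℕ n) (s u) (fromℕ ∣ T ∣) (I v u) ⟩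
      fromℕ n * z u + fromℕ ∣ T ∣ * fromℕ n * (s u * I v u)
        ≈⟨ +-congˡ (trans (*-congˡ (s*I-∉ v∉T u)) (zeroʳ _)) ⟩
      fromℕ n * z u + 0#
        ≈⟨ +-identityʳ _ ⟩
      fromℕ n * z u ∎
      where
      z : Vector Carrier n
      z k = fromℕ n * I v k + - 1# * ones k

    -- The rows say that a kernel vector `y` has sum 0, is constant on `T` and vanishes outside `T`;
    -- hence `∣ T ∣` times its value at `v₀` is 0.
    eigenvectors-independent : Δ eigenvector ≉ 0#
    eigenvectors-independent det≈0 with singular⇒kernel eigenvector det≈0
    ... | y , q , y≉0 , Py≈0 = y≉0 (trans (y≈ q) (trans (*-congˡ y₀≈0) (zeroʳ (s q))))
      where
      sum≈0′ : ∀ d d′ → vectorFor v₀ d d′ ∙ y ≈ 0# → ones ∙ y ≈ 0#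
      sum≈0′ (yes _)    _ eq = eq
      sum≈0′ (no v₀≢v₀) _ eq = contradiction ≡.refl v₀≢v₀
      sum≈0 : ones ∙ y ≈ 0#
      sum≈0 = sum≈0′ (v₀ Fin.≟ v₀) (v₀ ∈? T) (Py≈0 v₀)

      y≈′ : ∀ v d d′ → vectorFor v d d′ ∙ y ≈ 0# → y v ≈ s v * y v₀
      y≈′ v (yes ≡.refl) _ eq = sym (trans (*-congʳ (indicator-∈ v₀∈T)) (*-identityˡ _))
      y≈′ v (no _) (yes v∈T) eq = trans
        (x-y≈0⇒x≈y (begin
          y v - y v₀
            ≈⟨ solve 2 (λ a b → a :- b := :1 :* a :+ :- :1 :* b) refl (y v) (y v₀) ⟩
          1# * y v + - 1# * y v₀
            ≈⟨ +-cong (*-congˡ (I-row v y)) (*-congˡ (I-row v₀ y)) ⟨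
          1# * (I v ∙ y) + - 1# * (I v₀ ∙ y)
            ≈⟨ ∙-linearˡ 1# (I v) (- 1#) (I v₀) y ⟨
          (λ k → 1# * I v k + - 1# * I v₀ k) ∙ y
            ≈⟨ eq ⟩
          0# ∎))
        (sym (trans (*-congʳ (indicator-∈ v∈T)) (*-identityˡ _)))
      y≈′ v (no _) (no v∉T) eq = trans
        (xy≈0⇒y≈0 (fromℕ≉0 0<n) (begin
          fromℕ n * y v
            ≈⟨ solve 2 (λ n a → n :* a := n :* a :+ :- :1 :* :0) refl (fromℕ n) (y v) ⟩
          fromℕ n * y v + - 1# * 0#
            ≈⟨ +-cong (*-congˡ (I-row v y)) (*-congˡ sum≈0) ⟨
          fromℕ n * (I v ∙ y) + - 1# * (ones ∙ y)
            ≈⟨ ∙-linearˡ (fromℕ n) (I v) (- 1#) ones y ⟨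
          (λ k → fromℕ n * I v k + - 1# * ones k) ∙ y
            ≈⟨ eq ⟩
          0# ∎))
        (sym (trans (*-congʳ (indicator-∉ v∉T)) (zeroˡ _)))

      y≈ : ∀ v → y v ≈ s v * y v₀
      y≈ v = y≈′ v (v Fin.≟ v₀) (v ∈? T) (Py≈0 v)

      y₀≈0 : y v₀ ≈ 0#
      y₀≈0 = xy≈0⇒y≈0 (fromℕ≉0 1≤∣T∣) (begin
        fromℕ ∣ T ∣ * y v₀          ≈⟨ *-congʳ (sum-indicator T) ⟨
        sum s * y v₀                ≈⟨ *-distribʳ-sum (y v₀) s ⟩
        sum (λ v → s v * y v₀)      ≈⟨ sum-cong-≋ (λ v → sym (y≈ v)) ⟩
        sum y                       ≈⟨ ones∙ y ⟩
        ones ∙ y                    ≈⟨ sum≈0 ⟩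
        0#                          ∎)

    eigenvalues : ∀ {L : Mat n} → (∀ u v → L u v ≈ M u v) → Eigenvalues ℝ L (tabulate eigenvalue)
    eigenvalues {L} L≈M x = begin
      charPoly ℝ L x
        ≈⟨ charPoly≈det-pencil L x ⟩
      Δ (pencil x I L)
        ≈⟨ det-cong (pencil x I L) (pencil x I M) (λ u v → +-congˡ (-‿cong (L≈M u v))) ⟩
      Δ (pencil x I M)
        ≈⟨ eigenbasis⇒det {M = M} {eigenvector} {eigenvalue}
             (laplacian-symmetric {g = splitWeight T} (splitWeight-symmetric T))
             (λ v u → eigen-equation v (v Fin.≟ v₀) (v ∈? T) u) eigenvectors-independent x ⟩
      product (λ v → x - eigenvalue v)
        ≈⟨ rootProduct-tabulate eigenvalue x ⟨
      rootProduct (tabulate eigenvalue) x ∎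

    private
      a = fromℕ n
      b = fromℕ (n ℕ.+ ∣ T ∣)

    -- For `v` in `T` the eigenvalue is either 0, which lies below the interval, or the right end,
    -- which is excluded.
    eigenvalue-∈ : ∀ {v} → v ∈ T → ¬ (a ≤ eigenvalue v × eigenvalue v < b)
    eigenvalue-∈ {v} v∈T = go (v Fin.≟ v₀) (v ∈? T)
      where
      go : ∀ d d′ → ¬ (a ≤ valueFor {v} d d′ × valueFor {v} d d′ < b)
      go (yes _) _        (a≤0 , _) = ≤-<-contradiction a≤0 (fromℕ-mono-< {0} {n} 0<n)
      go (no _) (yes _)   (_ , b<b) = proj₂ b<b refl
      go (no _) (no v∉T) _         = v∉T v∈T

    eigenvalue-∉ : ∀ {v} → v ∉ T → a ≤ eigenvalue v × eigenvalue v < b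
    eigenvalue-∉ {v} v∉T = go (v Fin.≟ v₀) (v ∈? T)
      where
      go : ∀ d d′ → a ≤ valueFor {v} d d′ × valueFor {v} d d′ < b
      go (yes ≡.refl) _     = contradiction v₀∈T v∉T
      go (no _) (yes v∈T)   = contradiction v∈T v∉T
      go (no _) (no _)      = ≤-refl , fromℕ-mono-< (ℕ.m<m+n n 1≤∣T∣)

  split-eigenvalueCount : ∀ {n} {G : Graph n} {T} → IsSplit G T → 0 ℕ.< ∣ T ∣ → (conn : Connected G) →
    DLEigenvalueCount ℝ G conn (fromℕ n) (fromℕ (n ℕ.+ ∣ T ∣)) (n ℕ.∸ ∣ T ∣)
  split-eigenvalueCount {n} {G} {T} split 0<∣T∣ conn =
    tabulate eigenvalue ,
    eigenvalues {distanceLaplacian ℝ G conn} (laplacian-cong distance≈weight) ,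
    ≡.trans (count-tabulate (λ x → _∈?[_,_⟩ ℝ x _ _) eigenvalue T eigenvalue-∈ eigenvalue-∉)
            (Sub.∣∁p∣≡n∸∣p∣ T)
    where
    element : ∃ λ v → v ∈ T
    element = 0<∣T∣⇒∃∈ T 0<∣T∣
    open SplitSpectrum T (proj₁ element) (proj₂ element)

    distance≈weight : ∀ {u v} → u ≢ v → distanceMatrix ℝ G conn u v ≈ splitWeight T u v
    distance≈weight {u} {v} u≢v with u ∈? T | v ∈? T
    ... | yes u∈T | yes v∈T = trans
      (reflexive (≡.cong fromℕ (split-dist-independent split conn u≢v u∈T v∈T)))
      (sym (+-congˡ (trans (*-cong (indicator-∈ u∈T) (indicator-∈ v∈T)) (solve 0 (:1 :* :1 := :1 :+ :0) refl))))
    ... | no u∉T | _ = trans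
      (reflexive (≡.cong fromℕ (split-dist-joined split conn u≢v (u∉T ∘ proj₁))))
      (sym (+-congˡ (trans (*-congʳ (indicator-∉ u∉T)) (zeroˡ _))))
    ... | yes _ | no v∉T = trans
      (reflexive (≡.cong fromℕ (split-dist-joined split conn u≢v (v∉T ∘ proj₂))))
      (sym (+-congˡ (trans (*-congˡ (indicator-∉ v∉T)) (zeroʳ _))))

open import Data.Nat using (_+_; _∸_; _≤_)

theorem3p1 : ∀ {c ℓ₁ ℓ₂} (ℝ : RealNumbers c ℓ₁ ℓ₂) →
    let open RealNumbers ℝ using (fromℕ) in
      (∀ {n} (G : Graph n) (conn : Connected G) (α : ℕ) → IndependenceNumber G α →
        (∀ k → DLEigenvalueCount ℝ G conn (fromℕ n) (fromℕ (n + α)) k → k ≤ n ∸ α)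
        × ((α ≡ 1 ⊎ suc α ≡ n) →
            DLEigenvalueCount ℝ G conn (fromℕ n) (fromℕ (n + α)) (n ∸ α)
              ⇔ (G ≅ K n ⊎ G ≅ S n)))
      × (∀ n α → 2 ≤ α → 2 + α ≤ n →
          IndependenceNumber (SK n α) α
          × Σ (Connected (SK n α)) λ conn →
              DLEigenvalueCount ℝ (SK n α) conn (fromℕ n) (fromℕ (n + α)) (n ∸ α))
theorem3p1 ℝ = (λ G conn α isα → bound G conn isα , extremal G conn isα) , sharp
  where
  open RealNumbers ℝ using (fromℕ)

  bound : ∀ {n} (G : Graph n) (conn : Connected G) {α} → IndependenceNumber G α →
    ∀ k → DLEigenvalueCount ℝ G conn (fromℕ n) (fromℕ (n + α)) k → k ≤ n ∸ α
  bound G conn ((T , independent , ≡.refl) , _) = count≤n∸∣T∣ ℝ G conn T independent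

  -- Either value of `α` determines the graph, `K n` or `S n`, and exhibits it as a complete split
  -- graph, whose spectrum gives the count; so both sides of the equivalence hold.
  extremal : ∀ {n} (G : Graph n) (conn : Connected G) {α} → IndependenceNumber G α →
    (α ≡ 1 ⊎ suc α ≡ n) →
    DLEigenvalueCount ℝ G conn (fromℕ n) (fromℕ (n + α)) (n ∸ α) ⇔ (G ≅ K n ⊎ G ≅ S n)
  extremal G conn isα@((T , independent , ≡.refl) , _) (inj₁ ∣T∣≡1) = mk⇔
    (λ _ → inj₁ (complete⇒≅K {G = G} complete))
    (λ _ → split-eigenvalueCount ℝ
      (record { independent = independent ; joined = λ u≢v _ → complete u≢v })
      (ℕ.≤-reflexive (≡.sym ∣T∣≡1)) conn)
    where
    complete : ∀ {u v} → u ≢ v → Adj G u v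
    complete = independenceNumber-1⇒complete {G = G} (≡.subst (IndependenceNumber G) ∣T∣≡1 isα)
  extremal G conn isα@((T , independent , ≡.refl) , _) (inj₂ 1+∣T∣≡n) = mk⇔
    (λ _ → inj₂ (split⇒≅S independent 1+∣T∣≡n split))
    -- `n` is a successor, so some vertex exists, and its singleton forces the largest independent
    -- set `T` to be nonempty.
    (λ _ → split-eigenvalueCount ℝ split (independenceNumber>0 {G = G} isα (≡.subst Fin 1+∣T∣≡n zero)) conn)
    where
    split : IsSplit G T
    split = connected⇒split independent 1+∣T∣≡n conn

  sharp : ∀ n α → 2 ≤ α → 2 + α ≤ n → IndependenceNumber (SK n α) α ×
    Σ (Connected (SK n α)) λ conn →
      DLEigenvalueCount ℝ (SK n α) conn (fromℕ n) (fromℕ (n + α)) (n ∸ α)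
  sharp n α 2≤α 2+α≤n = SK-independenceNumber 1≤α α≤n , conn ,
    ≡.subst (λ a → DLEigenvalueCount ℝ (SK n α) conn (fromℕ n) (fromℕ (n + a)) (n ∸ a)) (∣below∣ α≤n)
      (split-eigenvalueCount ℝ (SK-isSplit n α) (≡.subst (1 ≤_) (≡.sym (∣below∣ α≤n)) 1≤α) conn)
    where
    1≤α : 1 ≤ α
    1≤α = ℕ.≤-trans (s≤s z≤n) 2≤α
    α<n : suc α ≤ n
    α<n = ℕ.≤-trans (ℕ.n≤1+n (suc α)) 2+α≤n
    α≤n : α ≤ n
    α≤n = ℕ.<⇒≤ α<n
    conn : Connected (SK n α)
    conn = SK-connected α<n
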